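{- Let $p>3$ be a prime and $q=p^s$ with $s$ a positive integer. Let $h(x)=b_3x^3+b_1x+b_0 \in \mathbb{F}_q[x]$ with $b_3\neq 0$, and let $\beta_0\in \mathbb{F}_q$. Let $\gamma_1, \gamma_2$ denote the critical points of $h$ (the roots of $h'$ in $\overline{\mathbb{F}}_q$, counted with multiplicity), and for each $n\ge 0$ let $\beta_n\in\overline{\mathbb{F}}_q$ be a root of $h^n(x)-\beta_0$. Then the pair $(h,\beta_0)$ is dynamically irreducible over $\mathbb{F}_q$ if and only if both of the following hold: (1) $-3\,(h^{n+1}(\gamma_1)-\beta_0)(h^{n+1}(\gamma_2)-\beta_0)$ is a non-zero square in $\mathbb{F}_q$ for all $n\geq 0$; and (2) for all $n\ge 0$, for $\mu_n\in \mathbb{F}_q(\beta_n)^\times$ such that $$-4\left(\frac{b_1}{b_3}\right)^3-27\left(\frac{b_0-\beta_n}{b_3}\right)^2=81\mu_n^2,$$ the element $$\frac{1}{2}\left(-\left(\frac{b_0-\beta_n}{b_3}\right)+\mu_n\sqrt{ -3}\right)$$ is not a cube in $\mathbb{F}_q(\sqrt{ -3},\beta_n)$ (where, in the case $b_1=0$, the sign of $\mu_n$ is chosen so that this element is non-zero).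
   Context: $\mathbb{F}_q$ is the finite field with $q$ elements, $\overline{\mathbb{F}}_q$ an algebraic closure, and $\sqrt{ -3}$ a fixed square root of $-3$ in $\overline{\mathbb{F}}_q$. For a polynomial $h$, $h^n$ denotes the $n$-fold composition of $h$ with itself, with $h^0(x)=x$. For a polynomial $h\in K[x]$ of degree at least $2$ over a field $K$ and $\beta\in K$, the pair $(h,\beta)$ is dynamically irreducible over $K$ if $h^n(x)-\beta$ is irreducible over $K$ for all positive integers $n$. -}

module Defs where

open import Algebra.Bundles using (CommutativeRing)
open import Algebra.Bundles.Raw using (RawRing; RawSemiring)
open import Algebra.Morphism.Structures using (IsRingMonomorphism)
import Algebra.Definitions.RawSemiring as RawSemiringDefinitions
open import Data.Fin.Base using (Fin)
open import Data.List.Base using (List; []; _∷_; map; foldr)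
open import Data.List.Relation.Unary.Any using (Any)
open import Data.Nat.Base using (ℕ; zero; suc; _<_)
open import Data.Product.Base using (∃; _×_)
open import Function.Bundles using (Inverse)
open import Level using (Level; _⊔_) renaming (suc to lsuc)
open import Relation.Binary.Core using (Rel)
open import Relation.Binary.Definitions using (Decidable)
open import Relation.Binary.PropositionalEquality.Properties using () renaming (setoid to ≡-setoid)
open import Relation.Nullary.Negation.Core using (¬_)

-- The value of 0# ⁻¹ is unspecified.
record Field (c ℓ : Level) : Set (lsuc (c ⊔ ℓ)) where
  infix 9 _⁻¹
  infixl 7 _/_

  field
    commutativeRing : CommutativeRing c ℓ

  open CommutativeRing commutativeRing public

  field
    1≉0        : 1# ≉ 0#
    _≟_        : Decidable _≈_
    _⁻¹        : Carrier → Carrier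
    ⁻¹-cong    : ∀ {x y} → x ≈ y → x ⁻¹ ≈ y ⁻¹
    *-inverseʳ : ∀ {x} → x ≉ 0# → x * x ⁻¹ ≈ 1#

  _/_ : Carrier → Carrier → Carrier
  x / y = x * y ⁻¹

  open RawSemiringDefinitions (RawRing.rawSemiring rawRing) public
    using (_^_) renaming (_×_ to _·_)

HasCardinality : ∀ {c ℓ} → Field c ℓ → ℕ → Set (c ⊔ ℓ)
HasCardinality F q = Inverse (Field.setoid F) (≡-setoid (Fin q))

-- Polynomials are lists of coefficients, constant term first; trailing zeros
-- are allowed, and ≈ₚ ignores them.
module Polynomial {c ℓ} (R : RawRing c ℓ) where
  open RawRing R

  infixl 7 _*ₚ_
  infixl 6 _+ₚ_ _-ₚ_
  infix  4 _≈ₚ_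
  infixr 9 _∘ₚ_ _^∘_

  Poly : Set c
  Poly = List Carrier

  coeff : Poly → ℕ → Carrier
  coeff []      _       = 0#
  coeff (a ∷ p) zero    = a
  coeff (a ∷ p) (suc i) = coeff p i

  _≈ₚ_ : Rel Poly ℓ
  p ≈ₚ q = ∀ i → coeff p i ≈ coeff q i

  C : Carrier → Poly
  C a = a ∷ []

  X : Poly
  X = 0# ∷ 1# ∷ []

  _+ₚ_ : Poly → Poly → Poly
  []      +ₚ q       = q
  (a ∷ p) +ₚ []      = a ∷ p
  (a ∷ p) +ₚ (b ∷ q) = (a + b) ∷ (p +ₚ q)

  _-ₚ_ : Poly → Poly → Poly
  p -ₚ q = p +ₚ map -_ q

  _*ₚ_ : Poly → Poly → Poly
  []      *ₚ q = []
  (a ∷ p) *ₚ q = map (a *_) q +ₚ (0# ∷ (p *ₚ q))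

  _∘ₚ_ : Poly → Poly → Poly
  []      ∘ₚ q = []
  (a ∷ p) ∘ₚ q = C a +ₚ q *ₚ (p ∘ₚ q)

  _^∘_ : Poly → ℕ → Poly
  h ^∘ zero  = X
  h ^∘ suc n = h ∘ₚ (h ^∘ n)

  eval : Poly → Carrier → Carrier
  eval []      x = 0#
  eval (a ∷ p) x = a + x * eval p x

  -- (a + X p)′ = p + X p′
  derivative : Poly → Poly
  derivative []      = []
  derivative (a ∷ p) = p +ₚ (0# ∷ derivative p)

  -- f = c ∏ (X - γ) with c ≠ 0: the list consists of all the roots of f,
  -- repeated according to multiplicity.
  RootsWithMultiplicity : Poly → List Carrier → Set (c ⊔ ℓ)
  RootsWithMultiplicity f γs =
    ∃ λ c → c ≉ 0# × f ≈ₚ foldr (λ γ g → (X -ₚ C γ) *ₚ g) (C c) γs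

  rawSemiringₚ : RawSemiring c ℓ
  rawSemiringₚ = record
    { Carrier = Poly ; _≈_ = _≈ₚ_ ; _+_ = _+ₚ_ ; _*_ = _*ₚ_ ; 0# = [] ; 1# = C 1# }

  open RawSemiringDefinitions rawSemiringₚ public using (Irreducible)

  -- Intended for h of degree at least 2.
  DynamicallyIrreducible : Poly → Carrier → Set (c ⊔ ℓ)
  DynamicallyIrreducible h β = ∀ n → 0 < n → Irreducible (h ^∘ n -ₚ C β)

module _ {a ℓ₁ b ℓ₂} (F : Field a ℓ₁) (K : Field b ℓ₂)
         (ι : Field.Carrier F → Field.Carrier K) where
  private
    module F  = Field F
    module F[X] = Polynomial F.rawRing
  open Field K
  open Polynomial rawRing

  record IsAlgebraicClosure : Set (a ⊔ ℓ₁ ⊔ b ⊔ ℓ₂) where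
    field
      isRingMonomorphism : IsRingMonomorphism F.rawRing rawRing ι
      algebraic : ∀ x → ∃ λ (f : F[X].Poly) →
                  ¬ (f F[X].≈ₚ []) × eval (map ι f) x ≈ 0#
      closed    : ∀ (f : Poly) → (∃ λ i → coeff f (suc i) ≉ 0#) →
                  ∃ λ x → eval f x ≈ 0#

  -- Adjoin xs is the subfield F(xs) of K.
  data Adjoin (xs : List Carrier) : Carrier → Set (a ⊔ b ⊔ ℓ₂) where
    base      : ∀ x → Adjoin xs (ι x)
    generator : ∀ {x} → Any (x ≈_) xs → Adjoin xs x
    resp      : ∀ {x y} → x ≈ y → Adjoin xs x → Adjoin xs y
    add       : ∀ {x y} → Adjoin xs x → Adjoin xs y → Adjoin xs (x + y)
    neg       : ∀ {x} → Adjoin xs x → Adjoin xs (- x)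
    mul       : ∀ {x y} → Adjoin xs x → Adjoin xs y → Adjoin xs (x * y)
    inv       : ∀ {x} → x ≉ 0# → Adjoin xs x → Adjoin xs (x ⁻¹)

{-# OPTIONS --safe #-}
module Submission where

-- Let φ be the Frobenius automorphism x ↦ x^q. A polynomial over F of degree d with
-- root α is irreducible iff φᵏα ≠ α for 0 < k < d, so everything is a statement about
-- φ-orbits of the roots β of hⁿ - β₀. Given such a β with 3ⁿ conjugates, put N = 3ⁿ and
-- ψ = φᴺ, whose fixed field is F(β). The roots of hⁿ⁺¹ - β₀ above β are the three roots
-- of the cubic h - β, and they have 3ⁿ⁺¹ conjugates iff ψ permutes them cyclically.
-- A cyclic permutation is even, which means that ψ fixes a square root ρ ≠ 0 of the
-- discriminant. The product of the conjugates of ρ is, up to a factor in F, a square root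
-- of -3 (hⁿ⁺¹(γ₁) - β₀)(hⁿ⁺¹(γ₂) - β₀), and it is fixed by φ iff ρ is fixed by ψ; this is
-- condition (1). Given that ψ acts by an even permutation, it is trivial iff some root of
-- the cubic lies in F(β); by Cardano's formula, which expresses a root and a cube root of
-- θ in terms of each other, this happens iff θ is a cube in F(√-3, β), which is
-- excluded by condition (2).

-- Field degrees and Galois groups are replaced by powers of φ acting on the algebraic closure. All
-- that ties φ to F is that it is a ring endomorphism whose fixed elements are those of F;
-- interpolation along an orbit turns this into minimal polynomials and into membership in F(β).
--
-- The roots βₙ of different levels are unrelated: h(βₙ₊₁) = βₙ need not hold. The induction climbs
-- from βₙ to some preimage of it and then moves over to βₙ₊₁, which is possible because a root with
-- 3ⁿ⁺¹ conjugates has all other roots among them.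
--
-- ψ may negate √-3, so a root of the cubic obtained from a cube root of θ in F(√-3, β) is at first
-- only known to be fixed by ψ². This suffices, since the square of a 3-cycle is not the identity.
--
-- The factor -3 in condition (1) survives because 3ⁿ is odd: each of the 3ⁿ conjugate discriminants
-- contributes -3 times a square of F, besides its critical values.
--
-- The choice of sign for b₁ = 0 is forced by θθ′ = -A³/27, where θ′ belongs to -μ: one of the two
-- is then 0, a cube that tells nothing about the roots.

open import Defs
open import Algebra.Definitions.RawMagma using (_,_)
open import Algebra.Bundles using (CommutativeRing)
import Algebra.Morphism.Construct.Composition as Composition
import Algebra.Morphism.Construct.Identity as Identity
open import Algebra.Morphism.Structures using (IsRingHomomorphism; IsRingMonomorphism)
import Algebra.Properties.AbelianGroup as AbelianGroupProperties
import Algebra.Properties.CommutativeMonoid.Sum as SumProperties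
import Algebra.Properties.CommutativeSemiring.Binomial as Binomial
import Algebra.Properties.CommutativeSemiring.Exp as ExpProperties
import Algebra.Properties.Group as GroupProperties
import Algebra.Properties.Monoid.Mult as MonoidMultProperties
import Algebra.Properties.Ring as RingProperties
import Algebra.Properties.Semiring.Mult as MultProperties
import Algebra.Solver.Ring as RingSolver
open import Algebra.Solver.Ring.AlmostCommutativeRing using (_-Raw-AlmostCommutative⟶_; fromCommutativeRing)
open import Data.Empty using (⊥)
open import Data.Fin.Base as Fin using (Fin; zero; suc)
import Data.Fin.Permutation as Permutation
open import Data.Fin.Permutation using (Permutation)
import Data.Fin.Properties as Fin
import Data.Integer.Base as ℤ
open import Data.Integer.Base using (ℤ; +_; -[1+_]; _⊖_)
import Data.Integer.Properties as ℤ
open import Data.List.Base using ([]; _∷_; map)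
import Data.List.Relation.Unary.All as All
open import Data.List.Relation.Unary.All using (All; []; _∷_)
open import Data.List.Relation.Unary.Any using (Any; here; there)
open import Data.Maybe.Base as Maybe using (Maybe)
open import Data.Nat.Base as ℕ using (ℕ; zero; suc; _≤_; _<_; z≤n; s≤s; _!) renaming (_^_ to _^ℕ_)
open import Data.Nat.Combinatorics using () renaming (_C_ to _choose_)
import Data.Nat.Combinatorics as ℕ
import Data.Nat.Combinatorics.Specification as ℕ
open import Data.Nat.Coprimality using (coprime-Bézout; prime⇒coprime)
import Data.Nat.Divisibility as ℕ
open import Data.Nat.Divisibility using (_∣_; divides)
open import Data.Nat.DivMod using (_%_; m≡m%n+[m/n]*n; m%n<n; m/n*n≡m)
open import Data.Nat.GCD using (module Bézout)
open import Data.Nat.Induction using (<-rec)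
open import Data.Nat.Primality using (Prime; euclidsLemma; prime⇒nonTrivial)
import Data.Nat.Properties as ℕ
open import Data.Nat.Solver using (module +-*-Solver)
open import Data.Product.Base using (∃; ∃₂; _×_; _,_; proj₁; proj₂)
open import Data.Sum.Base as Sum using (_⊎_; inj₁; inj₂)
open import Function.Base using (_∘_)
open import Function.Bundles using (Inverse; _⇔_; mk⇔)
open import Relation.Binary.Definitions using (tri<; tri≈; tri>)
import Relation.Binary.PropositionalEquality.Core as ≡
open import Relation.Binary.PropositionalEquality.Core using (_≡_; _≢_)
import Relation.Binary.Reasoning.Setoid as SetoidReasoning
open import Relation.Nullary.Decidable.Core using (Dec; yes; no; dec⇒maybe; decidable-stable)
open import Relation.Nullary.Negation.Core using (¬_; contradiction)

-- A ring solver with integer coefficients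

module IntegerSolver {c ℓ} (R : CommutativeRing c ℓ) where
  open CommutativeRing R
  open import Algebra.Properties.Semiring.Mult semiring using (×1-homo-*) renaming (_×_ to _·_)
  open import Algebra.Properties.Monoid.Mult +-monoid using (×-homo-+)
  open RingProperties ring using (-‿distribˡ-*; -0#≈0#; -‿involutive; -‿+-comm)
  open SetoidReasoning setoid

  -- Reading `+ n` as `n · 1#` makes `con (+ 27)` denote literally the numeral `27 · 1#` of the
  -- goals.
  ⟦_⟧ᶻ : ℤ → Carrier
  ⟦ + n ⟧ᶻ      = n · 1#
  ⟦ -[1+ n ] ⟧ᶻ = - (suc n · 1#)

  private
    ⊖-homo : ∀ m n → ⟦ m ⊖ n ⟧ᶻ ≈ m · 1# + - (n · 1#)
    ⊖-homo zero    zero    = sym (-‿inverseʳ 0#)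
    ⊖-homo zero    (suc n) = sym (+-identityˡ _)
    ⊖-homo (suc m) zero    = sym (trans (+-congˡ -0#≈0#) (+-identityʳ _))
    ⊖-homo (suc m) (suc n) = begin
      ⟦ suc m ⊖ suc n ⟧ᶻ                    ≡⟨ ≡.cong ⟦_⟧ᶻ (ℤ.[1+m]⊖[1+n]≡m⊖n m n) ⟩
      ⟦ m ⊖ n ⟧ᶻ                            ≈⟨ ⊖-homo m n ⟩
      m · 1# - n · 1#                       ≈⟨ +-congʳ (+-identityʳ _) ⟨
      m · 1# + 0# - n · 1#                  ≈⟨ +-congʳ (+-congˡ (-‿inverseʳ 1#)) ⟨
      m · 1# + (1# - 1#) - n · 1#           ≈⟨ +-congʳ (+-assoc _ _ _) ⟨
      m · 1# + 1# - 1# - n · 1#             ≈⟨ +-congʳ (+-congʳ (+-comm _ _)) ⟩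
      1# + m · 1# - 1# - n · 1#             ≈⟨ +-assoc _ _ _ ⟩
      1# + m · 1# + (- 1# - n · 1#)         ≈⟨ +-congˡ (-‿+-comm _ _) ⟩
      1# + m · 1# - (1# + n · 1#)           ∎

    neg-homo : ∀ i → ⟦ ℤ.- i ⟧ᶻ ≈ - ⟦ i ⟧ᶻ
    neg-homo (+ zero)    = sym -0#≈0#
    neg-homo ℤ.+[1+ n ]  = refl
    neg-homo -[1+ n ]    = sym (-‿involutive _)

    +-homo : ∀ i j → ⟦ i ℤ.+ j ⟧ᶻ ≈ ⟦ i ⟧ᶻ + ⟦ j ⟧ᶻ
    +-homo (+ m)    (+ n)    = ×-homo-+ 1# m n
    +-homo (+ m)    -[1+ n ] = ⊖-homo m (suc n)
    +-homo -[1+ m ] (+ n)    = trans (⊖-homo n (suc m)) (+-comm _ _)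
    +-homo -[1+ m ] -[1+ n ] = begin
      - (1# + (1# + (m ℕ.+ n) · 1#))  ≈⟨ -‿cong (+-congˡ (+-congˡ (×-homo-+ 1# m n))) ⟩
      - (1# + (1# + (m · 1# + n · 1#))) ≈⟨ -‿cong (+-congˡ (trans (sym (+-assoc _ _ _)) (trans (+-congʳ (+-comm _ _))
          (+-assoc _ _ _)))) ⟩
      - (1# + (m · 1# + (1# + n · 1#)))  ≈⟨ -‿cong (+-assoc _ _ _) ⟨
      - (1# + m · 1# + (1# + n · 1#))  ≈⟨ -‿+-comm _ _ ⟨
      - (1# + m · 1#) - (1# + n · 1#)  ∎

    pos*-homo : ∀ m j → ⟦ + m ℤ.* j ⟧ᶻ ≈ ⟦ + m ⟧ᶻ * ⟦ j ⟧ᶻ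
    pos*-homo m (+ n) = begin
      ⟦ + m ℤ.* + n ⟧ᶻ      ≡⟨ ≡.cong ⟦_⟧ᶻ (ℤ.pos-* m n) ⟨
      (m ℕ.* n) · 1#        ≈⟨ ×1-homo-* m n ⟩
      (m · 1#) * (n · 1#)   ∎
    pos*-homo m -[1+ n ] = begin
      ⟦ + m ℤ.* -[1+ n ] ⟧ᶻ        ≡⟨ ≡.cong ⟦_⟧ᶻ (ℤ.neg-distribʳ-* (+ m) (+ suc n)) ⟨
      ⟦ ℤ.- (+ m ℤ.* + suc n) ⟧ᶻ   ≈⟨ neg-homo (+ m ℤ.* + suc n) ⟩
      - ⟦ + m ℤ.* + suc n ⟧ᶻ       ≈⟨ -‿cong (pos*-homo m (+ suc n)) ⟩
      - ((m · 1#) * (suc n · 1#))  ≈⟨ RingProperties.-‿distribʳ-* ring _ _ ⟩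
      (m · 1#) * - (suc n · 1#)    ∎

    *-homo : ∀ i j → ⟦ i ℤ.* j ⟧ᶻ ≈ ⟦ i ⟧ᶻ * ⟦ j ⟧ᶻ
    *-homo (+ m)    j = pos*-homo m j
    *-homo -[1+ m ] j = begin
      ⟦ -[1+ m ] ℤ.* j ⟧ᶻ        ≡⟨ ≡.cong ⟦_⟧ᶻ (ℤ.neg-distribˡ-* (+ suc m) j) ⟨
      ⟦ ℤ.- (+ suc m ℤ.* j) ⟧ᶻ   ≈⟨ neg-homo (+ suc m ℤ.* j) ⟩
      - ⟦ + suc m ℤ.* j ⟧ᶻ       ≈⟨ -‿cong (pos*-homo (suc m) j) ⟩
      - ((suc m · 1#) * ⟦ j ⟧ᶻ)  ≈⟨ -‿distribˡ-* _ _ ⟩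
      - (suc m · 1#) * ⟦ j ⟧ᶻ    ∎

    morphism : ℤ.+-*-rawRing -Raw-AlmostCommutative⟶ fromCommutativeRing R
    morphism = record
      { ⟦_⟧    = ⟦_⟧ᶻ
      ; +-homo = +-homo
      ; *-homo = *-homo
      ; -‿homo = neg-homo
      ; 0-homo = refl
      ; 1-homo = +-identityʳ 1#
      }

    coeff≟ : ∀ i j → Maybe (⟦ i ⟧ᶻ ≈ ⟦ j ⟧ᶻ)
    coeff≟ i j = Maybe.map (λ i≡j → reflexive (≡.cong ⟦_⟧ᶻ i≡j)) (dec⇒maybe (i ℤ.≟ j))

  open RingSolver ℤ.+-*-rawRing (fromCommutativeRing R) morphism coeff≟ public
    using (solve; _:=_; _:+_; _:*_; _:-_; :-_; _:^_; con)

-- Elementary field arithmetic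

module FieldProperties {c ℓ} (K : Field c ℓ) where
  open Field K
  open IntegerSolver commutativeRing
  open AbelianGroupProperties +-abelianGroup public
    using () renaming (x∙y⁻¹≈ε⇒x≈y to x-y≈0⇒x≈y; x≈y⇒x∙y⁻¹≈ε to x≈y⇒x-y≈0)
  open RingProperties ring public using (-0#≈0#; -‿injective; -‿involutive)
  open ExpProperties commutativeSemiring public using (^-congˡ; ^-homo-*; ^-assocʳ; ^-distrib-*)
  open MultProperties semiring public using (×-assoc-*; ×1-homo-*) 
  open SetoidReasoning setoid

  *-inverseˡ : ∀ {x} → x ≉ 0# → x ⁻¹ * x ≈ 1#
  *-inverseˡ x≉0 = trans (*-comm _ _) (*-inverseʳ x≉0)

  *-cancelˡ : ∀ {x y z} → x ≉ 0# → x * y ≈ x * z → y ≈ z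
  *-cancelˡ {x} {y} {z} x≉0 xy≈xz = begin
    y               ≈⟨ *-identityˡ y ⟨
    1# * y          ≈⟨ *-congʳ (*-inverseˡ x≉0) ⟨
    x ⁻¹ * x * y    ≈⟨ *-assoc _ _ _ ⟩
    x ⁻¹ * (x * y)  ≈⟨ *-congˡ xy≈xz ⟩
    x ⁻¹ * (x * z)  ≈⟨ *-assoc _ _ _ ⟨
    x ⁻¹ * x * z    ≈⟨ *-congʳ (*-inverseˡ x≉0) ⟩
    1# * z          ≈⟨ *-identityˡ z ⟩
    z               ∎

  *-zeroProduct : ∀ {x y} → x * y ≈ 0# → x ≈ 0# ⊎ y ≈ 0#
  *-zeroProduct {x} {y} xy≈0 with x ≟ 0#
  ... | yes x≈0 = inj₁ x≈0
  ... | no  x≉0 = inj₂ (*-cancelˡ x≉0 (trans xy≈0 (sym (zeroʳ x))))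

  *-≉0 : ∀ {x y} → x ≉ 0# → y ≉ 0# → x * y ≉ 0#
  *-≉0 x≉0 y≉0 xy≈0 with *-zeroProduct xy≈0
  ... | inj₁ x≈0 = x≉0 x≈0
  ... | inj₂ y≈0 = y≉0 y≈0

  *-≉0ˡ : ∀ {x y} → x * y ≉ 0# → x ≉ 0#
  *-≉0ˡ xy≉0 x≈0 = xy≉0 (trans (*-congʳ x≈0) (zeroˡ _))

  *-≉0ʳ : ∀ {x y} → x * y ≉ 0# → y ≉ 0#
  *-≉0ʳ xy≉0 y≈0 = xy≉0 (trans (*-congˡ y≈0) (zeroʳ _))

  -‿≉0 : ∀ {x} → x ≉ 0# → - x ≉ 0#
  -‿≉0 x≉0 -x≈0 = x≉0 (-‿injective (trans -x≈0 (sym -0#≈0#)))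

  ⁻¹-≉0 : ∀ {x} → x ≉ 0# → x ⁻¹ ≉ 0#
  ⁻¹-≉0 x≉0 = *-≉0ʳ (λ xx⁻¹≈0 → 1≉0 (trans (sym (*-inverseʳ x≉0)) xx⁻¹≈0))

  ^-≉0 : ∀ {x} n → x ≉ 0# → x ^ n ≉ 0#
  ^-≉0 zero    x≉0 = 1≉0
  ^-≉0 (suc n) x≉0 = *-≉0 x≉0 (^-≉0 n x≉0)

  ^-≈0 : ∀ {x} n → x ^ n ≈ 0# → x ≈ 0#
  ^-≈0 {x} n xⁿ≈0 with x ≟ 0#
  ... | yes x≈0 = x≈0
  ... | no  x≉0 = contradiction xⁿ≈0 (^-≉0 n x≉0)

  x*[y/x]≈y : ∀ {x} y → x ≉ 0# → x * (y / x) ≈ y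
  x*[y/x]≈y {x} y x≉0 = begin
    x * (y * x ⁻¹)  ≈⟨ solve 3 (λ x y z → x :* (y :* z) := y :* (x :* z)) refl x y (x ⁻¹) ⟩
    y * (x * x ⁻¹)  ≈⟨ *-congˡ (*-inverseʳ x≉0) ⟩
    y * 1#          ≈⟨ *-identityʳ y ⟩
    y               ∎

  /-unique : ∀ {x y z} → x ≉ 0# → x * z ≈ y → z ≈ y / x
  /-unique x≉0 xz≈y = *-cancelˡ x≉0 (trans xz≈y (sym (x*[y/x]≈y _ x≉0)))

  -- Brings scalar multiples into the form that the solver understands, where a numeral is a
  -- constant of the ring.
  ·-as-* : ∀ n x → n · x ≈ (n · 1#) * x
  ·-as-* n x = sym (trans (×-assoc-* n 1# x) (MonoidMultProperties.×-congʳ +-monoid n (*-identityˡ x)))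

  square-unique : ∀ {x y} → x * x ≈ y * y → x ≈ y ⊎ x ≈ - y
  square-unique {x} {y} xx≈yy with *-zeroProduct (trans factored (x≈y⇒x-y≈0 xx≈yy))
    where
    factored : (x - y) * (x + y) ≈ x * x - y * y
    factored = solve 2 (λ x y → (x :- y) :* (x :+ y) := x :* x :- y :* y) refl x y
  ... | inj₁ x-y≈0 = inj₁ (x-y≈0⇒x≈y x y x-y≈0)
  ... | inj₂ x+y≈0 = inj₂ (x-y≈0⇒x≈y x (- y) (trans (+-congˡ (-‿involutive y)) x+y≈0))

-- Polynomials over a field: degree, roots, interpolation, division

module PolynomialProperties {c ℓ} (K : Field c ℓ) where
  open Field K hiding (zero)
  open FieldProperties K
  open IntegerSolver commutativeRing
  open Polynomial rawRing
  open SetoidReasoning setoid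
  open SumProperties *-commutativeMonoid using () renaming (sum to product)

  coeff-+ : ∀ p q i → coeff (p +ₚ q) i ≈ coeff p i + coeff q i
  coeff-+ []      q       i       = sym (+-identityˡ _)
  coeff-+ (a ∷ p) []      i       = sym (+-identityʳ _)
  coeff-+ (a ∷ p) (b ∷ q) zero    = refl
  coeff-+ (a ∷ p) (b ∷ q) (suc i) = coeff-+ p q i

  coeff-neg : ∀ p i → coeff (map -_ p) i ≈ - coeff p i
  coeff-neg []      i       = sym -0#≈0#
  coeff-neg (a ∷ p) zero    = refl
  coeff-neg (a ∷ p) (suc i) = coeff-neg p i

  coeff-- : ∀ p q i → coeff (p -ₚ q) i ≈ coeff p i - coeff q i
  coeff-- p q i = trans (coeff-+ p (map -_ q) i) (+-congˡ (coeff-neg q i))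

  coeff-scale : ∀ a p i → coeff (map (a *_) p) i ≈ a * coeff p i
  coeff-scale a []      i       = sym (zeroʳ a)
  coeff-scale a (b ∷ p) zero    = refl
  coeff-scale a (b ∷ p) (suc i) = coeff-scale a p i

  eval-≈0 : ∀ p → p ≈ₚ [] → ∀ x → eval p x ≈ 0#
  eval-≈0 []      p≈0 x = refl
  eval-≈0 (a ∷ p) p≈0 x = begin
    a + x * eval p x  ≈⟨ +-cong (p≈0 0) (*-congˡ (eval-≈0 p (p≈0 ∘ suc) x)) ⟩
    0# + x * 0#       ≈⟨ trans (+-identityˡ _) (zeroʳ x) ⟩
    0#                ∎

  eval-+ : ∀ p q x → eval (p +ₚ q) x ≈ eval p x + eval q x
  eval-+ []      q       x = sym (+-identityˡ _)
  eval-+ (a ∷ p) []      x = sym (+-identityʳ _)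
  eval-+ (a ∷ p) (b ∷ q) x = begin
    a + b + x * eval (p +ₚ q) x        ≈⟨ +-congˡ (*-congˡ (eval-+ p q x)) ⟩
    a + b + x * (eval p x + eval q x)  ≈⟨ solve 5 (λ a b x u v → a :+ b :+ x :* (u :+ v) :=
        a :+ x :* u :+ (b :+ x :* v)) refl a b x _ _ ⟩
    a + x * eval p x + (b + x * eval q x)  ∎

  eval-scale : ∀ a p x → eval (map (a *_) p) x ≈ a * eval p x
  eval-scale a []      x = sym (zeroʳ a)
  eval-scale a (b ∷ p) x = begin
    a * b + x * eval (map (a *_) p) x  ≈⟨ +-congˡ (*-congˡ (eval-scale a p x)) ⟩
    a * b + x * (a * eval p x)         ≈⟨ solve 4 (λ a b x u → a :* b :+ x :* (a :* u) := a :* (b :+ x :* u)) refl a b x _ ⟩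
    a * (b + x * eval p x)             ∎

  eval-neg : ∀ p x → eval (map -_ p) x ≈ - eval p x
  eval-neg []      x = sym -0#≈0#
  eval-neg (a ∷ p) x = begin
    - a + x * eval (map -_ p) x  ≈⟨ +-congˡ (*-congˡ (eval-neg p x)) ⟩
    - a + x * - eval p x         ≈⟨ solve 3 (λ a x u → :- a :+ x :* :- u := :- (a :+ x :* u)) refl a x _ ⟩
    - (a + x * eval p x)         ∎

  eval-- : ∀ p q x → eval (p -ₚ q) x ≈ eval p x - eval q x
  eval-- p q x = trans (eval-+ p (map -_ q) x) (+-congˡ (eval-neg q x))

  -ₚ≈0⇒≈ₚ : ∀ p q → p -ₚ q ≈ₚ [] → p ≈ₚ q
  -ₚ≈0⇒≈ₚ p q p-q≈0 i = x-y≈0⇒x≈y _ _ (trans (sym (coeff-- p q i)) (p-q≈0 i))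

  eval-≈ₚ : ∀ p q → p ≈ₚ q → ∀ x → eval p x ≈ eval q x
  eval-≈ₚ p q p≈q x = x-y≈0⇒x≈y _ _ (trans (sym (eval-- p q x)) (eval-≈0 (p -ₚ q) p-q≈0 x))
    where
    p-q≈0 : p -ₚ q ≈ₚ []
    p-q≈0 i = trans (coeff-- p q i) (x≈y⇒x-y≈0 (p≈q i))

  eval-cong : ∀ p {x y} → x ≈ y → eval p x ≈ eval p y
  eval-cong []      x≈y = refl
  eval-cong (a ∷ p) x≈y = +-congˡ (*-cong x≈y (eval-cong p x≈y))

  eval-* : ∀ p q x → eval (p *ₚ q) x ≈ eval p x * eval q x
  eval-* []      q x = sym (zeroˡ _)
  eval-* (a ∷ p) q x = begin
    eval (map (a *_) q +ₚ (0# ∷ p *ₚ q)) x           ≈⟨ eval-+ (map (a *_) q) (0# ∷ p *ₚ q) x ⟩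
    eval (map (a *_) q) x + (0# + x * eval (p *ₚ q) x)
        ≈⟨ +-cong (eval-scale a q x) (trans (+-identityˡ _) (*-congˡ (eval-* p q x))) ⟩
    a * eval q x + x * (eval p x * eval q x)         ≈⟨ solve 4 (λ a x u v → a :* v :+ x :* (u :* v) :=
        (a :+ x :* u) :* v) refl a x _ _ ⟩
    (a + x * eval p x) * eval q x                    ∎

  DegreeBelow : Poly → ℕ → Set ℓ
  DegreeBelow p n = ∀ i → n ≤ i → coeff p i ≈ 0#

  -- a may be zero.
  record Leading (p : Poly) (d : ℕ) (a : Carrier) : Set ℓ where
    constructor leading
    field
      coefficient : coeff p d ≈ a
      below       : DegreeBelow p (suc d)

  Leading-≈ₚ : ∀ {p q d a} → p ≈ₚ q → Leading p d a → Leading q d a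
  Leading-≈ₚ p≈q (leading c b) =
    leading (trans (sym (p≈q _)) c) (λ i d<i → trans (sym (p≈q i)) (b i d<i))

  -- Because of trailing zeros the length of the list does not give the degree; decidable equality
  -- finds the last nonzero coefficient.
  ≈0⊎Leading : ∀ p → p ≈ₚ [] ⊎ ∃₂ λ d a → a ≉ 0# × Leading p d a
  ≈0⊎Leading [] = inj₁ (λ _ → refl)
  ≈0⊎Leading (a ∷ p) with ≈0⊎Leading p
  ... | inj₂ (d , b , b≉0 , leading pd p<) =
    inj₂ (suc d , b , b≉0 , leading pd λ { (suc i) (s≤s d<i) → p< i d<i })
  ... | inj₁ p≈0 with a ≟ 0#
  ...   | yes a≈0 = inj₁ λ { zero → a≈0 ; (suc i) → p≈0 i }
  ...   | no  a≉0 = inj₂ (0 , a , a≉0 , leading refl λ { (suc i) _ → p≈0 i })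

  Leading-≤ : ∀ {p d n a} → a ≉ 0# → Leading p d a → DegreeBelow p n → d < n
  Leading-≤ {d = d} {n} a≉0 (leading pd _) p< with d ℕ.<? n
  ... | yes d<n = d<n
  ... | no  d≮n = contradiction (trans (sym pd) (p< d (ℕ.≮⇒≥ d≮n))) a≉0

  Leading-unique : ∀ {p d e a b} → a ≉ 0# → b ≉ 0# → Leading p d a → Leading p e b → d ≡ e
  Leading-unique a≉0 b≉0 Lp Lp′ = ℕ.≤-antisym
    (ℕ.≤-pred (Leading-≤ a≉0 Lp (Leading.below Lp′))) (ℕ.≤-pred (Leading-≤ b≉0 Lp′ (Leading.below Lp)))

  coeff-∷-* : ∀ x p q i → coeff ((x ∷ p) *ₚ q) i ≈ x * coeff q i + coeff (0# ∷ p *ₚ q) i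
  coeff-∷-* x p q i = trans (coeff-+ (map (x *_) q) _ i) (+-congʳ (coeff-scale x q i))

  *ₚ-≈0ˡ : ∀ p q → p ≈ₚ [] → p *ₚ q ≈ₚ []
  *ₚ-≈0ˡ []      q p≈0 i = refl
  *ₚ-≈0ˡ (x ∷ p) q p≈0 i = begin
    coeff ((x ∷ p) *ₚ q) i                     ≈⟨ coeff-∷-* x p q i ⟩
    x * coeff q i + coeff (0# ∷ p *ₚ q) i      ≈⟨ +-cong (trans (*-congʳ (p≈0 0)) (zeroˡ _)) (shifted i) ⟩
    0# + 0#                                    ≈⟨ +-identityˡ 0# ⟩
    0#                                         ∎
    where
    shifted : 0# ∷ p *ₚ q ≈ₚ []
    shifted zero    = refl
    shifted (suc i) = *ₚ-≈0ˡ p q (p≈0 ∘ suc) i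

  *ₚ-≈0ʳ : ∀ p q → q ≈ₚ [] → p *ₚ q ≈ₚ []
  *ₚ-≈0ʳ []      q q≈0 i = refl
  *ₚ-≈0ʳ (x ∷ p) q q≈0 i = begin
    coeff ((x ∷ p) *ₚ q) i                     ≈⟨ coeff-∷-* x p q i ⟩
    x * coeff q i + coeff (0# ∷ p *ₚ q) i      ≈⟨ +-cong (trans (*-congˡ (q≈0 i)) (zeroʳ x)) (shifted i) ⟩
    0# + 0#                                    ≈⟨ +-identityˡ 0# ⟩
    0#                                         ∎
    where
    shifted : 0# ∷ p *ₚ q ≈ₚ []
    shifted zero    = refl
    shifted (suc i) = *ₚ-≈0ʳ p q q≈0 i

  Leading-* : ∀ {p d a q e b} → Leading p d a → Leading q e b → Leading (p *ₚ q) (d ℕ.+ e) (a * b)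
  Leading-* {[]} {a = a} {b = b} (leading 0≈a _) _ =
    leading (sym (trans (*-congʳ (sym 0≈a)) (zeroˡ b))) (λ _ _ → refl)
  Leading-* {x ∷ p} {zero} {a} {q} {e} {b} (leading x≈a p<) (leading qe q<) =
    leading (trans (product≈ e) (*-cong x≈a qe)) λ i e<i → trans (product≈ i) (trans (*-congˡ (q< i e<i)) (zeroʳ x))
    where
    shifted : 0# ∷ p *ₚ q ≈ₚ []
    shifted zero    = refl
    shifted (suc i) = *ₚ-≈0ˡ p q (λ j → p< (suc j) (s≤s z≤n)) i
    product≈ : ∀ i → coeff ((x ∷ p) *ₚ q) i ≈ x * coeff q i
    product≈ i = trans (coeff-∷-* x p q i) (trans (+-congˡ (shifted i)) (+-identityʳ _))
  Leading-* {x ∷ p} {suc d} {a} {q} {e} {b} (leading pd p<) Lq@(leading qe q<)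
    with leading r r< ← Leading-* {p} {d} {a} {q} {e} {b} (leading pd λ i d<i → p< (suc i) (s≤s d<i)) Lq =
    leading (trans (product≈ (d ℕ.+ e) (s≤s (ℕ.m≤n+m e d))) r)
      λ { (suc i) (s≤s d+e<i) → trans (product≈ i (s≤s (ℕ.≤-trans (ℕ.m≤n+m e d) (ℕ.<⇒≤ d+e<i)))) (r< i d+e<i) }
    where
    product≈ : ∀ i → e < suc i → coeff ((x ∷ p) *ₚ q) (suc i) ≈ coeff (p *ₚ q) i
    product≈ i e<i = trans (coeff-∷-* x p q (suc i))
      (trans (+-congʳ (trans (*-congˡ (q< (suc i) e<i)) (zeroʳ x))) (+-identityˡ _))

  Leading-factors : ∀ {f d a} g h → a ≉ 0# → Leading f d a → f ≈ₚ g *ₚ h →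
                    ∃₂ λ m n → ∃₂ λ b c → b ≉ 0# × c ≉ 0# × Leading g m b × Leading h n c × d ≡ m ℕ.+ n
  Leading-factors {f} {d} g h a≉0 Lf f≈gh with ≈0⊎Leading g | ≈0⊎Leading h
  ... | inj₁ g≈0 | _        =
    contradiction (trans (sym (Leading.coefficient Lf)) (trans (f≈gh d) (*ₚ-≈0ˡ g h g≈0 d))) a≉0
  ... | inj₂ _   | inj₁ h≈0 =
    contradiction (trans (sym (Leading.coefficient Lf)) (trans (f≈gh d) (*ₚ-≈0ʳ g h h≈0 d))) a≉0
  ... | inj₂ (m , b , b≉0 , Lg) | inj₂ (n , c , c≉0 , Lh) = m , n , b , c , b≉0 , c≉0 , Lg , Lh ,
    Leading-unique a≉0 (*-≉0 b≉0 c≉0) Lf (Leading-≈ₚ (λ i → sym (f≈gh i)) (Leading-* Lg Lh))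

  Unit : Poly → Set _
  Unit f = ∃ λ g → g *ₚ f ≈ₚ C 1#

  Leading-C : ∀ a → Leading (C a) 0 a
  Leading-C a = leading refl λ { (suc i) _ → refl }

  Leading-0⇒Unit : ∀ {f a} → a ≉ 0# → Leading f 0 a → Unit f
  Leading-0⇒Unit {f} {a} a≉0 Lf with leading f₀ f< ← Leading-* (Leading-C (a ⁻¹)) Lf =
    C (a ⁻¹) , λ { zero → trans f₀ (*-inverseˡ a≉0) ; (suc i) → f< (suc i) (s≤s z≤n) }

  Unit⇒Leading-0 : ∀ f → Unit f → ∃ λ a → a ≉ 0# × Leading f 0 a
  Unit⇒Leading-0 f (g , gf≈1) with Leading-factors g f 1≉0 (Leading-C 1#) (λ i → sym (gf≈1 i))
  ... | zero , zero , _ , a , _ , a≉0 , _ , Lf , _ = a , a≉0 , Lf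

  Leading-+ : ∀ {p d a q} → DegreeBelow q d → Leading p d a → Leading (q +ₚ p) d a
  Leading-+ {p} {d} {q = q} q< (leading pd p<) = leading
    (trans (coeff-+ q p d) (trans (+-cong (q< d ℕ.≤-refl) pd) (+-identityˡ _)))
    λ i d<i → trans (coeff-+ q p i) (trans (+-cong (q< i (ℕ.<⇒≤ d<i)) (p< i d<i)) (+-identityˡ 0#))

  Leading-- : ∀ {p d a q} → DegreeBelow q d → Leading p d a → Leading (p -ₚ q) d a
  Leading-- {p} {d} {q = q} q< (leading pd p<) = leading
    (trans (coeff-- p q d) (trans (+-cong pd (trans (-‿cong (q< d ℕ.≤-refl)) -0#≈0#)) (+-identityʳ _)))
    λ i d<i → trans (coeff-- p q i) (trans (+-cong (p< i d<i) (trans (-‿cong (q< i (ℕ.<⇒≤ d<i))) -0#≈0#)) (+-identityʳ 0#))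

  -- Synthetic division by X - r: the coefficients are the values at r of the tails of the list, the
  -- intermediate results of Horner's scheme.
  quotient : Carrier → Poly → Poly
  quotient r []          = []
  quotient r (a ∷ [])    = []
  quotient r (a ∷ b ∷ p) = eval (b ∷ p) r ∷ quotient r (b ∷ p)

  eval-quotient : ∀ r p x → eval p x ≈ eval p r + (x - r) * eval (quotient r p) x
  eval-quotient r []          x = solve 1 (λ u → con (+ 0) := con (+ 0) :+ u :* con (+ 0)) refl (x - r)
  eval-quotient r (a ∷ [])    x = solve 3 (λ a x r → a :+ x :* con (+ 0) :=
      a :+ r :* con (+ 0) :+ (x :- r) :* con (+ 0)) refl a x r
  eval-quotient r (a ∷ b ∷ p) x = begin
    a + x * eval (b ∷ p) x     ≈⟨ +-congˡ (*-congˡ (eval-quotient r (b ∷ p) x)) ⟩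
    a + x * (s + (x - r) * t)  ≈⟨ solve 5 (λ a r s t x → a :+ x :* (s :+ (x :- r) :* t) :=
        a :+ r :* s :+ (x :- r) :* (s :+ x :* t)) refl a r s t x ⟩
    a + r * s + (x - r) * (s + x * t) ∎
    where
    s t : Carrier
    s = eval (b ∷ p) r
    t = eval (quotient r (b ∷ p)) x

  quotient-below : ∀ r p n → DegreeBelow p (suc n) → DegreeBelow (quotient r p) n
  quotient-below r []          n       p< i       _ = refl
  quotient-below r (a ∷ [])    n       p< i       _ = refl
  quotient-below r (a ∷ b ∷ p) zero    p< zero    _ = eval-≈0 (b ∷ p) (λ i → p< (suc i) (s≤s z≤n)) r
  quotient-below r (a ∷ b ∷ p) zero    p< (suc i) _ =
    quotient-below r (b ∷ p) zero (λ j _ → p< (suc j) (s≤s z≤n)) i z≤n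
  quotient-below r (a ∷ b ∷ p) (suc n) p< (suc i) (s≤s n≤i) =
    quotient-below r (b ∷ p) n (λ j n<j → p< (suc j) (s≤s n<j)) i n≤i

  quotient-leading : ∀ r p d a → Leading p (suc d) a → Leading (quotient r p) d a
  quotient-leading r p d a (leading pd p<) = leading (trans (top p d p<) pd) (quotient-below r p (suc d) p<)
    where
    top : ∀ p d → DegreeBelow p (suc (suc d)) → coeff (quotient r p) d ≈ coeff p (suc d)
    top []          d       p< = refl
    top (a ∷ [])    d       p< = refl
    top (a ∷ b ∷ p) zero    p< =
      trans (+-congˡ (trans (*-congˡ (eval-≈0 p (λ i → p< (suc (suc i)) (s≤s (s≤s z≤n))) r)) (zeroʳ r))) (+-identityʳ b)
    top (a ∷ b ∷ p) (suc d) p< = top (b ∷ p) d (λ i d<i → p< (suc i) (s≤s d<i))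

  Distinct : ∀ {n} → (Fin n → Carrier) → Set ℓ
  Distinct r = ∀ {i j} → i ≢ j → r i ≉ r j

  product-≉0 : ∀ {n} (f : Fin n → Carrier) → (∀ i → f i ≉ 0#) → product f ≉ 0#
  product-≉0 {zero}  f f≉0 = 1≉0
  product-≉0 {suc n} f f≉0 = *-≉0 (f≉0 zero) (product-≉0 (f ∘ suc) (f≉0 ∘ suc))

  x-y≉0 : ∀ {x y} → x ≉ y → x - y ≉ 0#
  x-y≉0 x≉y x-y≈0 = x≉y (x-y≈0⇒x≈y _ _ x-y≈0)

  -- Dividing by X - r₀ leaves a quotient that vanishes at the remaining roots, because these differ
  -- from r₀.
  factorisation : ∀ {n p a} (r : Fin n → Carrier) → Distinct r → Leading p n a →
                  (∀ i → eval p (r i) ≈ 0#) → ∀ y → eval p y ≈ a * product (λ i → y - r i)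
  factorisation {zero}  {[]}    r r≉ (leading 0≈a _) roots y = trans 0≈a (sym (*-identityʳ _))
  factorisation {zero}  {b ∷ p} r r≉ (leading b≈a p<) roots y =
    trans (+-cong b≈a (trans (*-congˡ (eval-≈0 p (λ i → p< (suc i) (s≤s z≤n)) y)) (zeroʳ y)))
      (trans (+-identityʳ _) (sym (*-identityʳ _)))
  factorisation {suc n} {p} {a} r r≉ Lp roots y = begin
    eval p y                                       ≈⟨ divided y ⟩
    (y - r zero) * eval q y                        ≈⟨ *-congˡ (factorisation (r ∘ suc) (λ i≢j →
        r≉ (i≢j ∘ Fin.suc-injective)) (quotient-leading (r zero) p n a Lp) roots′ y) ⟩
    (y - r zero) * (a * product (λ i → y - r (suc i)))  ≈⟨ solve 3 (λ u a v → u :* (a :* v) := a :* (u :* v)) refl _ _ _ ⟩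
    a * ((y - r zero) * product (λ i → y - r (suc i)))  ∎
    where
    q : Poly
    q = quotient (r zero) p
    divided : ∀ x → eval p x ≈ (x - r zero) * eval q x
    divided x = trans (eval-quotient (r zero) p x) (trans (+-congʳ (roots zero)) (+-identityˡ _))
    roots′ : ∀ i → eval q (r (suc i)) ≈ 0#
    roots′ i with *-zeroProduct (trans (sym (divided (r (suc i)))) (roots (suc i)))
    ... | inj₁ difference≈0 = contradiction difference≈0 (x-y≉0 (r≉ λ ()))
    ... | inj₂ root         = root

  -- If n exceeded d, the factorisation along d of the roots would have to vanish at one further
  -- root, where none of its factors does.
  roots≤degree : ∀ {n p d a} (r : Fin n → Carrier) → Distinct r → a ≉ 0# → Leading p d a →
                 (∀ i → eval p (r i) ≈ 0#) → n ≤ d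
  roots≤degree {n} {p} {d} {a} r r≉ a≉0 Lp roots with n ℕ.≤? d
  ... | yes n≤d = n≤d
  ... | no  n≰d = contradiction
      (trans (sym (factorisation (r′ ∘ suc) (λ i≢j → r′≉ (i≢j ∘ Fin.suc-injective)) Lp (λ i → roots _) (r′ zero))) (roots _))
      (*-≉0 a≉0 (product-≉0 (λ i → r′ zero - r′ (suc i)) λ i → x-y≉0 (r′≉ {zero} {suc i} λ ())))
    where
    r′ : Fin (suc d) → Carrier
    r′ i = r (Fin.inject≤ i (ℕ.≰⇒> n≰d))
    r′≉ : Distinct r′
    r′≉ i≢j = r≉ (i≢j ∘ Fin.inject≤-injective _ _ _ _)

  rootsBound : ∀ {n p} (r : Fin n → Carrier) → Distinct r → DegreeBelow p n →
               (∀ i → eval p (r i) ≈ 0#) → p ≈ₚ []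
  rootsBound {n} {p} r r≉ p< roots with ≈0⊎Leading p
  ... | inj₁ p≈0 = p≈0
  ... | inj₂ (d , a , a≉0 , Lp) = contradiction (Leading-≤ a≉0 Lp p<) (ℕ.≤⇒≯ (roots≤degree r r≉ a≉0 Lp roots))

  interpolation-unique : ∀ {n p q} (r : Fin n → Carrier) → Distinct r → DegreeBelow p n → DegreeBelow q n →
                         (∀ i → eval p (r i) ≈ eval q (r i)) → p ≈ₚ q
  interpolation-unique {n} {p} {q} r r≉ p< q< agree = -ₚ≈0⇒≈ₚ p q (rootsBound {p = p -ₚ q} r r≉ below roots)
    where
    below : DegreeBelow (p -ₚ q) n
    below i n≤i = trans (coeff-- p q i) (x≈y⇒x-y≈0 (trans (p< i n≤i) (sym (q< i n≤i))))
    roots : ∀ i → eval (p -ₚ q) (r i) ≈ 0#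
    roots i = trans (eval-- p q (r i)) (x≈y⇒x-y≈0 (agree i))

  interpolation : ∀ {n} (r v : Fin n → Carrier) → Distinct r →
                  ∃ λ p → DegreeBelow p n × (∀ i → eval p (r i) ≈ v i)
  interpolation {zero}  r v r≉ = [] , (λ _ _ → refl) , λ ()
  interpolation {suc n} r v r≉
    with interpolation (r ∘ suc) (λ i → (v (suc i) - v zero) / (r (suc i) - r zero)) (λ i≢j → r≉ (i≢j ∘ Fin.suc-injective))
  ... | q , q< , q-values = p , below , values
    where
    -- p = v₀ + (X - r₀) q
    p : Poly
    p = (v zero ∷ q) -ₚ map (r zero *_) q
    below : DegreeBelow p (suc n)
    below (suc i) (s≤s n≤i) = begin
      coeff p (suc i)                                ≈⟨ coeff-- (v zero ∷ q) (map (r zero *_) q) (suc i) ⟩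
      coeff q i - coeff (map (r zero *_) q) (suc i)  ≈⟨ +-cong (q< i n≤i) (-‿cong (trans (coeff-scale (r zero) q
          (suc i)) (trans (*-congˡ (q< (suc i) (ℕ.m≤n⇒m≤1+n n≤i))) (zeroʳ _)))) ⟩
      0# - 0#                                        ≈⟨ -‿inverseʳ 0# ⟩
      0#                                             ∎
    eval-p : ∀ x → eval p x ≈ v zero + (x - r zero) * eval q x
    eval-p x = begin
      eval p x                                       ≈⟨ eval-- (v zero ∷ q) (map (r zero *_) q) x ⟩
      v zero + x * eval q x - eval (map (r zero *_) q) x  ≈⟨ +-congˡ (-‿cong (eval-scale (r zero) q x)) ⟩
      v zero + x * eval q x - r zero * eval q x      ≈⟨ solve 4 (λ v x r u → v :+ x :* u :- r :* u :=
          v :+ (x :- r) :* u) refl (v zero) x (r zero) _ ⟩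
      v zero + (x - r zero) * eval q x               ∎
    values : ∀ i → eval p (r i) ≈ v i
    values zero    = trans (eval-p (r zero)) (trans (+-congˡ (trans (*-congʳ (-‿inverseʳ _)) (zeroˡ _))) (+-identityʳ _))
    values (suc i) = begin
      eval p (r (suc i))                             ≈⟨ eval-p (r (suc i)) ⟩
      v zero + (r (suc i) - r zero) * eval q (r (suc i))  ≈⟨ +-congˡ (*-congˡ (q-values i)) ⟩
      v zero + (r (suc i) - r zero) * ((v (suc i) - v zero) / (r (suc i) - r zero))  ≈⟨ +-congˡ (x*[y/x]≈y _ (x-y≉0 (r≉ λ ()))) ⟩
      v zero + (v (suc i) - v zero)                  ≈⟨ solve 2 (λ a b → a :+ (b :- a) := b) refl _ _ ⟩
      v (suc i)                                      ∎

  -- If f = q g + r, then X r + a has at most the degree of g. As g is monic, subtracting b g, with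
  -- b the top coefficient of X r + a, brings it below.
  division : ∀ {g k} → Leading g (suc k) 1# → ∀ f →
             ∃₂ λ q r → f ≈ₚ q *ₚ g +ₚ r × DegreeBelow r (suc k)
  division Lg [] = [] , [] , (λ _ → refl) , λ _ _ → refl
  division {g} {k} Lg@(leading gk g<) (a ∷ f) with division Lg f
  ... | q , r , f≈qg+r , r< = b ∷ q , r′ , equal , below
    where
    b : Carrier
    b = coeff r k
    r′ : Poly
    r′ = (a ∷ r) -ₚ map (b *_) g
    coeff-r′ : ∀ i → coeff r′ i ≈ coeff (a ∷ r) i - b * coeff g i
    coeff-r′ i = trans (coeff-- (a ∷ r) (map (b *_) g) i) (+-congˡ (-‿cong (coeff-scale b g i)))
    shifted : ∀ i → coeff (a ∷ f) i ≈ coeff (0# ∷ q *ₚ g) i + coeff (a ∷ r) i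
    shifted zero    = sym (+-identityˡ a)
    shifted (suc i) = trans (f≈qg+r i) (coeff-+ (q *ₚ g) r i)
    equal : a ∷ f ≈ₚ (b ∷ q) *ₚ g +ₚ r′
    equal i = begin
      coeff (a ∷ f) i                                    ≈⟨ shifted i ⟩
      coeff (0# ∷ q *ₚ g) i + coeff (a ∷ r) i
          ≈⟨ solve 3 (λ u v w → u :+ v := w :+ u :+ (v :- w)) refl _ _ (b * coeff g i) ⟩
      b * coeff g i + coeff (0# ∷ q *ₚ g) i + (coeff (a ∷ r) i - b * coeff g i)
                                                         ≈⟨ +-cong (coeff-∷-* b q g i) (coeff-r′ i) ⟨
      coeff ((b ∷ q) *ₚ g) i + coeff r′ i                ≈⟨ coeff-+ ((b ∷ q) *ₚ g) r′ i ⟨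
      coeff ((b ∷ q) *ₚ g +ₚ r′) i                       ∎
    below : DegreeBelow r′ (suc k)
    below (suc i) (s≤s k≤i) with ℕ.m≤n⇒m<n∨m≡n k≤i
    ... | inj₁ k<i    = begin
      coeff r′ (suc i)                     ≈⟨ coeff-r′ (suc i) ⟩
      coeff r i - b * coeff g (suc i)      ≈⟨ +-cong (r< i k<i) (-‿cong (trans (*-congˡ (g< (suc i) (s≤s k<i))) (zeroʳ b))) ⟩
      0# - 0#                              ≈⟨ -‿inverseʳ 0# ⟩
      0#                                   ∎
    ... | inj₂ ≡.refl = begin
      coeff r′ (suc i)                     ≈⟨ coeff-r′ (suc i) ⟩
      b - b * coeff g (suc i)              ≈⟨ +-congˡ (-‿cong (trans (*-congˡ gk) (*-identityʳ b))) ⟩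
      b - b                                ≈⟨ -‿inverseʳ b ⟩
      0#                                   ∎

  monomial : ℕ → Poly
  monomial zero    = C 1#
  monomial (suc n) = 0# ∷ monomial n

  monomial-leading : ∀ n → Leading (monomial n) n 1#
  monomial-leading zero    = Leading-C 1#
  monomial-leading (suc n) with monomial-leading n
  ... | leading m m< = leading m λ { (suc i) (s≤s n<i) → m< i n<i }

  eval-monomial : ∀ n x → eval (monomial n) x ≈ x ^ n
  eval-monomial zero    x = trans (+-congˡ (zeroʳ x)) (+-identityʳ 1#)
  eval-monomial (suc n) x = trans (+-identityˡ _) (*-congˡ (eval-monomial n x))

-- Evaluating polynomials over F at points of K

module MapProperties {c₁ ℓ₁ c₂ ℓ₂} (F : Field c₁ ℓ₁) (K : Field c₂ ℓ₂) (ι : Field.Carrier F → Field.Carrier K)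
  (isHom : IsRingHomomorphism (Field.rawRing F) (Field.rawRing K) ι) where
  private
    module F = Field F
    module F[X] = Polynomial F.rawRing
    module FP = PolynomialProperties F
  open Field K hiding (zero)
  open Polynomial rawRing
  open PolynomialProperties K
  open IsRingHomomorphism isHom
  open SetoidReasoning setoid

  coeff-map : ∀ p i → coeff (map ι p) i ≈ ι (F[X].coeff p i)
  coeff-map []      i       = sym 0#-homo
  coeff-map (a ∷ p) zero    = refl
  coeff-map (a ∷ p) (suc i) = coeff-map p i

  map-≈ₚ : ∀ p q → p F[X].≈ₚ q → map ι p ≈ₚ map ι q
  map-≈ₚ p q p≈q i = trans (coeff-map p i) (trans (⟦⟧-cong (p≈q i)) (sym (coeff-map q i)))

  map-below : ∀ {p n} → FP.DegreeBelow p n → DegreeBelow (map ι p) n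
  map-below {p} p< i n≤i = trans (coeff-map p i) (trans (⟦⟧-cong (p< i n≤i)) 0#-homo)

  map-leading : ∀ {p d a} → FP.Leading p d a → Leading (map ι p) d (ι a)
  map-leading {p} {d} (FP.leading pd p<) = leading (trans (coeff-map p d) (⟦⟧-cong pd)) (map-below {p} p<)

  eval-map : ∀ p x → eval (map ι p) (ι x) ≈ ι (F[X].eval p x)
  eval-map []      x = sym 0#-homo
  eval-map (a ∷ p) x = begin
    ι a + ι x * eval (map ι p) (ι x)   ≈⟨ +-congˡ (*-congˡ (eval-map p x)) ⟩
    ι a + ι x * ι (F[X].eval p x)      ≈⟨ +-congˡ (*-homo x _) ⟨
    ι a + ι (x F.* F[X].eval p x)      ≈⟨ +-homo a _ ⟨
    ι (a F.+ x F.* F[X].eval p x)      ∎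

  eval⟨_⟩ : F[X].Poly → Carrier → Carrier
  eval⟨ p ⟩ = eval (map ι p)

  map-+ₚ : ∀ p q → map ι (p F[X].+ₚ q) ≈ₚ map ι p +ₚ map ι q
  map-+ₚ p q i = begin
    coeff (map ι (p F[X].+ₚ q)) i                ≈⟨ coeff-map (p F[X].+ₚ q) i ⟩
    ι (F[X].coeff (p F[X].+ₚ q) i)               ≈⟨ ⟦⟧-cong (FP.coeff-+ p q i) ⟩
    ι (F[X].coeff p i F.+ F[X].coeff q i)        ≈⟨ +-homo _ _ ⟩
    ι (F[X].coeff p i) + ι (F[X].coeff q i)      ≈⟨ +-cong (coeff-map p i) (coeff-map q i) ⟨
    coeff (map ι p) i + coeff (map ι q) i        ≈⟨ coeff-+ (map ι p) (map ι q) i ⟨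
    coeff (map ι p +ₚ map ι q) i                 ∎

  map-neg : ∀ p → map ι (map F.-_ p) ≈ₚ map -_ (map ι p)
  map-neg p i = begin
    coeff (map ι (map F.-_ p)) i     ≈⟨ coeff-map (map F.-_ p) i ⟩
    ι (F[X].coeff (map F.-_ p) i)    ≈⟨ ⟦⟧-cong (FP.coeff-neg p i) ⟩
    ι (F.- F[X].coeff p i)           ≈⟨ -‿homo _ ⟩
    - ι (F[X].coeff p i)             ≈⟨ -‿cong (coeff-map p i) ⟨
    - coeff (map ι p) i              ≈⟨ coeff-neg (map ι p) i ⟨
    coeff (map -_ (map ι p)) i       ∎

  map-scale : ∀ a p → map ι (map (a F.*_) p) ≈ₚ map (ι a *_) (map ι p)
  map-scale a p i = begin
    coeff (map ι (map (a F.*_) p)) i     ≈⟨ coeff-map (map (a F.*_) p) i ⟩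
    ι (F[X].coeff (map (a F.*_) p) i)    ≈⟨ ⟦⟧-cong (FP.coeff-scale a p i) ⟩
    ι (a F.* F[X].coeff p i)             ≈⟨ *-homo _ _ ⟩
    ι a * ι (F[X].coeff p i)             ≈⟨ *-congˡ (coeff-map p i) ⟨
    ι a * coeff (map ι p) i              ≈⟨ coeff-scale (ι a) (map ι p) i ⟨
    coeff (map (ι a *_) (map ι p)) i     ∎

  eval⟨⟩-≈ₚ : ∀ p q → p F[X].≈ₚ q → ∀ x → eval⟨ p ⟩ x ≈ eval⟨ q ⟩ x
  eval⟨⟩-≈ₚ p q p≈q = eval-≈ₚ (map ι p) (map ι q) (map-≈ₚ p q p≈q)

  eval⟨⟩-+ : ∀ p q x → eval⟨ p F[X].+ₚ q ⟩ x ≈ eval⟨ p ⟩ x + eval⟨ q ⟩ x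
  eval⟨⟩-+ p q x = trans (eval-≈ₚ (map ι (p F[X].+ₚ q)) (map ι p +ₚ map ι q) (map-+ₚ p q) x) (eval-+ (map ι p) (map ι q) x)

  eval⟨⟩-- : ∀ p q x → eval⟨ p F[X].-ₚ q ⟩ x ≈ eval⟨ p ⟩ x - eval⟨ q ⟩ x
  eval⟨⟩-- p q x = trans (eval⟨⟩-+ p (map F.-_ q) x)
    (+-congˡ (trans (eval-≈ₚ (map ι (map F.-_ q)) (map -_ (map ι q)) (map-neg q) x) (eval-neg (map ι q) x)))

  eval⟨⟩-* : ∀ p q x → eval⟨ p F[X].*ₚ q ⟩ x ≈ eval⟨ p ⟩ x * eval⟨ q ⟩ x
  eval⟨⟩-* []      q x = sym (zeroˡ _)
  eval⟨⟩-* (a ∷ p) q x = begin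
    eval⟨ map (a F.*_) q F[X].+ₚ (F.0# ∷ p F[X].*ₚ q) ⟩ x           ≈⟨ eval⟨⟩-+ (map (a F.*_) q) (F.0# ∷ p F[X].*ₚ q) x ⟩
    eval⟨ map (a F.*_) q ⟩ x + (ι F.0# + x * eval⟨ p F[X].*ₚ q ⟩ x)
      ≈⟨ +-cong (trans (eval-≈ₚ (map ι (map (a F.*_) q)) (map (ι a *_) (map ι q)) (map-scale a q) x) (eval-scale (ι a)
          (map ι q) x)) (+-cong 0#-homo (*-congˡ (eval⟨⟩-* p q x))) ⟩
    ι a * eval⟨ q ⟩ x + (0# + x * (eval⟨ p ⟩ x * eval⟨ q ⟩ x))      ≈⟨ +-congˡ (+-identityˡ _) ⟩
    ι a * eval⟨ q ⟩ x + x * (eval⟨ p ⟩ x * eval⟨ q ⟩ x)             ≈⟨ +-congˡ (*-assoc _ _ _) ⟨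
    ι a * eval⟨ q ⟩ x + x * eval⟨ p ⟩ x * eval⟨ q ⟩ x               ≈⟨ distribʳ _ _ _ ⟨
    (ι a + x * eval⟨ p ⟩ x) * eval⟨ q ⟩ x                           ∎

  eval⟨⟩-C : ∀ a x → eval⟨ F[X].C a ⟩ x ≈ ι a
  eval⟨⟩-C a x = trans (+-congˡ (zeroʳ x)) (+-identityʳ _)

  eval⟨⟩-X : ∀ x → eval⟨ F[X].X ⟩ x ≈ x
  eval⟨⟩-X x = begin
    ι F.0# + x * (ι F.1# + x * 0#)  ≈⟨ +-cong 0#-homo (*-congˡ (+-cong 1#-homo (zeroʳ x))) ⟩
    0# + x * (1# + 0#)              ≈⟨ trans (+-identityˡ _) (*-congˡ (+-identityʳ 1#)) ⟩
    x * 1#                          ≈⟨ *-identityʳ x ⟩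
    x                               ∎

  eval⟨⟩-∘ : ∀ p q x → eval⟨ p F[X].∘ₚ q ⟩ x ≈ eval⟨ p ⟩ (eval⟨ q ⟩ x)
  eval⟨⟩-∘ []      q x = refl
  eval⟨⟩-∘ (a ∷ p) q x = begin
    eval⟨ F[X].C a F[X].+ₚ q F[X].*ₚ (p F[X].∘ₚ q) ⟩ x       ≈⟨ eval⟨⟩-+ (F[X].C a) (q F[X].*ₚ (p F[X].∘ₚ q)) x ⟩
    eval⟨ F[X].C a ⟩ x + eval⟨ q F[X].*ₚ (p F[X].∘ₚ q) ⟩ x   ≈⟨ +-cong (eval⟨⟩-C a x) (eval⟨⟩-* q (p F[X].∘ₚ q) x) ⟩
    ι a + eval⟨ q ⟩ x * eval⟨ p F[X].∘ₚ q ⟩ x                ≈⟨ +-congˡ (*-congˡ (eval⟨⟩-∘ p q x)) ⟩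
    ι a + eval⟨ q ⟩ x * eval⟨ p ⟩ (eval⟨ q ⟩ x)              ∎

-- Ring homomorphisms between fields

module HomomorphismProperties {c₁ ℓ₁ c₂ ℓ₂} (F : Field c₁ ℓ₁) (K : Field c₂ ℓ₂) (ι : Field.Carrier F → Field.Carrier K)
  (isHom : IsRingHomomorphism (Field.rawRing F) (Field.rawRing K) ι) where
  private
    module F = Field F
    module FP = FieldProperties F
  open Field K hiding (zero)
  open FieldProperties K
  open IsRingHomomorphism isHom
  open SetoidReasoning setoid

  homo-≉0 : ∀ {x} → x F.≉ F.0# → ι x ≉ 0#
  homo-≉0 {x} x≉0 ιx≈0 = 1≉0 (begin
    1#               ≈⟨ 1#-homo ⟨
    ι F.1#           ≈⟨ ⟦⟧-cong (F.*-inverseʳ x≉0) ⟨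
    ι (x F.* x F.⁻¹) ≈⟨ *-homo _ _ ⟩
    ι x * ι (x F.⁻¹) ≈⟨ *-congʳ ιx≈0 ⟩
    0# * ι (x F.⁻¹)  ≈⟨ zeroˡ _ ⟩
    0#               ∎)

  homo-- : ∀ x y → ι (x F.- y) ≈ ι x - ι y
  homo-- x y = trans (+-homo x _) (+-congˡ (-‿homo y))

  homo-injective : ∀ {x y} → ι x ≈ ι y → x F.≈ y
  homo-injective {x} {y} ιx≈ιy with (x F.- y) F.≟ F.0#
  ... | yes x-y≈0 = FP.x-y≈0⇒x≈y x y x-y≈0
  ... | no  x-y≉0 = contradiction (trans (homo-- x y) (x≈y⇒x-y≈0 ιx≈ιy)) (homo-≉0 x-y≉0)

  homo-⁻¹ : ∀ {x} → x F.≉ F.0# → ι (x F.⁻¹) ≈ ι x ⁻¹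
  homo-⁻¹ {x} x≉0 = *-cancelˡ (homo-≉0 x≉0) (begin
    ι x * ι (x F.⁻¹)  ≈⟨ *-homo _ _ ⟨
    ι (x F.* x F.⁻¹)  ≈⟨ ⟦⟧-cong (F.*-inverseʳ x≉0) ⟩
    ι F.1#            ≈⟨ 1#-homo ⟩
    1#                ≈⟨ *-inverseʳ (homo-≉0 x≉0) ⟨
    ι x * ι x ⁻¹      ∎)

  homo-^ : ∀ x n → ι (x F.^ n) ≈ ι x ^ n
  homo-^ x zero    = 1#-homo
  homo-^ x (suc n) = trans (*-homo x _) (*-congˡ (homo-^ x n))

  homo-· : ∀ n x → ι (n F.· x) ≈ n · ι x
  homo-· zero    x = 0#-homo
  homo-· (suc n) x = trans (+-homo x _) (+-congˡ (homo-· n x))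

-- Orbits of an endomorphism with fixed field F

-- φ stands for the Frobenius automorphism.
module FixedField {c₁ ℓ₁ c₂ ℓ₂} (F : Field c₁ ℓ₁) (K : Field c₂ ℓ₂) (ι : Field.Carrier F → Field.Carrier K)
  (ι-hom : IsRingHomomorphism (Field.rawRing F) (Field.rawRing K) ι)
  (φ : Field.Carrier K → Field.Carrier K)
  (φ-hom : IsRingHomomorphism (Field.rawRing K) (Field.rawRing K) φ)
  (φ-ι : ∀ a → Field._≈_ K (φ (ι a)) (ι a))
  (φ-fixed : ∀ x → Field._≈_ K (φ x) x → ∃ λ a → Field._≈_ K (ι a) x)
  where
  private
    module F = Field F
    module F[X] = Polynomial F.rawRing
    module FP = PolynomialProperties F
  open Field K hiding (zero)
  open FieldProperties K
  open Polynomial rawRing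
  open PolynomialProperties K
  open MapProperties F K ι ι-hom public
  module ι where
    open HomomorphismProperties F K ι ι-hom public
    open IsRingHomomorphism ι-hom public
  open SetoidReasoning setoid
  open SumProperties *-commutativeMonoid using () renaming (sum to product)
  open MonoidMultProperties +-monoid using (×-congʳ)

  -- Applying φ first makes the tail of the conjugates of x definitionally the conjugates of φ x,
  -- which is how `norm` unfolds.
  φ^ : ℕ → Carrier → Carrier
  φ^ zero    x = x
  φ^ (suc n) x = φ^ n (φ x)

  φ^-suc : ∀ n x → φ^ (suc n) x ≡ φ (φ^ n x)
  φ^-suc zero    x = ≡.refl
  φ^-suc (suc n) x = φ^-suc n (φ x)

  φ^-+ : ∀ m n x → φ^ (m ℕ.+ n) x ≡ φ^ n (φ^ m x)
  φ^-+ zero    n x = ≡.refl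
  φ^-+ (suc m) n x = φ^-+ m n (φ x)

  φ^-hom : ∀ n → IsRingHomomorphism rawRing rawRing (φ^ n)
  φ^-hom zero    = Identity.isRingHomomorphism rawRing refl
  φ^-hom (suc n) = Composition.isRingHomomorphism trans φ-hom (φ^-hom n)

  module φ^ (n : ℕ) where
    open IsRingHomomorphism (φ^-hom n) public
    open HomomorphismProperties K K (φ^ n) (φ^-hom n) public
    open MapProperties K K (φ^ n) (φ^-hom n) public using (eval-map)

  φ^-ι : ∀ n a → φ^ n (ι a) ≈ ι a
  φ^-ι zero    a = refl
  φ^-ι (suc n) a = trans (φ^.⟦⟧-cong n (φ-ι a)) (φ^-ι n a)

  φ^-comm : ∀ m n x → φ^ m (φ^ n x) ≡ φ^ n (φ^ m x)
  φ^-comm m n x = ≡.trans (≡.sym (φ^-+ n m x)) (≡.trans (≡.cong (λ k → φ^ k x) (ℕ.+-comm n m)) (φ^-+ m n x))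

  φ^-fixed-* : ∀ k {d x} → φ^ d x ≈ x → φ^ (k ℕ.* d) x ≈ x
  φ^-fixed-* zero            fixed = refl
  φ^-fixed-* (suc k) {d} {x} fixed = begin
    φ^ (d ℕ.+ k ℕ.* d) x    ≡⟨ φ^-+ d (k ℕ.* d) x ⟩
    φ^ (k ℕ.* d) (φ^ d x)   ≈⟨ φ^.⟦⟧-cong (k ℕ.* d) fixed ⟩
    φ^ (k ℕ.* d) x          ≈⟨ φ^-fixed-* k fixed ⟩
    x                       ∎

  φ^-eval : ∀ n f x → φ^ n (eval⟨ f ⟩ x) ≈ eval⟨ f ⟩ (φ^ n x)
  φ^-eval n f x = begin
    φ^ n (eval⟨ f ⟩ x)                        ≈⟨ φ^.eval-map n (map ι f) x ⟨
    eval (map (φ^ n) (map ι f)) (φ^ n x)      ≈⟨ eval-≈ₚ (map (φ^ n) (map ι f)) (map ι f) (coefficients f) (φ^ n x) ⟩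
    eval⟨ f ⟩ (φ^ n x)                        ∎
    where
    coefficients : ∀ f → map (φ^ n) (map ι f) ≈ₚ map ι f
    coefficients []      i       = refl
    coefficients (a ∷ f) zero    = φ^-ι n a
    coefficients (a ∷ f) (suc i) = coefficients f i

  φ^-root : ∀ n f {x} → eval⟨ f ⟩ x ≈ 0# → eval⟨ f ⟩ (φ^ n x) ≈ 0#
  φ^-root n f {x} fx≈0 = trans (sym (φ^-eval n f x)) (trans (φ^.⟦⟧-cong n fx≈0) (φ^.0#-homo n))

  -- Equivalently, the first d conjugates α, φα, …, φᵈ⁻¹α are distinct.
  FreeBelow : Carrier → ℕ → Set ℓ₂
  FreeBelow α d = ∀ k → 0 < k → k < d → φ^ k α ≉ α

  conjugates : ∀ d → Carrier → Fin d → Carrier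
  conjugates d α i = φ^ (Fin.toℕ i) α

  FreeBelow⇒≉ : ∀ {α d m n} → FreeBelow α d → m < n → n < d → φ^ m α ≉ φ^ n α
  FreeBelow⇒≉ {α} {d} {m} {n} free m<n n<d φᵐα≈φⁿα =
    free (n ℕ.∸ m) (ℕ.m<n⇒0<n∸m m<n) (ℕ.≤-<-trans (ℕ.m∸n≤m n m) n<d) (sym (φ^.homo-injective m (begin
      φ^ m α                       ≈⟨ φᵐα≈φⁿα ⟩
      φ^ n α                       ≡⟨ ≡.cong (λ k → φ^ k α) (ℕ.m∸n+n≡m (ℕ.<⇒≤ m<n)) ⟨
      φ^ (n ℕ.∸ m ℕ.+ m) α         ≡⟨ φ^-+ (n ℕ.∸ m) m α ⟩
      φ^ m (φ^ (n ℕ.∸ m) α)        ∎)))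

  conjugates-distinct : ∀ {α d} → FreeBelow α d → Distinct (conjugates d α)
  conjugates-distinct {α} {d} free {i} {j} i≢j eq with ℕ.<-cmp (Fin.toℕ i) (Fin.toℕ j)
  ... | tri< i<j _ _ = FreeBelow⇒≉ free i<j (Fin.toℕ<n j) eq
  ... | tri≈ _ i≡j _ = i≢j (Fin.toℕ-injective i≡j)
  ... | tri> _ _ j<i = FreeBelow⇒≉ free j<i (Fin.toℕ<n i) (sym eq)

  conjugates-roots : ∀ f {α} d → eval⟨ f ⟩ α ≈ 0# → ∀ i → eval⟨ f ⟩ (conjugates d α i) ≈ 0#
  conjugates-roots f d fα≈0 i = φ^-root (Fin.toℕ i) f fα≈0

  FreeBelow⇒≤degree : ∀ {f d a α n} → FP.Leading f d a → a F.≉ F.0# → eval⟨ f ⟩ α ≈ 0# → FreeBelow α n → n ≤ d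
  FreeBelow⇒≤degree {f} {α = α} {n} Lf a≉0 fα≈0 free = roots≤degree (conjugates n α)
    (conjugates-distinct free) (ι.homo-≉0 a≉0) (map-leading Lf) (conjugates-roots f n fα≈0)

  FreeBelow-suc : ∀ {α d} → FreeBelow α d → φ^ d α ≉ α → FreeBelow α (suc d)
  FreeBelow-suc free φᵈα≉α k 0<k k<1+d with ℕ.m≤n⇒m<n∨m≡n (ℕ.≤-pred k<1+d)
  ... | inj₁ k<d    = free k 0<k k<d
  ... | inj₂ ≡.refl = φᵈα≉α

  -- Otherwise α, φα, ..., φᵈα would be d + 1 distinct roots of a polynomial of degree d.
  FreeBelow⇒fixed : ∀ {f d a α} → FP.Leading f d a → a F.≉ F.0# → eval⟨ f ⟩ α ≈ 0# → FreeBelow α d → φ^ d α ≈ α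
  FreeBelow⇒fixed {d = d} {α = α} Lf a≉0 fα≈0 free with φ^ d α ≟ α
  ... | yes φᵈα≈α = φᵈα≈α
  ... | no  φᵈα≉α = contradiction (FreeBelow⇒≤degree Lf a≉0 fα≈0 (FreeBelow-suc free φᵈα≉α)) ℕ.1+n≰n

  product-≈0 : ∀ {n} (f : Fin n → Carrier) → product f ≈ 0# → ∃ λ i → f i ≈ 0#
  product-≈0 {zero}  f 1≈0 = contradiction 1≈0 1≉0
  product-≈0 {suc n} f f≈0 with *-zeroProduct f≈0
  ... | inj₁ f₀≈0 = zero , f₀≈0
  ... | inj₂ rest with product-≈0 (f ∘ suc) rest
  ...   | i , fᵢ≈0 = suc i , fᵢ≈0

  -- The d conjugates of α are all the roots of f, so β = φᵐα for some m. Powers of φ commute and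
  -- are injective, hence a period of β is a period of α.
  FreeBelow-conjugate : ∀ {f d a α β} → FP.Leading f d a → a F.≉ F.0# → eval⟨ f ⟩ α ≈ 0# → eval⟨ f ⟩ β ≈ 0# →
                        FreeBelow α d → FreeBelow β d
  FreeBelow-conjugate {f} {d} {a} {α} {β} Lf a≉0 fα≈0 fβ≈0 free k 0<k k<d φᵏβ≈β
    with *-zeroProduct (trans (sym (factorisation (conjugates d α) (conjugates-distinct free) (map-leading Lf)
        (conjugates-roots f d fα≈0) β)) fβ≈0)
  ... | inj₁ ιa≈0    = ι.homo-≉0 a≉0 ιa≈0
  ... | inj₂ product≈0 with product-≈0 (λ i → β - conjugates d α i) product≈0
  ...   | i , β-φⁱα≈0 = free k 0<k k<d (φ^.homo-injective m (begin
      φ^ m (φ^ k α)  ≡⟨ φ^-comm m k α ⟩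
      φ^ k (φ^ m α)  ≈⟨ φ^.⟦⟧-cong k β≈φᵐα ⟨
      φ^ k β         ≈⟨ φᵏβ≈β ⟩
      β              ≈⟨ β≈φᵐα ⟩
      φ^ m α         ∎))
    where
    m : ℕ
    m = Fin.toℕ i
    β≈φᵐα : β ≈ φ^ m α
    β≈φᵐα = x-y≈0⇒x≈y _ _ β-φⁱα≈0

  descend : ∀ p → (∀ i → φ (coeff p i) ≈ coeff p i) → ∃ λ f → map ι f ≈ₚ p
  descend []      fixed = [] , λ _ → refl
  descend (x ∷ p) fixed with φ-fixed x (fixed 0) | descend p (fixed ∘ suc)
  ... | a , ιa≈x | f , f≈p = a ∷ f , λ { zero → ιa≈x ; (suc i) → f≈p i }

  -- The polynomial interpolating φⁱα ↦ φⁱx is unique, hence invariant under φ.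
  generates : ∀ {α k x} → 0 < k → FreeBelow α k → φ^ k α ≈ α → φ^ k x ≈ x →
              ∃ λ f → FP.DegreeBelow f k × eval⟨ f ⟩ α ≈ x
  generates {α} {suc k} {x} _ free α-fixed x-fixed
    with interpolation (conjugates (suc k) α) (conjugates (suc k) x) (conjugates-distinct free)
  ... | p , p< , values = f , below , trans (eval-≈ₚ (map ι f) p f≈p α) (values zero)
    where
    module φ where
      open IsRingHomomorphism φ-hom public
      open MapProperties K K φ φ-hom public
    values′ : ∀ n → n < suc k → eval p (φ^ n α) ≈ φ^ n x
    values′ n n<k = ≡.subst (λ m → eval p (φ^ m α) ≈ φ^ m x) (Fin.toℕ-fromℕ< n<k) (values (Fin.fromℕ< n<k))
    step : ∀ n → n < suc k → eval (map φ p) (φ^ (suc n) α) ≈ φ^ (suc n) x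
    step n n<k = begin
      eval (map φ p) (φ^ (suc n) α)  ≡⟨ ≡.cong (eval (map φ p)) (φ^-suc n α) ⟩
      eval (map φ p) (φ (φ^ n α))    ≈⟨ φ.eval-map p (φ^ n α) ⟩
      φ (eval p (φ^ n α))            ≈⟨ φ.⟦⟧-cong (values′ n n<k) ⟩
      φ (φ^ n x)                     ≡⟨ φ^-suc n x ⟨
      φ^ (suc n) x                   ∎
    φ-values : ∀ i → eval p (conjugates (suc k) α i) ≈ eval (map φ p) (conjugates (suc k) α i)
    -- The orbit closes up here: the value at α is reached from the last conjugate because
    -- `φ^ (suc k)` fixes both α and x.
    φ-values zero    = begin
      eval p α                       ≈⟨ values zero ⟩
      x                              ≈⟨ x-fixed ⟨
      φ^ (suc k) x                   ≈⟨ step k ℕ.≤-refl ⟨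
      eval (map φ p) (φ^ (suc k) α)  ≈⟨ eval-cong (map φ p) α-fixed ⟩
      eval (map φ p) α               ∎
    φ-values (suc i) = trans (values (suc i)) (sym (step (Fin.toℕ i) (ℕ.m≤n⇒m≤1+n (Fin.toℕ<n i))))
    invariant : p ≈ₚ map φ p
    invariant = interpolation-unique {p = p} {map φ p} (conjugates (suc k) α) (conjugates-distinct free) p<
        (φ.map-below {p} p<) φ-values
    descended : ∃ λ f → map ι f ≈ₚ p
    descended = descend p (λ i → trans (sym (φ.coeff-map p i)) (sym (invariant i)))
    f : F[X].Poly
    f = proj₁ descended
    f≈p : map ι f ≈ₚ p
    f≈p = proj₂ descended
    below : FP.DegreeBelow f (suc k)
    below i k<i = ι.homo-injective (begin
      ι (F[X].coeff f i)  ≈⟨ coeff-map f i ⟨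
      coeff (map ι f) i   ≈⟨ f≈p i ⟩
      coeff p i           ≈⟨ p< i k<i ⟩
      0#                  ≈⟨ ι.0#-homo ⟨
      ι F.0#              ∎)

  root⇒¬Unit : ∀ f {α} → eval⟨ f ⟩ α ≈ 0# → ¬ FP.Unit f
  root⇒¬Unit f {α} fα≈0 (q , qf≈1) = 1≉0 (begin
    1#                         ≈⟨ trans (eval⟨⟩-C F.1# α) ι.1#-homo ⟨
    eval⟨ F[X].C F.1# ⟩ α      ≈⟨ eval⟨⟩-≈ₚ (q F[X].*ₚ f) (F[X].C F.1#) qf≈1 α ⟨
    eval⟨ q F[X].*ₚ f ⟩ α      ≈⟨ eval⟨⟩-* q f α ⟩
    eval⟨ q ⟩ α * eval⟨ f ⟩ α  ≈⟨ trans (*-congˡ fα≈0) (zeroʳ _) ⟩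
    0#                         ∎)

  FreeBelow⇒irreducible : ∀ {f d a α} → FP.Leading f d a → a F.≉ F.0# → eval⟨ f ⟩ α ≈ 0# → FreeBelow α d →
                          F[X].Irreducible f
  FreeBelow⇒irreducible {f} {d} {a} {α} Lf a≉0 fα≈0 free = record
    { p∤1 = λ { (q , qf≈1) → root⇒¬Unit f fα≈0 (q , qf≈1) }
    ; split-∣1 = λ {g} {h} → split g h
    }
    where
    -- A factor vanishing at α has all d conjugates of α as roots, which leaves degree 0 for the other one.
    cofactor : ∀ {m n b c} → d ≡ m ℕ.+ n → b F.≉ F.0# → c F.≉ F.0# →
               ∀ {g h} → FP.Leading g m b → FP.Leading h n c → eval⟨ g ⟩ α ≈ 0# → FP.Unit h
    cofactor {m} {n} ≡.refl b≉0 c≉0 Lg Lh gα≈0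
      with ≡.refl ← ℕ.n≤0⇒n≡0 (ℕ.+-cancelˡ-≤ m n 0
             (ℕ.≤-trans (FreeBelow⇒≤degree Lg b≉0 gα≈0 free) (ℕ.≤-reflexive (≡.sym (ℕ.+-identityʳ m))))) =
      FP.Leading-0⇒Unit c≉0 Lh
    split : ∀ g h → f F[X].≈ₚ g F[X].*ₚ h → _
    split g h f≈gh with FP.Leading-factors g h a≉0 Lf f≈gh
    ... | m , n , b , c , b≉0 , c≉0 , Lg , Lh , d≡m+n
      with *-zeroProduct (trans (sym (trans (eval⟨⟩-≈ₚ f (g F[X].*ₚ h) f≈gh α) (eval⟨⟩-* g h α))) fα≈0)
    ...   | inj₁ gα≈0 with q , qh≈1 ← cofactor d≡m+n b≉0 c≉0 Lg Lh gα≈0 = inj₂ (q , qh≈1)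
    ...   | inj₂ hα≈0 with q , qg≈1 ← cofactor (≡.trans d≡m+n (ℕ.+-comm m n)) c≉0 b≉0 Lh Lg hα≈0 = inj₁ (q , qg≈1)

  eval⟨⟩-monomial : ∀ n x → eval⟨ FP.monomial n ⟩ x ≈ x ^ n
  eval⟨⟩-monomial zero    x = trans (eval⟨⟩-C F.1# x) ι.1#-homo
  eval⟨⟩-monomial (suc n) x = trans (+-cong ι.0#-homo (*-congˡ (eval⟨⟩-monomial n x))) (+-identityˡ _)

  FreeBelow⇒≈0 : ∀ {α n f} → FreeBelow α n → FP.DegreeBelow f n → eval⟨ f ⟩ α ≈ 0# → f F[X].≈ₚ []
  FreeBelow⇒≈0 {α} {n} {f} free f< fα≈0 i = ι.homo-injective (begin
    ι (F[X].coeff f i)  ≈⟨ coeff-map f i ⟨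
    coeff (map ι f) i   ≈⟨ rootsBound {p = map ι f} (conjugates n α) (conjugates-distinct free) (map-below {f} f<)
        (conjugates-roots f n fα≈0) i ⟩
    0#                  ≈⟨ ι.0#-homo ⟨
    ι F.0#              ∎)

  monic-root : ∀ {α k} f → FP.DegreeBelow f k → eval⟨ f ⟩ α ≈ α ^ k →
               ∃ λ g → FP.Leading g k F.1# × eval⟨ g ⟩ α ≈ 0#
  monic-root {α} {k} f f< fα≈αᵏ =
    FP.monomial k F[X].-ₚ f ,
    FP.Leading-- {p = FP.monomial k} {q = f} f< (FP.monomial-leading k) ,
    trans (eval⟨⟩-- (FP.monomial k) f α) (x≈y⇒x-y≈0 (trans (eval⟨⟩-monomial k α) (sym fα≈αᵏ)))

  φ^-fixed-^ : ∀ {α} k n → φ^ k α ≈ α → φ^ k (α ^ n) ≈ α ^ n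
  φ^-fixed-^ {α} k n α-fixed = trans (φ^.homo-^ k α n) (^-congˡ n α-fixed)

  -- φᵏ fixes αᵏ along with α, so αᵏ is a combination of lower powers of α; this relation is the
  -- polynomial.
  minimalPolynomial : ∀ {α k} → 0 < k → FreeBelow α k → φ^ k α ≈ α →
                      ∃ λ g → FP.Leading g k F.1# × eval⟨ g ⟩ α ≈ 0#
  minimalPolynomial {α} {k} 0<k free α-fixed =
    let f , f< , fα≈αᵏ = generates 0<k free α-fixed (φ^-fixed-^ k k α-fixed)
    in monic-root f f< fα≈αᵏ

  -- The remainder of f modulo g vanishes at k + 1 distinct conjugates of α and has smaller degree
  -- than that, so it is zero.
  minimalPolynomial-divides : ∀ {α k} f g → FreeBelow α (suc k) → FP.Leading g (suc k) F.1# →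
                              eval⟨ g ⟩ α ≈ 0# → eval⟨ f ⟩ α ≈ 0# → ∃ λ q → f F[X].≈ₚ q F[X].*ₚ g
  minimalPolynomial-divides {α} f g free Lg gα≈0 fα≈0 with FP.division Lg f
  ... | q , r , f≈qg+r , r< = q , λ i → F.trans (f≈qg+r i) (F.trans (FP.coeff-+ (q F[X].*ₚ g) r i)
        (F.trans (F.+-congˡ (FreeBelow⇒≈0 {f = r} free r< rα≈0 i)) (F.+-identityʳ _)))
    where
    rα≈0 : eval⟨ r ⟩ α ≈ 0#
    rα≈0 = begin
      eval⟨ r ⟩ α                                ≈⟨ +-identityˡ _ ⟨
      0# + eval⟨ r ⟩ α                           ≈⟨ +-congʳ (trans (*-congˡ gα≈0) (zeroʳ _)) ⟨
      eval⟨ q ⟩ α * eval⟨ g ⟩ α + eval⟨ r ⟩ α    ≈⟨ +-congʳ (eval⟨⟩-* q g α) ⟨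
      eval⟨ q F[X].*ₚ g ⟩ α + eval⟨ r ⟩ α        ≈⟨ eval⟨⟩-+ (q F[X].*ₚ g) r α ⟨
      eval⟨ q F[X].*ₚ g F[X].+ₚ r ⟩ α            ≈⟨ eval⟨⟩-≈ₚ f (q F[X].*ₚ g F[X].+ₚ r) f≈qg+r α ⟨
      eval⟨ f ⟩ α                                ≈⟨ fα≈0 ⟩
      0#                                         ∎

  -- The least period k < d of α would give a minimal polynomial of degree k dividing f, a proper
  -- factor. Strong induction supplies the minimality: the excluded smaller periods are exactly
  -- `FreeBelow α k`.
  irreducible⇒FreeBelow : ∀ {f d a α} → FP.Leading f d a → a F.≉ F.0# → eval⟨ f ⟩ α ≈ 0# → F[X].Irreducible f →
                          FreeBelow α d
  irreducible⇒FreeBelow {f} {d} {a} {α} Lf a≉0 fα≈0 irr =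
    <-rec (λ k → 0 < k → k < d → φ^ k α ≉ α) λ k smaller 0<k k<d →
      minimal k 0<k k<d (λ j 0<j j<k → smaller j<k 0<j (ℕ.<-trans j<k k<d))
    where
    improper : ∀ {k} g q → k < d → FP.Leading g k F.1# → eval⟨ g ⟩ α ≈ 0# → f F[X].≈ₚ q F[X].*ₚ g → ⊥
    improper {k} g q k<d Lg gα≈0 f≈qg with F[X].Irreducible.split-∣1 irr {q} {g} f≈qg
    ... | inj₂ (u , ug≈1) = root⇒¬Unit g gα≈0 (u , ug≈1)
    ... | inj₁ (u , uq≈1) with FP.Unit⇒Leading-0 q (u , uq≈1)
    ...   | b , b≉0 , Lq = ℕ.<⇒≢ k<d
      (FP.Leading-unique (FieldProperties.*-≉0 F b≉0 F.1≉0) a≉0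
        (FP.Leading-≈ₚ (λ i → F.sym (f≈qg i)) (FP.Leading-* Lq Lg)) Lf)
    minimal : ∀ k → 0 < k → k < d → FreeBelow α k → φ^ k α ≉ α
    minimal (suc k) _ k<d free α-fixed =
      let g , Lg , gα≈0 = minimalPolynomial (s≤s z≤n) free α-fixed
          q , f≈qg = minimalPolynomial-divides f g free Lg gα≈0 fα≈0
      in improper g q k<d Lg gα≈0 f≈qg

  norm : ℕ → Carrier → Carrier
  norm n x = product (conjugates n x)

  -- φ shifts the product of x, φx, ..., φⁿ⁻¹x by one place. For x nonzero this means that φ fixes
  -- the norm exactly when φⁿ fixes x; the form without division covers x = 0 as well.
  norm-φ : ∀ n x → φ (norm n x) * x ≈ norm n x * φ^ n x
  norm-φ zero    x = *-congʳ φ.1#-homo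
    where module φ = IsRingHomomorphism φ-hom
  norm-φ (suc n) x = begin
    φ (x * norm n (φ x)) * x           ≈⟨ *-congʳ (φ.*-homo x _) ⟩
    φ x * φ (norm n (φ x)) * x         ≈⟨ solve 3 (λ x u v → u :* v :* x := x :* (v :* u)) refl x _ _ ⟩
    x * (φ (norm n (φ x)) * φ x)       ≈⟨ *-congˡ (norm-φ n (φ x)) ⟩
    x * (norm n (φ x) * φ^ n (φ x))    ≈⟨ *-assoc _ _ _ ⟨
    x * norm n (φ x) * φ^ n (φ x)      ∎
    where
    module φ = IsRingHomomorphism φ-hom
    open IntegerSolver commutativeRing

  -- The elements fixed by φⁿ form a subfield containing F.
  Adjoin-fixed : ∀ {xs x} n → All (λ y → φ^ n y ≈ y) xs → Adjoin F K ι xs x → φ^ n x ≈ x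
  Adjoin-fixed n fixed (base a)                    = φ^-ι n a
  Adjoin-fixed n fixed (generator y∈xs)            = All.lookupWith (λ fx y≈x →
      trans (φ^.⟦⟧-cong n y≈x) (trans fx (sym y≈x))) fixed y∈xs
  Adjoin-fixed n fixed (resp x≈y x∈)               = trans (φ^.⟦⟧-cong n (sym x≈y)) (trans (Adjoin-fixed n fixed x∈) x≈y)
  Adjoin-fixed n fixed (add x∈ y∈)                 = trans (φ^.+-homo n _ _) (+-cong (Adjoin-fixed n fixed x∈)
      (Adjoin-fixed n fixed y∈))
  Adjoin-fixed n fixed (neg x∈)                    = trans (φ^.-‿homo n _) (-‿cong (Adjoin-fixed n fixed x∈))
  Adjoin-fixed n fixed (mul x∈ y∈)                 = trans (φ^.*-homo n _ _) (*-cong (Adjoin-fixed n fixed x∈)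
      (Adjoin-fixed n fixed y∈))
  Adjoin-fixed n fixed (inv x≉0 x∈)                = trans (φ^.homo-⁻¹ n x≉0) (⁻¹-cong (Adjoin-fixed n fixed x∈))

  Adjoin-eval : ∀ {xs x} f → Adjoin F K ι xs x → Adjoin F K ι xs (eval⟨ f ⟩ x)
  Adjoin-eval []      x∈ = resp ι.0#-homo (base F.0#)
  Adjoin-eval (a ∷ f) x∈ = add (base a) (mul x∈ (Adjoin-eval f x∈))

  Adjoin-monotone : ∀ {xs ys x} → (∀ {y} → Any (y ≈_) xs → Any (y ≈_) ys) → Adjoin F K ι xs x → Adjoin F K ι ys x
  Adjoin-monotone xs⊆ys (base a)         = base a
  Adjoin-monotone xs⊆ys (generator x∈xs) = generator (xs⊆ys x∈xs)
  Adjoin-monotone xs⊆ys (resp x≈y x∈)    = resp x≈y (Adjoin-monotone xs⊆ys x∈)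
  Adjoin-monotone xs⊆ys (add x∈ y∈)      = add (Adjoin-monotone xs⊆ys x∈) (Adjoin-monotone xs⊆ys y∈)
  Adjoin-monotone xs⊆ys (neg x∈)         = neg (Adjoin-monotone xs⊆ys x∈)
  Adjoin-monotone xs⊆ys (mul x∈ y∈)      = mul (Adjoin-monotone xs⊆ys x∈) (Adjoin-monotone xs⊆ys y∈)
  Adjoin-monotone xs⊆ys (inv x≉0 x∈)     = inv x≉0 (Adjoin-monotone xs⊆ys x∈)

  Adjoin-numeral : ∀ {xs} n → Adjoin F K ι xs (n · 1#)
  Adjoin-numeral n = resp (trans (ι.homo-· n F.1#) (×-congʳ n ι.1#-homo)) (base (n F.· F.1#))

  Adjoin-^ : ∀ {xs x} n → Adjoin F K ι xs x → Adjoin F K ι xs (x ^ n)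
  Adjoin-^ zero    x∈ = resp ι.1#-homo (base F.1#)
  Adjoin-^ (suc n) x∈ = mul x∈ (Adjoin-^ n x∈)

  -- The converse of `Adjoin-fixed` for one generator: by `generates` the element is a polynomial in
  -- α over F.
  fixed⇒Adjoin : ∀ {α k x} → 0 < k → FreeBelow α k → φ^ k α ≈ α → φ^ k x ≈ x → Adjoin F K ι (α ∷ []) x
  fixed⇒Adjoin 0<k free α-fixed x-fixed with f , _ , fα≈x ← generates 0<k free α-fixed x-fixed =
    resp fα≈x (Adjoin-eval f (generator (here refl)))

-- Binomial coefficients and characteristic p

prime∤! : ∀ {p} → Prime p → ∀ k → k < p → ¬ (p ∣ k !)
prime∤! pp zero    _   p∣1 = ℕ.nonTrivial⇒≢1 {{prime⇒nonTrivial pp}} (ℕ.∣1⇒≡1 p∣1)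
prime∤! pp (suc k) k<p p∣  with euclidsLemma (suc k) (k !) pp p∣
... | inj₁ p∣1+k = ℕ.>⇒∤ k<p p∣1+k
... | inj₂ p∣k!  = prime∤! pp k (ℕ.<⇒≤ k<p) p∣k!

-- p divides the product of the binomial coefficient with k! and (p - k)!, which is p!, but it
-- divides neither of these factorials.
prime∣choose : ∀ {p} → Prime p → ∀ {k} → 0 < k → k < p → p ∣ p choose k
prime∣choose {suc p} pp {k} 0<k k<p with euclidsLemma _ _ pp (≡.subst (suc p ∣_) (≡.sym C*k![p-k]!≡p!) (ℕ.m∣m*n (p !)))
  where
  instance _ = ℕ._!*_!≢0 k (suc p ℕ.∸ k)
  C*k![p-k]!≡p! : (suc p choose k) ℕ.* (k ! ℕ.* (suc p ℕ.∸ k) !) ≡ suc p !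
  C*k![p-k]!≡p! = ≡.trans (≡.cong (ℕ._* (k ! ℕ.* (suc p ℕ.∸ k) !)) (ℕ.nCk≡n!/k![n-k]! (ℕ.<⇒≤ k<p)))
    (m/n*n≡m (ℕ.k![n∸k]!∣n! (ℕ.<⇒≤ k<p)))
... | inj₁ p∣C = p∣C
... | inj₂ p∣k![p-k]! with euclidsLemma (k !) _ pp p∣k![p-k]!
...   | inj₁ p∣k!     = contradiction p∣k! (prime∤! pp k k<p)
...   | inj₂ p∣[p-k]! = contradiction p∣[p-k]! (prime∤! pp (suc p ℕ.∸ k) (ℕ.∸-monoʳ-< 0<k (ℕ.<⇒≤ k<p)))

module Characteristic {c ℓ} (K : Field c ℓ) {p} (pp : Prime p) (p·1≈0 : Field._≈_ K (Field._·_ K p (Field.1# K))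
    (Field.0# K)) where
  open Field K hiding (zero)
  open FieldProperties K
  open SetoidReasoning setoid
  open SumProperties +-commutativeMonoid using (sum; sum-cong-≋; sum-replicate-zero; sum-init-last)

  p∣n⇒n·x≈0 : ∀ {n} → p ∣ n → ∀ x → n · x ≈ 0#
  p∣n⇒n·x≈0 {n} (divides m ≡.refl) x = begin
    (m ℕ.* p) · x            ≈⟨ ·-as-* (m ℕ.* p) x ⟩
    (m ℕ.* p) · 1# * x       ≈⟨ *-congʳ (×1-homo-* m p) ⟩
    m · 1# * (p · 1#) * x    ≈⟨ *-congʳ (trans (*-congˡ p·1≈0) (zeroʳ _)) ⟩
    0# * x                   ≈⟨ zeroˡ x ⟩
    0#                       ∎

  -- n and p are coprime, so a Bézout relation would make 1 vanish if both `n · 1#` and `p · 1#`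
  -- did.
  n·1≉0 : ∀ n → .{{ℕ.NonZero n}} → n < p → n · 1# ≉ 0#
  n·1≉0 n n<p n·1≈0 with coprime-Bézout (prime⇒coprime pp n<p)
  ... | Bézout.+- x y eq = 1≉0 (begin
    1#                             ≈⟨ +-identityʳ 1# ⟨
    1# + 0#                        ≈⟨ +-congˡ (trans (×1-homo-* y n) (trans (*-congˡ n·1≈0) (zeroʳ _))) ⟨
    (1 ℕ.+ y ℕ.* n) · 1#           ≡⟨ ≡.cong (_· 1#) eq ⟩
    (x ℕ.* p) · 1#                 ≈⟨ p∣n⇒n·x≈0 (divides x ≡.refl) 1# ⟩
    0#                             ∎)
  ... | Bézout.-+ x y eq = 1≉0 (begin
    1#                             ≈⟨ +-identityʳ 1# ⟨
    1# + 0#                        ≈⟨ +-congˡ (p∣n⇒n·x≈0 (divides x ≡.refl) 1#) ⟨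
    (1 ℕ.+ x ℕ.* p) · 1#           ≡⟨ ≡.cong (_· 1#) eq ⟩
    (y ℕ.* n) · 1#                 ≈⟨ trans (×1-homo-* y n) (trans (*-congˡ n·1≈0) (zeroʳ _)) ⟩
    0#                             ∎)

  sum-≈0 : ∀ {n} (t : Fin n → Carrier) → (∀ i → t i ≈ 0#) → sum t ≈ 0#
  sum-≈0 {n} t t≈0 = trans (sum-cong-≋ t≈0) (sum-replicate-zero n)

  -- Every inner binomial coefficient is a multiple of p. The auxiliary `n ≡ p` lets n be taken
  -- apart as `suc m`, as is needed to split off the two outer terms.
  +-^p : ∀ x y → (x + y) ^ p ≈ x ^ p + y ^ p
  +-^p x y = expand p ≡.refl
    where
    open Binomial commutativeSemiring using (theorem; binomialTerm)
    expand : ∀ n → n ≡ p → (x + y) ^ n ≈ x ^ n + y ^ n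
    expand zero      0≡p    = contradiction (≡.subst (1 <_) (≡.sym 0≡p) (ℕ.nonTrivial⇒n>1 p {{prime⇒nonTrivial pp}})) ℕ.n≮0
    expand n@(suc m) ≡.refl = begin
      (x + y) ^ n                            ≈⟨ theorem n x y ⟩
      term zero + sum (term ∘ suc)           ≈⟨ +-cong first (sum-init-last (term ∘ suc)) ⟩
      y ^ n + (sum (λ i → term (suc (Fin.inject₁ i))) + term (Fin.fromℕ n))
                                             ≈⟨ +-congˡ (+-cong (sum-≈0 _ middle) last) ⟩
      y ^ n + (0# + x ^ n)                   ≈⟨ trans (+-congˡ (+-identityˡ _)) (+-comm _ _) ⟩
      x ^ n + y ^ n                          ∎
      where
      term : Fin (suc n) → Carrier
      term = binomialTerm x y n
      first : term zero ≈ y ^ n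
      first = begin
        (n choose 0) · (1# * y ^ n)   ≡⟨ ≡.cong (_· (1# * y ^ n)) (≡.trans (ℕ.nCk≡nC[n∸k] (z≤n {n})) (ℕ.nCn≡1 n)) ⟩
        1# * y ^ n + 0#               ≈⟨ +-identityʳ _ ⟩
        1# * y ^ n                    ≈⟨ *-identityˡ _ ⟩
        y ^ n                         ∎
      last : term (Fin.fromℕ n) ≈ x ^ n
      last = begin
        term (Fin.fromℕ n)                     ≡⟨ ≡.cong (λ k → (n choose k) · (x ^ k * y ^ (n ℕ.∸ k))) (Fin.toℕ-fromℕ n) ⟩
        (n choose n) · (x ^ n * y ^ (n ℕ.∸ n)) ≡⟨ ≡.cong₂ (λ c k → c · (x ^ n * y ^ k)) (ℕ.nCn≡1 n) (ℕ.n∸n≡0 n) ⟩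
        x ^ n * 1# + 0#                        ≈⟨ trans (+-identityʳ _) (*-identityʳ _) ⟩
        x ^ n                                  ∎
      middle : ∀ i → term (suc (Fin.inject₁ i)) ≈ 0#
      middle i = p∣n⇒n·x≈0 (prime∣choose pp (s≤s z≤n) (s≤s (≡.subst (_< m) (≡.sym (Fin.toℕ-inject₁ i)) (Fin.toℕ<n i)))) _

  +-^pˢ : ∀ s x y → (x + y) ^ (p ℕ.^ s) ≈ x ^ (p ℕ.^ s) + y ^ (p ℕ.^ s)
  +-^pˢ zero    x y = distribʳ 1# x y
  +-^pˢ (suc s) x y = begin
    (x + y) ^ (p ℕ.* p ℕ.^ s)                      ≈⟨ ^-assocʳ (x + y) p _ ⟨
    ((x + y) ^ p) ^ (p ℕ.^ s)                      ≈⟨ ^-congˡ (p ℕ.^ s) (+-^p x y) ⟩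
    (x ^ p + y ^ p) ^ (p ℕ.^ s)                    ≈⟨ +-^pˢ s (x ^ p) (y ^ p) ⟩
    (x ^ p) ^ (p ℕ.^ s) + (y ^ p) ^ (p ℕ.^ s)      ≈⟨ +-cong (^-assocʳ x p _) (^-assocʳ y p _) ⟩
    x ^ (p ℕ.* p ℕ.^ s) + y ^ (p ℕ.* p ℕ.^ s)      ∎

-- Sums and products over a finite field

module FiniteField {c ℓ} (F : Field c ℓ) where
  open Field F hiding (zero)
  open FieldProperties F
  open PolynomialProperties F using (product-≉0)
  open SetoidReasoning setoid
  open SumProperties +-commutativeMonoid using (sum; sum-permute; ∑-distrib-+; sum-cong-≋; sum-replicate)
  private module ∏ = SumProperties *-commutativeMonoid

  module _ {q} (card : HasCardinality F q) where
    open Inverse card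

    from∘to : ∀ x → from (to x) ≈ x
    from∘to x = strictlyInverseʳ x

    -- A bijection of F becomes a permutation of the enumeration, so that sums and products over F
    -- can be reindexed along it.
    transport : (f g : Carrier → Carrier) → (∀ {x y} → x ≈ y → f x ≈ f y) → (∀ {x y} → x ≈ y → g x ≈ g y) →
                (∀ x → f (g x) ≈ x) → (∀ x → g (f x) ≈ x) → Permutation q q
    transport f g f-cong g-cong fg≈id gf≈id = Permutation.permutation (to ∘ f ∘ from) (to ∘ g ∘ from)
      (λ i → ≡.trans (to-cong (trans (f-cong (from∘to _)) (fg≈id _))) (strictlyInverseˡ i))
      (λ i → ≡.trans (to-cong (trans (g-cong (from∘to _)) (gf≈id _))) (strictlyInverseˡ i))

    -- Translation by x permutes F, so x can be added to every term of the sum of all elements.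
    q·x≈0 : ∀ x → q · x ≈ 0#
    q·x≈0 x = s+y≈s⇒y≈0 (begin
      sum from + q · x                 ≈⟨ +-congˡ (sum-replicate q) ⟨
      sum from + sum {q} (λ _ → x)     ≈⟨ ∑-distrib-+ from (λ _ → x) ⟨
      sum (λ i → from i + x)           ≈⟨ sum-cong-≋ (λ i → from∘to (from i + x)) ⟨
      sum (λ i → from (to (from i + x)))  ≈⟨ sum-permute from translation ⟨
      sum from                         ∎)
      where
      open IntegerSolver commutativeRing
      translation : Permutation q q
      translation = transport (_+ x) (_- x) +-congʳ +-congʳ
        (solve 2 (λ x y → y :- x :+ x := y) refl x) (solve 2 (λ x y → y :+ x :- x := y) refl x)
      s+y≈s⇒y≈0 : ∀ {s y} → s + y ≈ s → y ≈ 0#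
      s+y≈s⇒y≈0 {s} {y} eq = trans (solve 2 (λ s y → y := s :+ y :- s) refl s y) (x≈y⇒x-y≈0 eq)

  -- Fermat: multiplication by x ≉ 0 permutes F, so it leaves the product of the nonzero elements unchanged.
  x^q≈x : ∀ {q} → HasCardinality F q → ∀ x → x ^ q ≈ x
  x^q≈x {zero}  card x with () ← Inverse.to card x
  x^q≈x {suc n} card x with x ≟ 0#
  ... | yes x≈0 = trans (*-congʳ x≈0) (trans (zeroˡ _) (sym x≈0))
  ... | no  x≉0 = trans (*-congˡ xⁿ≈1) (*-identityʳ x)
    where
    open Inverse card
    scaling : Permutation (suc n) (suc n)
    scaling = transport card (x *_) (x ⁻¹ *_) *-congˡ *-congˡ
      (λ y → trans (sym (*-assoc _ _ _)) (trans (*-congʳ (*-inverseʳ x≉0)) (*-identityˡ y)))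
      (λ y → trans (sym (*-assoc _ _ _)) (trans (*-congʳ (*-inverseˡ x≉0)) (*-identityˡ y)))
    -- `nonzero` replaces 0 by 1, so its product over all of F is the product of the nonzero
    -- elements. `factor y` is what multiplication of y by x contributes to it: x, except 1 at y =
    -- 0.
    nonzero factor : Carrier → Carrier
    nonzero y with y ≟ 0#
    ... | yes _ = 1#
    ... | no  _ = y
    factor y with y ≟ 0#
    ... | yes _ = 1#
    ... | no  _ = x
    nonzero-≉0 : ∀ y → nonzero y ≉ 0#
    nonzero-≉0 y with y ≟ 0#
    ... | yes _   = 1≉0
    ... | no  y≉0 = y≉0
    nonzero-scaled : ∀ {y z} → z ≈ x * y → nonzero z ≈ factor y * nonzero y
    nonzero-scaled {y} {z} z≈xy with z ≟ 0# | y ≟ 0#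
    ... | yes _   | yes _   = sym (*-identityˡ 1#)
    ... | yes z≈0 | no  y≉0 = contradiction (trans (sym z≈xy) z≈0) (*-≉0 x≉0 y≉0)
    ... | no  z≉0 | yes y≈0 = contradiction (trans z≈xy (trans (*-congˡ y≈0) (zeroʳ x))) z≉0
    ... | no  _   | no  _   = z≈xy
    factor-0 : ∀ {y} → y ≈ 0# → factor y ≈ 1#
    factor-0 {y} y≈0 with y ≟ 0#
    ... | yes _   = refl
    ... | no  y≉0 = contradiction y≈0 y≉0
    factor-x : ∀ {y} → y ≉ 0# → factor y ≈ x
    factor-x {y} y≉0 with y ≟ 0#
    ... | yes y≈0 = contradiction y≈0 y≉0
    ... | no  _   = refl
    -- The index of 0, the only place where `factor` is 1; the other n places together give xⁿ.
    i₀ : Fin (suc n)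
    i₀ = to 0#
    from-≉0 : ∀ j → from (Fin.punchIn i₀ j) ≉ 0#
    from-≉0 j eq = Fin.punchInᵢ≢i i₀ j (≡.trans (≡.sym (strictlyInverseˡ _)) (to-cong eq))
    xⁿ≈1 : x ^ n ≈ 1#
    xⁿ≈1 = begin
      x ^ n                                                    ≈⟨ ∏.sum-replicate n ⟨
      ∏.sum {n} (λ _ → x)                                      ≈⟨ ∏.sum-cong-≋ (λ j → factor-x (from-≉0 j)) ⟨
      ∏.sum (λ j → factor (from (Fin.punchIn i₀ j)))           ≈⟨ *-identityˡ _ ⟨
      1# * ∏.sum (λ j → factor (from (Fin.punchIn i₀ j)))      ≈⟨ *-congʳ (factor-0 (from∘to card 0#)) ⟨
      factor (from i₀) * ∏.sum (λ j → factor (from (Fin.punchIn i₀ j)))  ≈⟨ ∏.sum-remove {i = i₀} (factor ∘ from) ⟨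
      ∏.sum (factor ∘ from)
          ≈⟨ *-cancelˡ (product-≉0 (nonzero ∘ from) (λ i → nonzero-≉0 (from i))) cancelled ⟩
      1#                                                       ∎
      where
      cancelled : ∏.sum (nonzero ∘ from) * ∏.sum (factor ∘ from) ≈ ∏.sum (nonzero ∘ from) * 1#
      cancelled = begin
        ∏.sum (nonzero ∘ from) * ∏.sum (factor ∘ from)         ≈⟨ *-comm _ _ ⟩
        ∏.sum (factor ∘ from) * ∏.sum (nonzero ∘ from)         ≈⟨ ∏.∑-distrib-+ (factor ∘ from) (nonzero ∘ from) ⟨
        ∏.sum (λ i → factor (from i) * nonzero (from i))
            ≈⟨ ∏.sum-cong-≋ {suc n} (λ i → nonzero-scaled {from i} (from∘to card (x * from i))) ⟨
        ∏.sum (λ i → nonzero (from (to (x * from i))))         ≈⟨ ∏.sum-permute (nonzero ∘ from) scaling ⟨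
        ∏.sum (nonzero ∘ from)                                 ≈⟨ *-identityʳ _ ⟨
        ∏.sum (nonzero ∘ from) * 1#                            ∎

  -- q · 1 vanishes and equals (p · 1)ˢ, and a field has no nonzero nilpotent elements.
  p·1≈0 : ∀ p s → HasCardinality F (p ℕ.^ s) → p · 1# ≈ 0#
  p·1≈0 p s card = ^-≈0 s (trans (sym (power s)) (q·x≈0 card 1#))
    where
    power : ∀ s → (p ℕ.^ s) · 1# ≈ (p · 1#) ^ s
    power zero    = +-identityʳ 1#
    power (suc s) = trans (×1-homo-* p (p ℕ.^ s)) (*-congˡ (power s))

-- The Frobenius endomorphism and its fixed field

module Frobenius {c₁ ℓ₁ c₂ ℓ₂} {p} (s : ℕ) (pp : Prime p) (0<s : 0 < s)
  (F : Field c₁ ℓ₁) (card : HasCardinality F (p ℕ.^ s)) (K : Field c₂ ℓ₂) (ι : Field.Carrier F → Field.Carrier K)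
  (ι-hom : IsRingHomomorphism (Field.rawRing F) (Field.rawRing K) ι) where
  private
    module F = Field F
  open Field K hiding (zero)
  open FieldProperties K
  open Polynomial rawRing
  open PolynomialProperties K
  private
    module ι where
      open HomomorphismProperties F K ι ι-hom public
      open IsRingHomomorphism ι-hom public

  private
    p·1≈0 : p · 1# ≈ 0#
    p·1≈0 = begin
      p · 1#           ≈⟨ MonoidMultProperties.×-congʳ +-monoid p ι.1#-homo ⟨
      p · ι F.1#       ≈⟨ ι.homo-· p F.1# ⟨
      ι (p F.· F.1#)   ≈⟨ ι.⟦⟧-cong (FiniteField.p·1≈0 F p s card) ⟩
      ι F.0#           ≈⟨ ι.0#-homo ⟩
      0#               ∎
      where open SetoidReasoning setoid

  open Characteristic K pp p·1≈0 public
    using (n·1≉0; +-^pˢ)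

  q : ℕ
  q = p ℕ.^ s

  1<q : 1 < q
  1<q = ℕ.≤-trans (ℕ.nonTrivial⇒n>1 p {{prime⇒nonTrivial pp}})
    (ℕ.≤-trans (ℕ.≤-reflexive (≡.sym (ℕ.^-identityʳ p))) (ℕ.^-monoʳ-≤ p {{ℕ.nonTrivial⇒nonZero p {{prime⇒nonTrivial pp}}}} 0<s))

  φ : Carrier → Carrier
  φ x = x ^ q

  φ-hom : IsRingHomomorphism rawRing rawRing φ
  φ-hom = record
    { isSemiringHomomorphism = record
      { isNearSemiringHomomorphism = record
        { +-isMonoidHomomorphism = record
          { isMagmaHomomorphism = record
            { isRelHomomorphism = record { cong = ^-congˡ q }
            ; homo = +-^pˢ s
            }
          ; ε-homo = 0^q≈0
          }
        ; *-homo = λ x y → ^-distrib-* x y q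
        }
      ; 1#-homo = 1^ q
      }
    ; -‿homo = λ x → inverseʳ-unique (x ^ q) ((- x) ^ q) (trans (sym (+-^pˢ s x (- x))) (trans (^-congˡ q (-‿inverseʳ x)) 0^q≈0))
    }
    where
    open GroupProperties +-group using (inverseʳ-unique)
    0^ : ∀ n → 0 < n → 0# ^ n ≈ 0#
    0^ (suc n) _ = zeroˡ _
    0^q≈0 : 0# ^ q ≈ 0#
    0^q≈0 = 0^ q (ℕ.<⇒≤ 1<q)
    1^ : ∀ n → 1# ^ n ≈ 1#
    1^ zero    = refl
    1^ (suc n) = trans (*-identityˡ _) (1^ n)

  φ-ι : ∀ a → φ (ι a) ≈ ι a
  φ-ι a = trans (sym (ι.homo-^ a q)) (ι.⟦⟧-cong (FiniteField.x^q≈x F card a))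

  -- The elements of F are already q roots of X^q - X.
  φ-fixed : ∀ x → φ x ≈ x → ∃ λ a → ι a ≈ x
  φ-fixed x φx≈x with Fin.any? (λ i → ι (Inverse.from card i) ≟ x)
  ... | yes (i , ιa≈x) = Inverse.from card i , ιa≈x
  ... | no  x∉F        = contradiction (roots≤degree r r-distinct 1≉0 (Leading-- {q = X} X< (monomial-leading q)) roots) ℕ.1+n≰n
    where
    r : Fin (suc q) → Carrier
    r zero    = x
    r (suc i) = ι (Inverse.from card i)
    r-distinct : Distinct r
    r-distinct {zero}  {zero}  0≢0 eq = 0≢0 ≡.refl
    r-distinct {zero}  {suc j} _   eq = x∉F (j , sym eq)
    r-distinct {suc i} {zero}  _   eq = x∉F (i , eq)
    r-distinct {suc i} {suc j} i≢j eq = i≢j (≡.cong suc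
      (≡.trans (≡.sym (Inverse.strictlyInverseˡ card i)) (≡.trans (Inverse.to-cong card (ι.homo-injective eq))
          (Inverse.strictlyInverseˡ card j))))
    X< : DegreeBelow X q
    X< zero          q≤0 = contradiction q≤0 (ℕ.<⇒≱ (ℕ.<⇒≤ 1<q))
    X< (suc zero)    q≤1 = contradiction q≤1 (ℕ.<⇒≱ 1<q)
    X< (suc (suc i)) _   = refl
    root : ∀ y → φ y ≈ y → eval (monomial q -ₚ X) y ≈ 0#
    root y φy≈y = trans (eval-- (monomial q) X y) (x≈y⇒x-y≈0 (trans (eval-monomial q y) (trans φy≈y (sym eval-X))))
      where
      eval-X : eval X y ≈ y
      eval-X = trans (+-identityˡ _) (trans (*-congˡ (trans (+-congˡ (zeroʳ y)) (+-identityʳ 1#))) (*-identityʳ y))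
    roots : ∀ i → eval (monomial q -ₚ X) (r i) ≈ 0#
    roots zero    = root x φx≈x
    roots (suc i) = root _ (φ-ι _)

-- Depressed cubics: discriminant and Cardano's formula

module Cubic {c ℓ} (K : Field c ℓ)
  (2≉0 : ¬ Field._≈_ K (Field._·_ K 2 (Field.1# K)) (Field.0# K))
  (3≉0 : ¬ Field._≈_ K (Field._·_ K 3 (Field.1# K)) (Field.0# K)) where
  open Field K
  open FieldProperties K
  open IntegerSolver commutativeRing
  open SetoidReasoning setoid

  cubic : Carrier → Carrier → Carrier → Carrier
  cubic A B x = x ^ 3 + A * x + B

  discriminant : Carrier → Carrier → Carrier
  discriminant A B = - (4 · (A ^ 3)) - 27 · (B ^ 2)

  discriminant≈ : ∀ A B → discriminant A B ≈ - (4 · 1# * A ^ 3) - 27 · 1# * B ^ 2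
  discriminant≈ A B = +-cong (-‿cong (·-as-* 4 (A ^ 3))) (-‿cong (·-as-* 27 (B ^ 2)))

  discriminant-cong : ∀ {A A′ B B′} → A ≈ A′ → B ≈ B′ → discriminant A B ≈ discriminant A′ B′
  discriminant-cong {A} {A′} {B} {B′} A≈A′ B≈B′ = begin
    discriminant A B                            ≈⟨ discriminant≈ A B ⟩
    - (4 · 1# * A ^ 3) - 27 · 1# * B ^ 2        ≈⟨ +-cong (-‿cong (*-congˡ (^-congˡ 3 A≈A′))) (-‿cong (*-congˡ
        (^-congˡ 2 B≈B′))) ⟩
    - (4 · 1# * A′ ^ 3) - 27 · 1# * B′ ^ 2      ≈⟨ discriminant≈ A′ B′ ⟨
    discriminant A′ B′                          ∎

  27≉0 : 27 · 1# ≉ 0#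
  27≉0 27≈0 = ^-≉0 3 3≉0 (trans (solve 0 (con (+ 3) :^ 3 := con (+ 27)) refl) 27≈0)

  81≉0 : 81 · 1# ≉ 0#
  81≉0 81≈0 = *-≉0 3≉0 27≉0 (trans (solve 0 (con (+ 3) :* con (+ 27) := con (+ 81)) refl) 81≈0)

  x+y≈0⇒y≈-x : ∀ {x y} → x + y ≈ 0# → y ≈ - x
  x+y≈0⇒y≈-x {x} {y} eq = trans (solve 2 (λ x y → y := (x :+ y) :- x) refl x y) (trans (+-congʳ eq) (+-identityˡ _))

  -- x² + xy + y² + A is (g(x) - g(y)) / (x - y) for the cubic g.
  divided-difference : ∀ {A B x y} → x ≉ y → cubic A B x ≈ 0# → cubic A B y ≈ 0# → x * x + x * y + y * y + A ≈ 0#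
  divided-difference {A} {B} {x} {y} x≉y fx≈0 fy≈0 with *-zeroProduct (begin
      (x - y) * (x * x + x * y + y * y + A)  ≈⟨ solve 4 (λ A B x y → (x :- y) :* (x :* x :+ x :* y :+ y :* y :+ A) :=
                                                   (x :^ 3 :+ A :* x :+ B) :- (y :^ 3 :+ A :* y :+ B)) refl A B x y ⟩
      cubic A B x - cubic A B y              ≈⟨ x≈y⇒x-y≈0 (trans fx≈0 (sym fy≈0)) ⟩
      0#                                     ∎)
  ... | inj₁ x-y≈0 = contradiction (x-y≈0⇒x≈y x y x-y≈0) x≉y
  ... | inj₂ eq    = eq

  -- The divided differences at x, y and at y, z differ by (x - z)(x + y + z).
  root-sum : ∀ {A B x y z} → x ≉ y → y ≉ z → x ≉ z →
             cubic A B x ≈ 0# → cubic A B y ≈ 0# → cubic A B z ≈ 0# → z ≈ - x - y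
  root-sum {A} {B} {x} {y} {z} x≉y y≉z x≉z fx≈0 fy≈0 fz≈0 with *-zeroProduct (begin
      (x - z) * (x + y + z)     ≈⟨ solve 4 (λ A x y z → (x :- z) :* (x :+ y :+ z) :=
                                     (x :* x :+ x :* y :+ y :* y :+ A) :- (y :* y :+ y :* z :+ z :* z :+ A)) refl A x y z ⟩
      x * x + x * y + y * y + A - (y * y + y * z + z * z + A)
                                ≈⟨ x≈y⇒x-y≈0 (trans (divided-difference x≉y fx≈0 fy≈0) (sym (divided-difference y≉z fy≈0 fz≈0))) ⟩
      0#                        ∎)
  ... | inj₁ x-z≈0   = contradiction (x-y≈0⇒x≈y x z x-z≈0) x≉z
  ... | inj₂ x+y+z≈0 = trans (x+y≈0⇒y≈-x x+y+z≈0) (solve 2 (λ x y → :- (x :+ y) := :- x :- y) refl x y)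

  vandermonde : Carrier → Carrier → Carrier → Carrier
  vandermonde x y z = (x - y) * (y - z) * (z - x)

  -- Two distinct roots determine the coefficients, A = -(x² + xy + y²) and B = -(x³ + Ax), after
  -- which this is an identity in x and y alone.
  vandermonde² : ∀ {A B x y} → x ≉ y → cubic A B x ≈ 0# → cubic A B y ≈ 0# →
                 vandermonde x y (- x - y) * vandermonde x y (- x - y) ≈ discriminant A B
  vandermonde² {A} {B} {x} {y} x≉y fx≈0 fy≈0 = begin
    vandermonde x y (- x - y) * vandermonde x y (- x - y)
      ≈⟨ solve 2 (λ x y → let z = :- x :- y; v = (x :- y) :* (y :- z) :* (z :- x)
                              A = :- (x :* x :+ x :* y :+ y :* y) in
           v :* v := :- (con (+ 4) :* A :^ 3) :- con (+ 27) :* (:- (x :^ 3 :+ A :* x)) :^ 2) refl x y ⟩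
    - (4 · 1# * A′ ^ 3) - 27 · 1# * (- (x ^ 3 + A′ * x)) ^ 2
      ≈⟨ discriminant≈ A′ (- (x ^ 3 + A′ * x)) ⟨
    discriminant A′ (- (x ^ 3 + A′ * x))
      ≈⟨ discriminant-cong A≈A′ (trans B≈ (-‿cong (+-congˡ (*-congʳ A≈A′)))) ⟨
    discriminant A B ∎
    where
    A′ : Carrier
    A′ = - (x * x + x * y + y * y)
    A≈A′ : A ≈ A′
    A≈A′ = x+y≈0⇒y≈-x (divided-difference x≉y fx≈0 fy≈0)
    B≈ : B ≈ - (x ^ 3 + A * x)
    B≈ = x+y≈0⇒y≈-x fx≈0

  -- 3x² + A is the derivative at x, the product of the differences from x to the other two roots.
  -- Those have sum -x and product x² + A, so the square of their difference is -(3x² + 4A).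
  derivative² : ∀ {A B x} → cubic A B x ≈ 0# →
                discriminant A B ≈ - ((3 · 1# * (x * x) + A) ^ 2 * (3 · 1# * (x * x) + 4 · 1# * A))
  derivative² {A} {B} {x} fx≈0 = begin
    discriminant A B                              ≈⟨ discriminant-cong refl (x+y≈0⇒y≈-x fx≈0) ⟩
    discriminant A (- (x ^ 3 + A * x))            ≈⟨ discriminant≈ A (- (x ^ 3 + A * x)) ⟩
    - (4 · 1# * A ^ 3) - 27 · 1# * (- (x ^ 3 + A * x)) ^ 2
      ≈⟨ solve 2 (λ A x → :- (con (+ 4) :* A :^ 3) :- con (+ 27) :* (:- (x :^ 3 :+ A :* x)) :^ 2 :=
           :- ((con (+ 3) :* (x :* x) :+ A) :^ 2 :* (con (+ 3) :* (x :* x) :+ con (+ 4) :* A))) refl A x ⟩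
    - ((3 · 1# * (x * x) + A) ^ 2 * (3 · 1# * (x * x) + 4 · 1# * A)) ∎

  module Resolvent {√-3 A B μ : Carrier} (√-3²≈-3 : √-3 ^ 2 ≈ - (3 · 1#)) (disc≈ : discriminant A B ≈ 81 · (μ ^ 2)) where

    -- Since 81μ² is the discriminant, (μ√-3)² = B² + 4A³/27. So θ is the radicand -B/2 + √(B²/4 +
    -- A³/27) of Cardano's formula.
    θ : Carrier
    θ = (1# / (2 · 1#)) * (- B + μ * √-3)

    2θ≈ : 2 · 1# * θ ≈ - B + μ * √-3
    2θ≈ = begin
      2 · 1# * ((1# / (2 · 1#)) * (- B + μ * √-3))   ≈⟨ *-assoc _ _ _ ⟨
      2 · 1# * (1# / (2 · 1#)) * (- B + μ * √-3)     ≈⟨ *-congʳ (x*[y/x]≈y 1# 2≉0) ⟩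
      1# * (- B + μ * √-3)                           ≈⟨ *-identityˡ _ ⟩
      - B + μ * √-3                                  ∎

    discriminant≈81μ² : discriminant A B ≈ 81 · 1# * (μ * μ)
    discriminant≈81μ² = trans disc≈ (trans (·-as-* 81 (μ ^ 2)) (*-congˡ (*-congˡ (*-identityʳ μ))))

    √-3*√-3 : √-3 * √-3 ≈ - (3 · 1#)
    √-3*√-3 = trans (*-congˡ (sym (*-identityʳ √-3))) √-3²≈-3

    -- θ and θ′ are the cubes of the two Lagrange resolvents u and -A/3u.
    θ′ : Carrier
    θ′ = - B - θ

    -- 4θθ′ = B² - (2θ + B)², and 2θ + B = μ√-3. The equation is multiplied by 4 to avoid halves.
    27θθ′≈-A³ : 27 · 1# * (θ * θ′) ≈ - (A ^ 3)
    27θθ′≈-A³ = *-cancelˡ (*-≉0 2≉0 2≉0) (begin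
      2 · 1# * (2 · 1#) * (27 · 1# * (θ * θ′))
        ≈⟨ solve 2 (λ B t → con (+ 2) :* con (+ 2) :* (con (+ 27) :* (t :* (:- B :- t))) :=
             con (+ 27) :* (B :* B) :- con (+ 27) :* ((con (+ 2) :* t :+ B) :* (con (+ 2) :* t :+ B))) refl B θ ⟩
      27 · 1# * (B * B) - 27 · 1# * ((2 · 1# * θ + B) * (2 · 1# * θ + B))
        ≈⟨ +-congˡ (-‿cong (*-congˡ (*-cong μ√-3 μ√-3))) ⟩
      27 · 1# * (B * B) - 27 · 1# * (μ * √-3 * (μ * √-3))
        ≈⟨ solve 3 (λ B m s → con (+ 27) :* (B :* B) :- con (+ 27) :* (m :* s :* (m :* s)) :=
             con (+ 27) :* (B :* B) :- con (+ 27) :* (m :* m) :* (s :* s)) refl B μ √-3 ⟩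
      27 · 1# * (B * B) - 27 · 1# * (μ * μ) * (√-3 * √-3)
        ≈⟨ +-congˡ (-‿cong (*-congˡ √-3*√-3)) ⟩
      27 · 1# * (B * B) - 27 · 1# * (μ * μ) * - (3 · 1#)
        ≈⟨ solve 2 (λ B m → con (+ 27) :* (B :* B) :- con (+ 27) :* (m :* m) :* (:- con (+ 3)) :=
             con (+ 27) :* (B :* B) :+ con (+ 81) :* (m :* m)) refl B μ ⟩
      27 · 1# * (B * B) + 81 · 1# * (μ * μ)
        ≈⟨ +-congˡ (trans (sym discriminant≈81μ²) (discriminant≈ A B)) ⟩
      27 · 1# * (B * B) + (- (4 · 1# * A ^ 3) - 27 · 1# * B ^ 2)
        ≈⟨ solve 2 (λ A B → con (+ 27) :* (B :* B) :+ (:- (con (+ 4) :* A :^ 3) :- con (+ 27) :* B :^ 2) :=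
             con (+ 2) :* con (+ 2) :* (:- (A :^ 3))) refl A B ⟩
      2 · 1# * (2 · 1#) * - (A ^ 3) ∎)
      where
      μ√-3 : 2 · 1# * θ + B ≈ μ * √-3
      μ√-3 = trans (+-congʳ 2θ≈) (solve 2 (λ B v → :- B :+ v :+ B := v) refl B (μ * √-3))

    A≉0⇒θ≉0 : A ≉ 0# → θ ≉ 0#
    A≉0⇒θ≉0 A≉0 θ≈0 = -‿≉0 (^-≉0 3 A≉0)
      (trans (sym 27θθ′≈-A³) (trans (*-congˡ (trans (*-congʳ θ≈0) (zeroˡ θ′))) (zeroʳ _)))

    -- Put v = -A/3u. Then 3uv = -A, and v³ = θ′ because 27θθ′ = -A³; hence u³ + v³ = -B, and u + v
    -- is a root.
    cardano : ∀ {u} → θ ≉ 0# → u ^ 3 ≈ θ → u ≉ 0# × cubic A B (u + - A / (3 · 1# * u)) ≈ 0#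
    cardano {u} θ≉0 u³≈θ = u≉0 , (begin
      (u + u′) ^ 3 + A * (u + u′) + B
        ≈⟨ solve 4 (λ A B u v → (u :+ v) :^ 3 :+ A :* (u :+ v) :+ B :=
             (con (+ 3) :* u :* v :+ A) :* (u :+ v) :+ (u :^ 3 :+ v :^ 3 :+ B)) refl A B u u′ ⟩
      (3 · 1# * u * u′ + A) * (u + u′) + (u ^ 3 + u′ ^ 3 + B)
        ≈⟨ +-cong (*-congʳ (trans (+-congʳ 3uu′≈-A) (-‿inverseˡ A))) (+-congʳ (+-cong u³≈θ u′³≈θ′)) ⟩
      0# * (u + u′) + (θ + (- B - θ) + B)
        ≈⟨ solve 3 (λ v B t → con (+ 0) :* v :+ (t :+ (:- B :- t) :+ B) := con (+ 0)) refl (u + u′) B θ ⟩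
      0# ∎)
      where
      u≉0 : u ≉ 0#
      u≉0 u≈0 = θ≉0 (trans (sym u³≈θ) (trans (*-congʳ u≈0) (zeroˡ _)))
      u′ : Carrier
      u′ = - A / (3 · 1# * u)
      3uu′≈-A : 3 · 1# * u * u′ ≈ - A
      3uu′≈-A = x*[y/x]≈y (- A) (*-≉0 3≉0 u≉0)
      u′³≈θ′ : u′ ^ 3 ≈ θ′
      u′³≈θ′ = *-cancelˡ (*-≉0 27≉0 θ≉0) (begin
        27 · 1# * θ * u′ ^ 3         ≈⟨ *-congʳ (*-congˡ u³≈θ) ⟨
        27 · 1# * u ^ 3 * u′ ^ 3     ≈⟨ solve 2 (λ u v → con (+ 27) :* u :^ 3 :* v :^ 3 := (con (+ 3) :* u :* v) :^ 3) refl u u′ ⟩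
        (3 · 1# * u * u′) ^ 3        ≈⟨ ^-congˡ 3 3uu′≈-A ⟩
        (- A) ^ 3                    ≈⟨ solve 1 (λ A → (:- A) :^ 3 := :- (A :^ 3)) refl A ⟩
        - (A ^ 3)                    ≈⟨ 27θθ′≈-A³ ⟨
        27 · 1# * (θ * θ′)           ≈⟨ *-assoc _ _ _ ⟨
        27 · 1# * θ * θ′             ∎)

    -- Cardano's formula read backwards: a root x determines the resolvent u = (x + t)/2,
    -- where t = μ√-3/(x² + A/3) is the difference of the two resolvents.
    resolvent : Carrier → Carrier
    resolvent x = (x + 3 · 1# * (μ * √-3) / (3 · 1# * (x * x) + A)) / (2 · 1#)

    -- With w = 3x² + A, the derivative at x, two relations give the cube of (x + t)/2: wt = 3μ√-3
    -- by the choice of t, and 3t² = 3x² + 4A from `derivative²`. As μ is nonzero the roots are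
    -- simple, so w may be divided by.
    resolvent³ : ∀ {x} → μ ≉ 0# → cubic A B x ≈ 0# → 3 · 1# * (x * x) + A ≉ 0# × resolvent x ^ 3 ≈ θ
    resolvent³ {x} μ≉0 fx≈0 = w≉0 , *-cancelˡ (*-≉0 3≉0 (^-≉0 3 2≉0)) (begin
      3 · 1# * (2 · 1#) ^ 3 * u ^ 3
        ≈⟨ solve 1 (λ u → con (+ 3) :* con (+ 2) :^ 3 :* u :^ 3 := con (+ 3) :* (con (+ 2) :* u) :^ 3) refl u ⟩
      3 · 1# * (2 · 1# * u) ^ 3
        ≈⟨ *-congˡ (^-congˡ 3 (x*[y/x]≈y (x + t) 2≉0)) ⟩
      3 · 1# * (x + t) ^ 3
        ≈⟨ solve 2 (λ x t → con (+ 3) :* (x :+ t) :^ 3 :=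
             con (+ 3) :* x :^ 3 :+ con (+ 9) :* (x :* x) :* t :+ (con (+ 3) :* x :+ t) :* (con (+ 3) :* (t :* t))) refl x t ⟩
      3 · 1# * x ^ 3 + 9 · 1# * (x * x) * t + (3 · 1# * x + t) * (3 · 1# * (t * t))
        ≈⟨ +-congˡ (*-congˡ 3t²≈) ⟩
      3 · 1# * x ^ 3 + 9 · 1# * (x * x) * t + (3 · 1# * x + t) * (3 · 1# * (x * x) + 4 · 1# * A)
        ≈⟨ solve 3 (λ A x t → con (+ 3) :* x :^ 3 :+ con (+ 9) :* (x :* x) :* t :+ (con (+ 3) :* x :+ t) :* (con
            (+ 3) :* (x :* x) :+ con (+ 4) :* A) :=
             con (+ 12) :* (x :^ 3 :+ A :* x) :+ con (+ 4) :* ((con (+ 3) :* (x :* x) :+ A) :* t)) refl A x t ⟩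
      12 · 1# * (x ^ 3 + A * x) + 4 · 1# * (w * t)
        ≈⟨ +-cong (*-congˡ (x+y≈0⇒y≈-x (trans (+-comm _ _) fx≈0))) (*-congˡ wt≈) ⟩
      12 · 1# * - B + 4 · 1# * (3 · 1# * (μ * √-3))
        ≈⟨ solve 2 (λ B v → con (+ 12) :* (:- B) :+ con (+ 4) :* (con (+ 3) :* v) := con (+ 12) :* (:- B :+ v)) refl B (μ * √-3) ⟩
      12 · 1# * (- B + μ * √-3)
        ≈⟨ *-congˡ 2θ≈ ⟨
      12 · 1# * (2 · 1# * θ)
        ≈⟨ solve 1 (λ t → con (+ 12) :* (con (+ 2) :* t) := con (+ 3) :* con (+ 2) :^ 3 :* t) refl θ ⟩
      3 · 1# * (2 · 1#) ^ 3 * θ ∎)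
      where
      w t u : Carrier
      w = 3 · 1# * (x * x) + A
      t = 3 · 1# * (μ * √-3) / w
      u = resolvent x
      81μ²≈ : 81 · 1# * (μ * μ) ≈ - (w ^ 2 * (3 · 1# * (x * x) + 4 · 1# * A))
      81μ²≈ = trans (sym discriminant≈81μ²) (derivative² fx≈0)
      w≉0 : w ≉ 0#
      w≉0 w≈0 = *-≉0 81≉0 (*-≉0 μ≉0 μ≉0) (begin
        81 · 1# * (μ * μ)                                  ≈⟨ 81μ²≈ ⟩
        - (w ^ 2 * (3 · 1# * (x * x) + 4 · 1# * A))        ≈⟨ -‿cong (*-congʳ (*-congʳ w≈0)) ⟩
        - (0# * w ^ 1 * (3 · 1# * (x * x) + 4 · 1# * A))   ≈⟨ -‿cong (*-congʳ (zeroˡ _)) ⟩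
        - (0# * (3 · 1# * (x * x) + 4 · 1# * A))           ≈⟨ -‿cong (zeroˡ _) ⟩
        - 0#                                               ≈⟨ -0#≈0# ⟩
        0#                                                 ∎)
      wt≈ : w * t ≈ 3 · 1# * (μ * √-3)
      wt≈ = x*[y/x]≈y (3 · 1# * (μ * √-3)) w≉0
      3t²≈ : 3 · 1# * (t * t) ≈ 3 · 1# * (x * x) + 4 · 1# * A
      3t²≈ = *-cancelˡ (^-≉0 2 w≉0) (begin
        w ^ 2 * (3 · 1# * (t * t))
            ≈⟨ solve 2 (λ w t → w :^ 2 :* (con (+ 3) :* (t :* t)) := con (+ 3) :* (w :* t :* (w :* t))) refl w t ⟩
        3 · 1# * (w * t * (w * t))                         ≈⟨ *-congˡ (*-cong wt≈ wt≈) ⟩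
        3 · 1# * (3 · 1# * (μ * √-3) * (3 · 1# * (μ * √-3)))
          ≈⟨ solve 2 (λ m s → con (+ 3) :* (con (+ 3) :* (m :* s) :* (con (+ 3) :* (m :* s))) :=
              con (+ 27) :* (m :* m) :* (s :* s)) refl μ √-3 ⟩
        27 · 1# * (μ * μ) * (√-3 * √-3)                    ≈⟨ *-congˡ √-3*√-3 ⟩
        27 · 1# * (μ * μ) * - (3 · 1#)
            ≈⟨ solve 1 (λ m → con (+ 27) :* (m :* m) :* (:- con (+ 3)) := :- (con (+ 81) :* (m :* m))) refl μ ⟩
        - (81 · 1# * (μ * μ))                              ≈⟨ -‿cong 81μ²≈ ⟩
        - - (w ^ 2 * (3 · 1# * (x * x) + 4 · 1# * A))      ≈⟨ -‿involutive _ ⟩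
        w ^ 2 * (3 · 1# * (x * x) + 4 · 1# * A)            ∎)

  -- γ and -γ are the critical points of the cubic when A = -3γ².
  critical-values : ∀ {A B γ} → A ≈ - (3 · 1# * (γ * γ)) →
                    - (27 · 1#) * (cubic A B γ * cubic A B (- γ)) ≈ discriminant A B
  critical-values {A} {B} {γ} A≈ = begin
    - (27 · 1#) * (cubic A B γ * cubic A B (- γ))
      ≈⟨ *-congˡ (*-cong (+-congʳ (+-congˡ (*-congʳ A≈))) (+-congʳ (+-congˡ (*-congʳ A≈)))) ⟩
    - (27 · 1#) * (cubic (- (3 · 1# * (γ * γ))) B γ * cubic (- (3 · 1# * (γ * γ))) B (- γ))
      ≈⟨ solve 2 (λ B g → let A = :- (con (+ 3) :* (g :* g)) in
           (:- con (+ 27)) :* ((g :^ 3 :+ A :* g :+ B) :* ((:- g) :^ 3 :+ A :* (:- g) :+ B)) :=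
           :- (con (+ 4) :* A :^ 3) :- con (+ 27) :* B :^ 2) refl B γ ⟩
    - (4 · 1# * (- (3 · 1# * (γ * γ))) ^ 3) - 27 · 1# * B ^ 2
      ≈⟨ discriminant≈ (- (3 · 1# * (γ * γ))) B ⟨
    discriminant (- (3 · 1# * (γ * γ))) B
      ≈⟨ discriminant-cong A≈ refl ⟨
    discriminant A B ∎

-- The iterates of h, their degrees and their roots

3^n>0 : ∀ n → 0 < 3 ^ℕ n
3^n>0 n = ℕ.m^n>0 3 n

-- Needed because a product over 3ⁿ conjugates then keeps one factor -3 that does not pair off into
-- a square.
3^n-odd : ∀ n → ∃ λ j → 3 ^ℕ n ≡ suc (j ℕ.+ j)
3^n-odd zero = 0 , ≡.refl
3^n-odd (suc n) with 3^n-odd n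
... | j , eq = suc (j ℕ.+ j ℕ.+ j) , ≡.trans (≡.cong (3 ℕ.*_) eq)
    (solve 1 (λ j → con 3 :* (con 1 :+ (j :+ j)) := con 1 :+ (con 1 :+ (j :+ j :+ j) :+ (con 1 :+ (j :+ j :+ j)))) ≡.refl j)
  where open +-*-Solver

module CubicDynamics {a ℓ₁ b ℓ₂} {p} (s : ℕ) (pp : Prime p) (3<p : 3 < p) (0<s : 0 < s)
  (F : Field a ℓ₁) (card : HasCardinality F (p ^ℕ s))
  (K : Field b ℓ₂) (ι : Field.Carrier F → Field.Carrier K) (closure : IsAlgebraicClosure F K ι)
  (b₀ b₁ b₃ : Field.Carrier F) (b₃≉0 : ¬ Field._≈_ F b₃ (Field.0# F)) (β₀ : Field.Carrier F)
  where
  private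
    module F = Field F
    module F[X] = Polynomial F.rawRing
    module FP = PolynomialProperties F
    module closure = IsAlgebraicClosure closure
    ι-hom : IsRingHomomorphism F.rawRing (Field.rawRing K) ι
    ι-hom = IsRingMonomorphism.isRingHomomorphism closure.isRingMonomorphism
  open Field K hiding (zero)
  open FieldProperties K
  open Polynomial rawRing
  open PolynomialProperties K
  open IntegerSolver commutativeRing
  open SetoidReasoning setoid
  open SumProperties *-commutativeMonoid using (∑-distrib-+; sum-cong-≋; sum-replicate) renaming (sum to product)
  open Frobenius s pp 0<s F card K ι ι-hom
  open FixedField F K ι ι-hom φ φ-hom φ-ι φ-fixed
  private
    2≉0 : 2 · 1# ≉ 0#
    2≉0 = n·1≉0 2 (ℕ.<⇒≤ 3<p)
    3≉0 : 3 · 1# ≉ 0#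
    3≉0 = n·1≉0 3 3<p
  open Cubic K 2≉0 3≉0 public

  h : F[X].Poly
  h = b₀ ∷ b₁ ∷ F.0# ∷ b₃ ∷ []

  k₀ k₁ k₃ A : Carrier
  k₀ = ι b₀
  k₁ = ι b₁
  k₃ = ι b₃
  A  = k₁ / k₃

  B : Carrier → Carrier
  B x = (k₀ - x) / k₃

  k₃≉0 : k₃ ≉ 0#
  k₃≉0 = ι.homo-≉0 b₃≉0

  f : ℕ → F[X].Poly
  f n = h F[X].^∘ n F[X].-ₚ F[X].C β₀

  -- One step of the Horner form in which composition is defined: the constant x cannot reach the
  -- top term, as g has positive degree.
  Leading-horner : ∀ {g r d e c a} x → 0 < d → FP.Leading g d c → FP.Leading r e a →
                   FP.Leading (F[X].C x F[X].+ₚ g F[X].*ₚ r) (d ℕ.+ e) (c F.* a)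
  Leading-horner {g} {r} {d} {e} x 0<d Lg Lr = FP.Leading-+ {p = g F[X].*ₚ r} {q = F[X].C x} C< (FP.Leading-* Lg Lr)
    where
    C< : FP.DegreeBelow (F[X].C x) (d ℕ.+ e)
    C< i d+e≤i = FP.Leading.below (FP.Leading-C x) i (ℕ.≤-trans 0<d (ℕ.≤-trans (ℕ.m≤m+n d e) d+e≤i))

  h^-leading : ∀ n → ∃ λ c → c F.≉ F.0# × FP.Leading (h F[X].^∘ n) (3 ^ℕ n) c
  h^-leading zero    = F.1# , F.1≉0 , FP.leading F.refl λ { (suc (suc i)) _ → F.refl ; (suc zero) (s≤s ()) }
  h^-leading (suc n) with h^-leading n
  ... | c , c≉0 , Lg = _ , F*-≉0 c≉0 (F*-≉0 c≉0 (F*-≉0 c≉0 b₃≉0)) ,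
    Leading-horner b₀ 0<d Lg (Leading-horner b₁ 0<d Lg (Leading-horner F.0# 0<d Lg b₃-leading))
    where
    open FieldProperties F using () renaming (*-≉0 to F*-≉0)
    g : F[X].Poly
    g = h F[X].^∘ n
    0<d : 0 < 3 ^ℕ n
    0<d = 3^n>0 n
    -- Composition ends at the empty list, so the innermost Horner level is b₃ + g · 0 instead of
    -- b₃.
    b₃-leading : FP.Leading (F[X].C b₃ F[X].+ₚ g F[X].*ₚ []) 0 b₃
    b₃-leading = FP.Leading-≈ₚ
      (λ i → F.sym (F.trans (FP.coeff-+ (F[X].C b₃) (g F[X].*ₚ []) i) (F.trans (F.+-congˡ (FP.*ₚ-≈0ʳ g [] (λ _ →
          F.refl) i)) (F.+-identityʳ _))))
      (FP.Leading-C b₃)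

  lc : ℕ → F.Carrier
  lc n = proj₁ (h^-leading n)

  lc≉0 : ∀ n → lc n F.≉ F.0#
  lc≉0 n = proj₁ (proj₂ (h^-leading n))

  f-leading : ∀ n → FP.Leading (f n) (3 ^ℕ n) (lc n)
  f-leading n = FP.Leading-- {q = F[X].C β₀} (λ i 3ⁿ≤i → FP.Leading.below (FP.Leading-C β₀) i (ℕ.≤-trans (3^n>0 n) 3ⁿ≤i)) (proj₂ (proj₂ (h^-leading n)))

  eval-f : ∀ n x → eval⟨ f n ⟩ x ≈ eval⟨ h F[X].^∘ n ⟩ x - ι β₀
  eval-f n x = trans (eval⟨⟩-- (h F[X].^∘ n) (F[X].C β₀) x) (+-congˡ (-‿cong (eval⟨⟩-C β₀ x)))

  -- Iteration is defined with the new h on the outside, whereas passing from a root to its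
  -- preimages needs it on the inside.
  iterate-inner : ∀ n x → eval⟨ h F[X].^∘ suc n ⟩ x ≈ eval⟨ h F[X].^∘ n ⟩ (eval⟨ h ⟩ x)
  iterate-inner zero    x = begin
    eval⟨ h F[X].∘ₚ F[X].X ⟩ x      ≈⟨ eval⟨⟩-∘ h F[X].X x ⟩
    eval⟨ h ⟩ (eval⟨ F[X].X ⟩ x)    ≈⟨ eval-cong (map ι h) (eval⟨⟩-X x) ⟩
    eval⟨ h ⟩ x                     ≈⟨ eval⟨⟩-X (eval⟨ h ⟩ x) ⟨
    eval⟨ F[X].X ⟩ (eval⟨ h ⟩ x)    ∎
  iterate-inner (suc n) x = begin
    eval⟨ h F[X].∘ₚ h F[X].^∘ suc n ⟩ x            ≈⟨ eval⟨⟩-∘ h (h F[X].^∘ suc n) x ⟩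
    eval⟨ h ⟩ (eval⟨ h F[X].^∘ suc n ⟩ x)          ≈⟨ eval-cong (map ι h) (iterate-inner n x) ⟩
    eval⟨ h ⟩ (eval⟨ h F[X].^∘ n ⟩ (eval⟨ h ⟩ x))  ≈⟨ eval⟨⟩-∘ h (h F[X].^∘ n) (eval⟨ h ⟩ x) ⟨
    eval⟨ h F[X].^∘ suc n ⟩ (eval⟨ h ⟩ x)          ∎

  f-inner : ∀ n x → eval⟨ f (suc n) ⟩ x ≈ eval⟨ f n ⟩ (eval⟨ h ⟩ x)
  f-inner n x = trans (eval-f (suc n) x) (trans (+-congʳ (iterate-inner n x)) (sym (eval-f n (eval⟨ h ⟩ x))))

  -- Normalises h - y to a monic cubic without quadratic term; only its constant coefficient `B y`
  -- depends on y.
  h≈cubic : ∀ x y → eval⟨ h ⟩ x - y ≈ k₃ * cubic A (B y) x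
  h≈cubic x y = begin
    k₀ + x * (k₁ + x * (ι F.0# + x * (k₃ + x * 0#))) - y
      ≈⟨ +-congʳ (+-congˡ (*-congˡ (+-congˡ (*-congˡ (+-congʳ ι.0#-homo))))) ⟩
    k₀ + x * (k₁ + x * (0# + x * (k₃ + x * 0#))) - y
      ≈⟨ solve 5 (λ k₀ k₁ k₃ x y → k₀ :+ x :* (k₁ :+ x :* (con (+ 0) :+ x :* (k₃ :+ x :* con (+ 0)))) :- y :=
           k₃ :* x :^ 3 :+ k₁ :* x :+ (k₀ :- y)) refl k₀ k₁ k₃ x y ⟩
    k₃ * x ^ 3 + k₁ * x + (k₀ - y)
      ≈⟨ +-cong (+-congˡ (*-congʳ (x*[y/x]≈y k₁ k₃≉0))) (x*[y/x]≈y (k₀ - y) k₃≉0) ⟨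
    k₃ * x ^ 3 + k₃ * A * x + k₃ * B y
      ≈⟨ solve 4 (λ k A B x → k :* x :^ 3 :+ k :* A :* x :+ k :* B := k :* (x :^ 3 :+ A :* x :+ B)) refl k₃ A (B y) x ⟩
    k₃ * cubic A (B y) x ∎

  cubic-root⇒preimage : ∀ {x y} → cubic A (B y) x ≈ 0# → eval⟨ h ⟩ x ≈ y
  cubic-root⇒preimage {x} {y} eq = x-y≈0⇒x≈y _ _ (trans (h≈cubic x y) (trans (*-congˡ eq) (zeroʳ k₃)))

  preimage⇒cubic-root : ∀ {x y} → eval⟨ h ⟩ x ≈ y → cubic A (B y) x ≈ 0#
  preimage⇒cubic-root {x} {y} hx≈y = *-cancelˡ k₃≉0 (trans (sym (h≈cubic x y)) (trans (x≈y⇒x-y≈0 hx≈y) (sym (zeroʳ k₃))))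

  preimage-root : ∀ n {x y} → eval⟨ h ⟩ x ≈ y → eval⟨ f n ⟩ y ≈ 0# → eval⟨ f (suc n) ⟩ x ≈ 0#
  preimage-root n {x} hx≈y fy≈0 = trans (f-inner n x) (trans (eval-cong (map ι (f n)) hx≈y) fy≈0)

  preimage : ∀ y → ∃ λ x → eval⟨ h ⟩ x ≈ y
  -- `closed` asks for a nonzero coefficient of index `suc i`; i = 2 points at the coefficient of
  -- X³.
  preimage y with closure.closed (B y ∷ A ∷ 0# ∷ 1# ∷ []) (2 , 1≉0)
  ... | x , eq = x , cubic-root⇒preimage (begin
    x ^ 3 + A * x + B y                          ≈⟨ solve 4 (λ A B x o → x :* (x :* (x :* o)) :+ A :* x :+ B :=
        B :+ x :* (A :+ x :* (con (+ 0) :+ x :* o))) refl A (B y) x 1# ⟩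
    B y + x * (A + x * (0# + x * 1#))            ≈⟨ +-congˡ (*-congˡ (+-congˡ (*-congˡ (+-congˡ (*-congˡ (trans
        (+-congˡ (zeroʳ x)) (+-identityʳ 1#))))))) ⟨
    B y + x * (A + x * (0# + x * (1# + x * 0#))) ≈⟨ eq ⟩
    0#                                           ∎)

  square-root : ∀ y → ∃ λ x → x * x ≈ y
  square-root y with closure.closed (- y ∷ 0# ∷ 1# ∷ []) (1 , 1≉0)
  ... | x , eq = x , x-y≈0⇒x≈y _ _ (begin
    x * x - y                          ≈⟨ solve 2 (λ x y → x :* x :- y := :- y :+ x :* (con (+ 0) :+ x)) refl x y ⟩
    - y + x * (0# + x)                 ≈⟨ +-congˡ (*-congˡ (+-congˡ (trans (*-congˡ (trans (+-congˡ (zeroʳ x))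
        (+-identityʳ 1#))) (*-identityʳ x)))) ⟨
    - y + x * (0# + x * (1# + x * 0#)) ≈⟨ eq ⟩
    0#                                 ∎)

  A∈F : ∀ {xs} → Adjoin F K ι xs A
  A∈F = mul (base b₁) (inv k₃≉0 (base b₃))

  φ^-B : ∀ n x → φ^ n (B x) ≈ B (φ^ n x)
  φ^-B n x = begin
    φ^ n ((k₀ - x) * k₃ ⁻¹)           ≈⟨ φ^.*-homo n _ _ ⟩
    φ^ n (k₀ - x) * φ^ n (k₃ ⁻¹)      ≈⟨ *-cong (φ^.homo-- n k₀ x) (φ^.homo-⁻¹ n k₃≉0) ⟩
    (φ^ n k₀ - φ^ n x) * φ^ n k₃ ⁻¹   ≈⟨ *-cong (+-congʳ (φ^-ι n b₀)) (⁻¹-cong (φ^-ι n b₃)) ⟩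
    (k₀ - φ^ n x) * k₃ ⁻¹             ∎

  φ^-discriminant : ∀ n x → φ^ n (discriminant A (B x)) ≈ discriminant A (B (φ^ n x))
  φ^-discriminant n x = begin
    φ^ n (- (4 · (A ^ 3)) - 27 · (B x ^ 2))          ≈⟨ φ^.homo-- n _ _ ⟩
    φ^ n (- (4 · (A ^ 3))) - φ^ n (27 · (B x ^ 2))   ≈⟨ +-cong (trans (φ^.-‿homo n _) (-‿cong (trans (φ^.homo-· n 4 _)
        (×-congʳ 4 (φ^.homo-^ n A 3)))))
                                                         (-‿cong (trans (φ^.homo-· n 27 _) (×-congʳ 27 (φ^.homo-^ n (B x) 2)))) ⟩
    discriminant (φ^ n A) (φ^ n (B x))               ≈⟨ discriminant-cong (Adjoin-fixed n [] A∈F) (φ^-B n x) ⟩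
    discriminant A (B (φ^ n x))                      ∎
    where open MonoidMultProperties +-monoid using (×-congʳ)

  -- Critical points, the norm of the root of the discriminant, and condition (1)

  module CriticalPoints (γ₁ γ₂ : Carrier) (critical : RootsWithMultiplicity (map ι (F[X].derivative h)) (γ₁ ∷ γ₂ ∷ [])) where
    private
      c : Carrier
      c = proj₁ critical
      c≉0 : c ≉ 0#
      c≉0 = proj₁ (proj₂ critical)
      coefficients : map ι (F[X].derivative h) ≈ₚ (X -ₚ C γ₁) *ₚ ((X -ₚ C γ₂) *ₚ C c)
      coefficients = proj₂ (proj₂ critical)

      -- This and the next two facts compare h′ = 3b₃X² + b₁ with c (X - γ₁)(X - γ₂) in degrees 0, 1
      -- and 2.
      k₁≈cγ₁γ₂ : k₁ ≈ c * (γ₁ * γ₂)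
      k₁≈cγ₁γ₂ = trans (ι.⟦⟧-cong (F.sym (F.+-identityʳ b₁))) (trans (coefficients 0)
        (solve 3 (λ c g₁ g₂ → (con (+ 0) :- g₁) :* ((con (+ 0) :- g₂) :* c :+ con (+ 0)) :+ con (+ 0) :=
            c :* (g₁ :* g₂)) refl c γ₁ γ₂))

      γ₁+γ₂≈0 : γ₁ + γ₂ ≈ 0#
      γ₁+γ₂≈0 = *-cancelˡ (-‿≉0 c≉0) (begin
        - c * (γ₁ + γ₂)
          ≈⟨ solve 3 (λ c g₁ g₂ → (:- c) :* (g₁ :+ g₂) := (con (+ 0) :- g₁) :* (c :+ con (+ 0)) :+ (((con
              (+ 0) :- g₂) :* c :+ con (+ 0)) :+ con (+ 0))) refl c γ₁ γ₂ ⟩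
        (0# - γ₁) * (c + 0#) + (((0# - γ₂) * c + 0#) + 0#)
          ≈⟨ +-cong (*-congˡ (+-congʳ (*-identityˡ c))) (+-congʳ (*-identityˡ _)) ⟨
        (0# - γ₁) * (1# * c + 0#) + (1# * ((0# - γ₂) * c + 0#) + 0#)
          ≈⟨ coefficients 1 ⟨
        ι (F.0# F.+ (F.0# F.+ F.0#))
          ≈⟨ ι.⟦⟧-cong (F.trans (F.+-identityˡ _) (F.+-identityˡ _)) ⟩
        ι F.0#
          ≈⟨ trans ι.0#-homo (sym (zeroʳ _)) ⟩
        - c * 0# ∎)

      c≈3k₃ : c ≈ 3 · k₃
      c≈3k₃ = begin
        c                                          ≈⟨ trans (*-identityˡ _) (trans (+-identityʳ _) (*-identityˡ c)) ⟨
        1# * (1# * c + 0#)                         ≈⟨ coefficients 2 ⟨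
        ι (3 F.· b₃)                               ≈⟨ ι.homo-· 3 b₃ ⟩
        3 · k₃                                     ∎

      γ₂≈-γ₁ : γ₂ ≈ - γ₁
      γ₂≈-γ₁ = x+y≈0⇒y≈-x γ₁+γ₂≈0

      A≈-3γ₁² : A ≈ - (3 · 1# * (γ₁ * γ₁))
      A≈-3γ₁² = sym (/-unique k₃≉0 (begin
        k₃ * - (3 · 1# * (γ₁ * γ₁))   ≈⟨ solve 2 (λ k g → k :* (:- (con (+ 3) :* (g :* g))) :=
            con (+ 3) :* k :* (g :* (:- g))) refl k₃ γ₁ ⟩
        3 · 1# * k₃ * (γ₁ * - γ₁)     ≈⟨ *-congʳ (·-as-* 3 k₃) ⟨
        3 · k₃ * (γ₁ * - γ₁)          ≈⟨ *-cong c≈3k₃ (*-congˡ γ₂≈-γ₁) ⟨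
        c * (γ₁ * γ₂)                 ≈⟨ k₁≈cγ₁γ₂ ⟨
        k₁                            ∎))

    -- κ is -27/k₃²: the -27 comes from `critical-values`, and each of the two values of h - y is k₃
    -- times a value of the monic cubic. Written as -3 times a square it exposes the -3 of δ.
    τ κ : Carrier
    τ = 3 · 1# / k₃
    κ = - (3 · 1#) * (τ * τ)

    discriminant≈critical : ∀ y → discriminant A (B y) ≈ κ * ((eval⟨ h ⟩ γ₁ - y) * (eval⟨ h ⟩ γ₂ - y))
    discriminant≈critical y = sym (begin
      κ * ((eval⟨ h ⟩ γ₁ - y) * (eval⟨ h ⟩ γ₂ - y))
        ≈⟨ *-congˡ (*-cong (h≈cubic γ₁ y) (trans (+-congʳ (eval-cong (map ι h) γ₂≈-γ₁)) (h≈cubic (- γ₁) y))) ⟩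
      κ * ((k₃ * u) * (k₃ * v))
        ≈⟨ solve 4 (λ t k u v → (:- con (+ 3)) :* (t :* t) :* ((k :* u) :* (k :* v)) :=
             (:- con (+ 3)) :* (k :* t) :* (k :* t) :* (u :* v)) refl τ k₃ u v ⟩
      - (3 · 1#) * (k₃ * τ) * (k₃ * τ) * (u * v)
        ≈⟨ *-congʳ (*-cong (*-congˡ k₃τ≈3) k₃τ≈3) ⟩
      - (3 · 1#) * (3 · 1#) * (3 · 1#) * (u * v)
        ≈⟨ solve 2 (λ u v → (:- con (+ 3)) :* con (+ 3) :* con (+ 3) :* (u :* v) := (:- con (+ 27)) :* (u :* v)) refl u v ⟩
      - (27 · 1#) * (u * v)
        ≈⟨ critical-values {A} {B y} {γ₁} A≈-3γ₁² ⟩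
      discriminant A (B y) ∎)
      where
      u v : Carrier
      u = cubic A (B y) γ₁
      v = cubic A (B y) (- γ₁)
      k₃τ≈3 : k₃ * τ ≈ 3 · 1#
      k₃τ≈3 = x*[y/x]≈y (3 · 1#) k₃≉0

    v₁ v₂ δ : ℕ → Carrier
    v₁ n = eval⟨ h F[X].^∘ suc n ⟩ γ₁ - ι β₀
    v₂ n = eval⟨ h F[X].^∘ suc n ⟩ γ₂ - ι β₀
    δ n = - (3 · 1#) * v₁ n * v₂ n

    -- If ρ is a square root of the discriminant of h - β over F(β), the product of its
    -- conjugates is, up to the factor e ∈ F, a square root of δ n.
    module Norm (n : ℕ) {β ρ : Carrier} (β-root : eval⟨ f n ⟩ β ≈ 0#) (free : FreeBelow β (3 ^ℕ n))
                (ρ²≈disc : ρ * ρ ≈ discriminant A (B β)) where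
      N : ℕ
      N = 3 ^ℕ n

      ψ : Carrier → Carrier
      ψ = φ^ N

      private
        j : ℕ
        j = proj₁ (3^n-odd n)

        -- As N = 2j + 1, κᴺ = -3e². In m² the leading coefficient of `f n` occurs twice, once for
        -- each product over the conjugates of β; this completes the two products to `v₁ n` and
        -- `v₂ n`.
        e m : Carrier
        e = κ ^ j * τ
        m = norm N ρ * ι (lc n)

        τ∈F : Adjoin F K ι [] τ
        τ∈F = mul (Adjoin-numeral 3) (inv k₃≉0 (base b₃))

        e∈F : Adjoin F K ι [] e
        e∈F = mul (Adjoin-^ j (mul (neg (Adjoin-numeral 3)) (mul τ∈F τ∈F))) τ∈F

        τ≉0 : τ ≉ 0#
        τ≉0 = *-≉0 3≉0 (⁻¹-≉0 k₃≉0)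

        e≉0 : e ≉ 0#
        e≉0 = *-≉0 (^-≉0 j (*-≉0 (-‿≉0 3≉0) (*-≉0 τ≉0 τ≉0))) τ≉0

        value : ∀ {γ} → eval⟨ h F[X].^∘ suc n ⟩ γ - ι β₀ ≈ ι (lc n) * product (λ i → eval⟨ h ⟩ γ - conjugates N β i)
        value {γ} = begin
          eval⟨ h F[X].^∘ suc n ⟩ γ - ι β₀   ≈⟨ eval-f (suc n) γ ⟨
          eval⟨ f (suc n) ⟩ γ                ≈⟨ f-inner n γ ⟩
          eval⟨ f n ⟩ (eval⟨ h ⟩ γ)          ≈⟨ factorisation (conjugates N β) (conjugates-distinct free) (map-leading
              (f-leading n)) (conjugates-roots (f n) N β-root) (eval⟨ h ⟩ γ) ⟩
          ι (lc n) * product (λ i → eval⟨ h ⟩ γ - conjugates N β i) ∎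

        κ^N≈ : κ ^ N ≈ κ * (κ ^ j * κ ^ j)
        κ^N≈ = trans (reflexive (≡.cong (κ ^_) (proj₂ (3^n-odd n)))) (*-congˡ (^-homo-* κ j j))

      norm² : norm N ρ * norm N ρ ≈ κ ^ N * (product (λ i → eval⟨ h ⟩ γ₁ - conjugates N β i) * product (λ i →
          eval⟨ h ⟩ γ₂ - conjugates N β i))
      norm² = begin
        norm N ρ * norm N ρ                                              ≈⟨ ∑-distrib-+ (conjugates N ρ) (conjugates N ρ) ⟨
        product (λ i → conjugates N ρ i * conjugates N ρ i)              ≈⟨ sum-cong-≋ conjugate-square ⟩
        product (λ i → κ * (u i * v i))                                  ≈⟨ ∑-distrib-+ (λ _ → κ) (λ i → u i * v i) ⟩
        product {N} (λ _ → κ) * product (λ i → u i * v i)                ≈⟨ *-cong (sum-replicate N) (∑-distrib-+ u v) ⟩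
        κ ^ N * (product u * product v)                                  ∎
        where
        u v : Fin N → Carrier
        u i = eval⟨ h ⟩ γ₁ - conjugates N β i
        v i = eval⟨ h ⟩ γ₂ - conjugates N β i
        conjugate-square : ∀ i → conjugates N ρ i * conjugates N ρ i ≈ κ * (u i * v i)
        conjugate-square i = begin
          conjugates N ρ i * conjugates N ρ i          ≈⟨ φ^.*-homo (Fin.toℕ i) ρ ρ ⟨
          φ^ (Fin.toℕ i) (ρ * ρ)                       ≈⟨ φ^.⟦⟧-cong (Fin.toℕ i) ρ²≈disc ⟩
          φ^ (Fin.toℕ i) (discriminant A (B β))        ≈⟨ φ^-discriminant (Fin.toℕ i) β ⟩
          discriminant A (B (conjugates N β i))        ≈⟨ discriminant≈critical (conjugates N β i) ⟩
          κ * (u i * v i)                              ∎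

      m²≈e²δ : m * m ≈ e * e * δ n
      m²≈e²δ = begin
        norm N ρ * l * (norm N ρ * l)               ≈⟨ solve 2 (λ M l → M :* l :* (M :* l) :=
            M :* M :* (l :* l)) refl (norm N ρ) l ⟩
        norm N ρ * norm N ρ * (l * l)               ≈⟨ *-congʳ (trans norm² (*-congʳ κ^N≈)) ⟩
        κ * (κ ^ j * κ ^ j) * (P₁ * P₂) * (l * l)   ≈⟨ solve 5 (λ t k l p q →
            (:- con (+ 3)) :* (t :* t) :* (k :* k) :* (p :* q) :* (l :* l) :=
                                                         k :* t :* (k :* t) :* ((:- con (+ 3)) :* (l :* p) :*
                                                             (l :* q))) refl τ (κ ^ j) l P₁ P₂ ⟩
        e * e * (- (3 · 1#) * (l * P₁) * (l * P₂))  ≈⟨ *-congˡ (*-cong (*-congˡ (value {γ₁})) (value {γ₂})) ⟨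
        e * e * δ n                                 ∎
        where
        l P₁ P₂ : Carrier
        l = ι (lc n)
        P₁ = product (λ i → eval⟨ h ⟩ γ₁ - conjugates N β i)
        P₂ = product (λ i → eval⟨ h ⟩ γ₂ - conjugates N β i)

      private
        e*e≉0 : e * e ≉ 0#
        e*e≉0 = *-≉0 e≉0 e≉0

        m-fixed⇒norm-fixed : φ m ≈ m → φ (norm N ρ) ≈ norm N ρ
        m-fixed⇒norm-fixed φm≈m = *-cancelˡ (ι.homo-≉0 (lc≉0 n)) (begin
          ι (lc n) * φ (norm N ρ)        ≈⟨ *-comm _ _ ⟩
          φ (norm N ρ) * ι (lc n)        ≈⟨ *-congˡ (φ-ι (lc n)) ⟨
          φ (norm N ρ) * φ (ι (lc n))    ≈⟨ φ^.*-homo 1 (norm N ρ) (ι (lc n)) ⟨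
          φ m                            ≈⟨ φm≈m ⟩
          m                              ≈⟨ *-comm _ _ ⟩
          ι (lc n) * norm N ρ            ∎)

      -- m² = (ed)² puts m = ± ed into F, so φ fixes the norm of ρ. The norm is nonzero because δ
      -- is, and `norm-φ` carries the invariance over to ρ.
      square⇒fixed : δ n ≉ 0# × (∃ λ d → ι d ^ 2 ≈ δ n) → ρ ≉ 0# × ψ ρ ≈ ρ
      square⇒fixed (δ≉0 , d , d²≈δ) = ρ≉0 , *-cancelˡ norm≉0 (begin
        norm N ρ * ψ ρ         ≈⟨ norm-φ N ρ ⟨
        φ (norm N ρ) * ρ       ≈⟨ *-congʳ (m-fixed⇒norm-fixed m-fixed) ⟩
        norm N ρ * ρ           ∎)
        where
        m≉0 : m ≉ 0#
        m≉0 m≈0 = *-≉0 e*e≉0 δ≉0 (trans (sym m²≈e²δ) (trans (*-congʳ m≈0) (zeroˡ m)))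
        norm≉0 : norm N ρ ≉ 0#
        norm≉0 = *-≉0ˡ m≉0
        ρ≉0 : ρ ≉ 0#
        ρ≉0 ρ≈0 = *-≉0 (*-≉0 e≉0 e≉0) δ≉0 (trans (sym m²≈e²δ) (trans (*-congʳ (*-congʳ (norm≈0 N (3^n>0 n)))) (trans
            (*-congʳ (zeroˡ _)) (zeroˡ _))))
          where
          norm≈0 : ∀ k → 0 < k → norm k ρ ≈ 0#
          norm≈0 (suc k) _ = trans (*-congʳ ρ≈0) (zeroˡ _)
        ed∈F : Adjoin F K ι [] (e * ι d)
        ed∈F = mul e∈F (base d)
        m²≈[ed]² : m * m ≈ e * ι d * (e * ι d)
        m²≈[ed]² = begin
          m * m                        ≈⟨ m²≈e²δ ⟩
          e * e * δ n                  ≈⟨ *-congˡ d²≈δ ⟨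
          e * e * ι d ^ 2              ≈⟨ *-congˡ (*-congˡ (*-identityʳ (ι d))) ⟩
          e * e * (ι d * ι d)          ≈⟨ solve 2 (λ e d → e :* e :* (d :* d) := e :* d :* (e :* d)) refl e (ι d) ⟩
          e * ι d * (e * ι d)          ∎
        m-fixed : φ m ≈ m
        m-fixed = Sum.[ (λ m≈ed → Adjoin-fixed 1 [] (resp (sym m≈ed) ed∈F))
                      , (λ m≈-ed → Adjoin-fixed 1 [] (resp (sym m≈-ed) (neg ed∈F))) ]′ (square-unique m²≈[ed]²)

      -- By `norm-φ` the norm of ρ lies in F, hence so does m/e, a square root of δ.
      fixed⇒square : ρ ≉ 0# → ψ ρ ≈ ρ → δ n ≉ 0# × (∃ λ d → ι d ^ 2 ≈ δ n)
      fixed⇒square ρ≉0 ψρ≈ρ = δ≉0 , d , *-cancelˡ e*e≉0 (begin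
        e * e * ι d ^ 2               ≈⟨ *-congˡ (*-congˡ (*-identityʳ (ι d))) ⟩
        e * e * (ι d * ι d)           ≈⟨ solve 2 (λ e d → e :* e :* (d :* d) := e :* d :* (e :* d)) refl e (ι d) ⟩
        e * ι d * (e * ι d)           ≈⟨ *-cong ed≈m ed≈m ⟩
        m * m                         ≈⟨ m²≈e²δ ⟩
        e * e * δ n                   ∎)
        where
        norm≉0 : norm N ρ ≉ 0#
        norm≉0 = product-≉0 (conjugates N ρ) (λ i → φ^.homo-≉0 (Fin.toℕ i) ρ≉0)
        m≉0 : m ≉ 0#
        m≉0 = *-≉0 norm≉0 (ι.homo-≉0 (lc≉0 n))
        δ≉0 : δ n ≉ 0#
        δ≉0 δ≈0 = *-≉0 m≉0 m≉0 (trans m²≈e²δ (trans (*-congˡ δ≈0) (zeroʳ _)))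
        norm-fixed : φ (norm N ρ) ≈ norm N ρ
        norm-fixed = *-cancelˡ ρ≉0 (begin
          ρ * φ (norm N ρ)      ≈⟨ *-comm _ _ ⟩
          φ (norm N ρ) * ρ      ≈⟨ norm-φ N ρ ⟩
          norm N ρ * ψ ρ        ≈⟨ *-congˡ ψρ≈ρ ⟩
          norm N ρ * ρ          ≈⟨ *-comm _ _ ⟩
          ρ * norm N ρ          ∎)
        norm∈F : ∃ λ d → ι d ≈ norm N ρ
        norm∈F = φ-fixed (norm N ρ) norm-fixed
        m/e∈F : Adjoin F K ι [] (m / e)
        m/e∈F = mul (mul (resp (proj₂ norm∈F) (base (proj₁ norm∈F))) (base (lc n))) (inv e≉0 e∈F)
        root∈F : ∃ λ d → ι d ≈ m / e
        root∈F = φ-fixed (m / e) (Adjoin-fixed 1 [] m/e∈F)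
        d : F.Carrier
        d = proj₁ root∈F
        ed≈m : e * ι d ≈ m
        ed≈m = trans (*-congˡ (proj₂ root∈F)) (x*[y/x]≈y m e≉0)

  -- The action of ψ on the three preimages of a root

  vandermonde-cong : ∀ {x x′ y y′ z z′} → x ≈ x′ → y ≈ y′ → z ≈ z′ → vandermonde x y z ≈ vandermonde x′ y′ z′
  vandermonde-cong x≈x′ y≈y′ z≈z′ =
    *-cong (*-cong (+-cong x≈x′ (-‿cong y≈y′)) (+-cong y≈y′ (-‿cong z≈z′))) (+-cong z≈z′ (-‿cong x≈x′))

  φ^-vandermonde : ∀ k x y z → φ^ k (vandermonde x y z) ≈ vandermonde (φ^ k x) (φ^ k y) (φ^ k z)
  φ^-vandermonde k x y z = trans (φ^.*-homo k _ _)
    (*-cong (trans (φ^.*-homo k _ _) (*-cong (φ^.homo-- k x y) (φ^.homo-- k y z))) (φ^.homo-- k z x))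

  φ^-third-root : ∀ k x y → φ^ k (- x - y) ≈ - φ^ k x - φ^ k y
  φ^-third-root k x y = trans (φ^.homo-- k (- x) y) (+-congʳ (φ^.-‿homo k x))

  -- The remainder of k modulo N is again a period of x, so it cannot be positive.
  φ^-∣ : ∀ {x N k} → .{{_ : ℕ.NonZero N}} → FreeBelow x N → φ^ N x ≈ x → φ^ k x ≈ x → N ∣ k
  φ^-∣ {x} {N} {k} free x-fixed φᵏx≈x = remainder (k % N) (k ℕ./ N) (m≡m%n+[m/n]*n k N) (m%n<n k N)
    where
    remainder : ∀ r m → k ≡ r ℕ.+ m ℕ.* N → r < N → N ∣ k
    remainder zero      m eq _   = divides m eq
    remainder r@(suc _) m eq r<N = contradiction (begin
      φ^ r x                    ≈⟨ φ^.⟦⟧-cong r (φ^-fixed-* m x-fixed) ⟨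
      φ^ r (φ^ (m ℕ.* N) x)     ≡⟨ φ^-comm r (m ℕ.* N) x ⟩
      φ^ (m ℕ.* N) (φ^ r x)     ≡⟨ φ^-+ r (m ℕ.* N) x ⟨
      φ^ (r ℕ.+ m ℕ.* N) x      ≡⟨ ≡.cong (λ k → φ^ k x) eq ⟨
      φ^ k x                    ≈⟨ φᵏx≈x ⟩
      x                         ∎) (free r (s≤s z≤n) r<N)

  module Preimages (n : ℕ) {y : Carrier} (y-root : eval⟨ f n ⟩ y ≈ 0#) (y-free : FreeBelow y (3 ^ℕ n)) where
    N : ℕ
    N = 3 ^ℕ n

    private
      instance
        N≢0 : ℕ.NonZero N
        N≢0 = ℕ.>-nonZero (3^n>0 n)

      N<3N : N < 3 ^ℕ suc n
      N<3N = ℕ.m<m+n N (ℕ.≤-trans (3^n>0 n) (ℕ.m≤m+n N (N ℕ.+ 0)))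

    2N<3N : N ℕ.+ N < 3 ^ℕ suc n
    2N<3N = ℕ.+-monoʳ-< N (≡.subst (N <_) (≡.cong (N ℕ.+_) (≡.sym (ℕ.+-identityʳ N))) (ℕ.m<m+n N (3^n>0 n)))

    0<N+N : 0 < N ℕ.+ N
    0<N+N = ℕ.≤-trans (3^n>0 n) (ℕ.m≤m+n N N)

    ψ : Carrier → Carrier
    ψ = φ^ N

    y-fixed : ψ y ≈ y
    y-fixed = FreeBelow⇒fixed (f-leading n) (lc≉0 n) y-root y-free

    ψ-preimage : ∀ {x} → eval⟨ h ⟩ x ≈ y → eval⟨ h ⟩ (ψ x) ≈ y
    ψ-preimage {x} hx≈y = trans (sym (φ^-eval N h x)) (trans (φ^.⟦⟧-cong N hx≈y) y-fixed)

    module _ {x} (hx≈y : eval⟨ h ⟩ x ≈ y) where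
      private
        x-root : cubic A (B y) x ≈ 0#
        x-root = preimage⇒cubic-root hx≈y
        ψx-root : cubic A (B y) (ψ x) ≈ 0#
        ψx-root = preimage⇒cubic-root (ψ-preimage hx≈y)
        ψψx-root : cubic A (B y) (ψ (ψ x)) ≈ 0#
        ψψx-root = preimage⇒cubic-root (ψ-preimage (ψ-preimage hx≈y))
        -- The third preimage is written -x - ψx because ψ(ψx) would be x again if ψ acted as a
        -- transposition, a case that has yet to be excluded.
        ρ : Carrier
        ρ = vandermonde x (ψ x) (- x - ψ x)

      -- ψ permutes the three preimages of y cyclically, so it fixes their Vandermonde product.
      free⇒discriminant-square : FreeBelow x (3 ^ℕ suc n) →
        ∃ λ ρ → ρ * ρ ≈ discriminant A (B y) × ρ ≉ 0# × ψ ρ ≈ ρ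
      free⇒discriminant-square free = ρ , vandermonde² x≉ψx x-root ψx-root , ρ≉0 , (begin
        ψ ρ                                            ≈⟨ φ^-vandermonde N x (ψ x) (- x - ψ x) ⟩
        vandermonde (ψ x) (ψ (ψ x)) (ψ (- x - ψ x))    ≈⟨ vandermonde-cong refl ψψx≈z ψz≈x ⟩
        vandermonde (ψ x) z x                          ≈⟨ solve 3 (λ x y z → (y :- z) :* (z :- x) :* (x :- y) :=
            (x :- y) :* (y :- z) :* (z :- x)) refl x (ψ x) z ⟩
        ρ                                              ∎)
        where
        z : Carrier
        z = - x - ψ x
        x≉ψx : x ≉ ψ x
        x≉ψx x≈ψx = free N (3^n>0 n) N<3N (sym x≈ψx)
        x≉ψψx : x ≉ ψ (ψ x)
        x≉ψψx x≈ψψx = free (N ℕ.+ N) 0<N+N 2N<3N (trans (reflexive (φ^-+ N N x)) (sym x≈ψψx))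
        ψx≉ψψx : ψ x ≉ ψ (ψ x)
        ψx≉ψψx eq = x≉ψx (φ^.homo-injective N eq)
        ψψx≈z : ψ (ψ x) ≈ z
        ψψx≈z = root-sum x≉ψx ψx≉ψψx x≉ψψx x-root ψx-root ψψx-root
        ψz≈x : ψ z ≈ x
        ψz≈x = begin
          ψ (- x - ψ x)              ≈⟨ φ^-third-root N x (ψ x) ⟩
          - ψ x - ψ (ψ x)            ≈⟨ +-congˡ (-‿cong ψψx≈z) ⟩
          - ψ x - (- x - ψ x)        ≈⟨ solve 2 (λ x y → :- y :- (:- x :- y) := x) refl x (ψ x) ⟩
          x                          ∎
        ρ≉0 : ρ ≉ 0#
        ρ≉0 = *-≉0 (*-≉0 (x-y≉0 x≉ψx) (x-y≉0 (λ ψx≈z → ψx≉ψψx (trans ψx≈z (sym ψψx≈z)))))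
          (x-y≉0 (λ z≈x → x≉ψψx (trans (sym z≈x) (sym ψψx≈z))))

      -- A transposition of the preimages would negate the square root of the discriminant.
      discriminant-square⇒free : ∀ {σ} → σ * σ ≈ discriminant A (B y) → σ ≉ 0# → ψ σ ≈ σ → ψ x ≉ x →
                                 FreeBelow x (3 ^ℕ suc n)
      discriminant-square⇒free {σ} σ²≈disc σ≉0 ψσ≈σ ψx≉x k 0<k k<3N φᵏx≈x = excluded (φ^-∣ y-free y-fixed φᵏy≈y)
        where
        φᵏy≈y : φ^ k y ≈ y
        φᵏy≈y = begin
          φ^ k y                ≈⟨ φ^.⟦⟧-cong k hx≈y ⟨
          φ^ k (eval⟨ h ⟩ x)    ≈⟨ φ^-eval k h x ⟩
          eval⟨ h ⟩ (φ^ k x)    ≈⟨ eval-cong (map ι h) φᵏx≈x ⟩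
          eval⟨ h ⟩ x           ≈⟨ hx≈y ⟩
          y                     ∎
        ρ²≈disc : ρ * ρ ≈ discriminant A (B y)
        ρ²≈disc = vandermonde² (ψx≉x ∘ sym) x-root ψx-root
        -- ρ and σ are square roots of the same element and so agree up to sign.
        ψρ≈ρ : ψ ρ ≈ ρ
        ψρ≈ρ = Sum.[ (λ ρ≈σ → trans (φ^.⟦⟧-cong N ρ≈σ) (trans ψσ≈σ (sym ρ≈σ)))
                   , (λ ρ≈-σ → trans (φ^.⟦⟧-cong N ρ≈-σ) (trans (φ^.-‿homo N σ) (trans (-‿cong ψσ≈σ) (sym ρ≈-σ)))) ]′
               (square-unique (trans ρ²≈disc (sym σ²≈disc)))
        not-transposed : ψ (ψ x) ≉ x
        not-transposed ψψx≈x = *-≉0 σ≉0 σ≉0 (begin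
          σ * σ                            ≈⟨ trans σ²≈disc (sym ρ²≈disc) ⟩
          ρ * ρ                            ≈⟨ trans (*-congʳ ρ≈0) (zeroˡ ρ) ⟩
          0#                               ∎)
          where
          z : Carrier
          z = - x - ψ x
          ψz≈z : ψ z ≈ z
          ψz≈z = trans (φ^-third-root N x (ψ x)) (trans (+-congˡ (-‿cong ψψx≈x)) (+-comm _ _))
          ρ≈-ρ : ρ ≈ - ρ
          ρ≈-ρ = begin
            ρ                                            ≈⟨ ψρ≈ρ ⟨
            ψ ρ                                          ≈⟨ φ^-vandermonde N x (ψ x) z ⟩
            vandermonde (ψ x) (ψ (ψ x)) (ψ z)            ≈⟨ vandermonde-cong refl ψψx≈x ψz≈z ⟩
            vandermonde (ψ x) x z                        ≈⟨ solve 3 (λ x y z → (y :- x) :* (x :- z) :* (z :- y) :=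
                :- ((x :- y) :* (y :- z) :* (z :- x))) refl x (ψ x) z ⟩
            - ρ                                          ∎
          ρ≈0 : ρ ≈ 0#
          ρ≈0 = *-cancelˡ 2≉0 (begin
            2 · 1# * ρ        ≈⟨ solve 1 (λ r → con (+ 2) :* r := r :- (:- r)) refl ρ ⟩
            ρ - - ρ           ≈⟨ x≈y⇒x-y≈0 ρ≈-ρ ⟩
            0#                ≈⟨ zeroʳ _ ⟨
            2 · 1# * 0#       ∎)
        -- A period k of x is also one of y, hence a multiple of N. Between 0 and 3N only N and 2N
        -- remain, where ψ or ψ² would fix x.
        excluded : ¬ (N ∣ k)
        excluded (divides 0 k≡0) = ℕ.<⇒≢ 0<k (≡.sym k≡0)
        excluded (divides 1 k≡N) = ψx≉x (≡.subst (λ k → φ^ k x ≈ x) (≡.trans k≡N (ℕ.+-identityʳ N)) φᵏx≈x)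
        excluded (divides 2 k≡2N) = not-transposed (begin
          ψ (ψ x)          ≡⟨ φ^-+ N N x ⟨
          φ^ (N ℕ.+ N) x   ≡⟨ ≡.cong (λ k → φ^ k x) (≡.trans k≡2N (≡.cong (N ℕ.+_) (ℕ.+-identityʳ N))) ⟨
          φ^ k x           ≈⟨ φᵏx≈x ⟩
          x                ∎)
        excluded (divides (suc (suc (suc m))) k≡) = ℕ.<⇒≱ k<3N (ℕ.≤-trans (ℕ.*-monoˡ-≤ N (s≤s (s≤s (s≤s (z≤n {m})))))
            (ℕ.≤-reflexive (≡.sym k≡)))

  -- Cube roots of θ and condition (2)

  module Resolvents {√-3 : Carrier} (√-3²≈-3 : √-3 ^ 2 ≈ - (3 · 1#)) where

    √-3≉0 : √-3 ≉ 0#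
    √-3≉0 √-3≈0 = -‿≉0 3≉0 (trans (sym √-3²≈-3) (trans (*-congʳ √-3≈0) (zeroˡ _)))

    -- φᵏ sends √-3 to one of its two signs, so applying it twice restores √-3. This is why 2N
    -- appears in place of N below.
    φ^-√-3 : ∀ k → φ^ (k ℕ.+ k) √-3 ≈ √-3
    φ^-√-3 k = trans (reflexive (φ^-+ k k √-3)) (Sum.[ (λ fixed → trans (φ^.⟦⟧-cong k fixed) fixed)
      , (λ negated → trans (φ^.⟦⟧-cong k negated) (trans (φ^.-‿homo k √-3) (trans (-‿cong negated) (-‿involutive √-3)))) ]′
      (square-unique (begin
        φ^ k √-3 * φ^ k √-3    ≈⟨ φ^.*-homo k √-3 √-3 ⟨
        φ^ k (√-3 * √-3)       ≈⟨ φ^.⟦⟧-cong k √-3*√-3 ⟩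
        φ^ k (- (3 · 1#))      ≈⟨ Adjoin-fixed {xs = []} k [] (neg (Adjoin-numeral 3)) ⟩
        - (3 · 1#)             ≈⟨ √-3*√-3 ⟨
        √-3 * √-3              ∎)))
      where
      √-3*√-3 : √-3 * √-3 ≈ - (3 · 1#)
      √-3*√-3 = trans (*-congˡ (sym (*-identityʳ √-3))) √-3²≈-3

    module _ (n : ℕ) {y μ : Carrier} (y-root : eval⟨ f n ⟩ y ≈ 0#) (y-free : FreeBelow y (3 ^ℕ n))
             (disc≈ : discriminant A (B y) ≈ 81 · (μ ^ 2)) where
      open Preimages n y-root y-free
      open Resolvent {√-3} {A} {B y} {μ} √-3²≈-3 disc≈

      -- For b₁ nonzero A is nonzero, and then 27θθ′ = -A³ already prevents θ = 0.
      b₁≈0⇒θ≉0⇒θ≉0 : (b₁ F.≈ F.0# → θ ≉ 0#) → θ ≉ 0#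
      b₁≈0⇒θ≉0⇒θ≉0 hyp θ≈0 = hyp (decidable-stable (b₁ F.≟ F.0#)
        λ b₁≉0 → A≉0⇒θ≉0 (*-≉0 (ι.homo-≉0 b₁≉0) (⁻¹-≉0 k₃≉0)) θ≈0) θ≈0

      -- Cardano's formula would produce a preimage of y inside F(√-3, y). That field is fixed by
      -- ψ², so the preimage would have the period 2N < 3N.
      free⇒θ-noncube : (∀ {x} → eval⟨ h ⟩ x ≈ y → FreeBelow x (3 ^ℕ suc n)) → θ ≉ 0# →
                       ¬ (∃ λ u → Adjoin F K ι (√-3 ∷ y ∷ []) u × u ^ 3 ≈ θ)
      free⇒θ-noncube free θ≉0 (u , u∈ , u³≈θ) =
        free (cubic-root⇒preimage (proj₂ solution)) (N ℕ.+ N) 0<N+N 2N<3N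
          (Adjoin-fixed (N ℕ.+ N) (φ^-√-3 N ∷ trans (reflexive (φ^-+ N N y)) (trans (φ^.⟦⟧-cong N y-fixed) y-fixed) ∷ []) x∈)
        where
        solution : u ≉ 0# × cubic A (B y) (u + - A / (3 · 1# * u)) ≈ 0#
        solution = cardano θ≉0 u³≈θ
        x∈ : Adjoin F K ι (√-3 ∷ y ∷ []) (u + - A / (3 · 1# * u))
        x∈ = add u∈ (mul (neg A∈F) (inv (*-≉0 3≉0 (proj₁ solution)) (mul (Adjoin-numeral 3) u∈)))

      -- A preimage x fixed by ψ lies in F(y), as does μ; then `resolvent x` lies in F(√-3, y) and
      -- its cube is θ.
      θ-noncube⇒moved : ψ μ ≈ μ → μ ≉ 0# → ¬ (∃ λ u → Adjoin F K ι (√-3 ∷ y ∷ []) u × u ^ 3 ≈ θ) →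
                        ∀ {x} → eval⟨ h ⟩ x ≈ y → ψ x ≉ x
      θ-noncube⇒moved ψμ≈μ μ≉0 noncube {x} hx≈y ψx≈x = noncube (resolvent x , u∈ , proj₂ solution)
        where
        solution : 3 · 1# * (x * x) + A ≉ 0# × resolvent x ^ 3 ≈ θ
        solution = resolvent³ μ≉0 (preimage⇒cubic-root hx≈y)
        fixed∈ : ∀ {z} → ψ z ≈ z → Adjoin F K ι (√-3 ∷ y ∷ []) z
        fixed∈ ψz≈z = Adjoin-monotone there (fixed⇒Adjoin (3^n>0 n) y-free y-fixed ψz≈z)
        u∈ : Adjoin F K ι (√-3 ∷ y ∷ []) (resolvent x)
        u∈ = mul (add (fixed∈ ψx≈x) (mul (mul (Adjoin-numeral 3) (mul (fixed∈ ψμ≈μ) (generator (here refl))))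
                   (inv (proj₁ solution) (add (mul (Adjoin-numeral 3) (mul (fixed∈ ψx≈x) (fixed∈ ψx≈x))) A∈F))))
                 (inv 2≉0 (Adjoin-numeral 2))

    -- Definitionally the θ of `Resolvent`, but available before 81μ² is known to be the
    -- discriminant.
    θ : Carrier → Carrier → Carrier
    θ y μ = (1# / (2 · 1#)) * (- B y + μ * √-3)

    -- θ y μ and θ y (- μ) do not both vanish.
    nonvanishing-sign : ∀ k {y σ} → σ * σ ≈ discriminant A (B y) → σ ≉ 0# → φ^ k σ ≈ σ →
      ∃ λ μ → μ ≉ 0# × φ^ k μ ≈ μ × discriminant A (B y) ≈ 81 · (μ ^ 2) × θ y μ ≉ 0#
    nonvanishing-sign k {y} {σ} σ²≈disc σ≉0 φσ≈σ = choose (θ y μ ≟ 0#)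
      where
      9≉0 : 9 · 1# ≉ 0#
      9≉0 9≈0 = *-≉0 3≉0 3≉0 (trans (solve 0 (con (+ 3) :* con (+ 3) := con (+ 9)) refl) 9≈0)
      μ : Carrier
      -- 81μ² = σ² amounts to σ = ± 9μ.
      μ = σ / (9 · 1#)
      μ≉0 : μ ≉ 0#
      μ≉0 = *-≉0 σ≉0 (⁻¹-≉0 9≉0)
      φμ≈μ : φ^ k μ ≈ μ
      φμ≈μ = trans (φ^.*-homo k _ _) (*-cong φσ≈σ (Adjoin-fixed {xs = []} k [] (inv 9≉0 (Adjoin-numeral 9))))
      disc≈ : discriminant A (B y) ≈ 81 · (μ ^ 2)
      disc≈ = begin
        discriminant A (B y)               ≈⟨ σ²≈disc ⟨
        σ * σ                              ≈⟨ *-cong (x*[y/x]≈y σ 9≉0) (x*[y/x]≈y σ 9≉0) ⟨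
        9 · 1# * μ * (9 · 1# * μ)          ≈⟨ solve 1 (λ m → con (+ 9) :* m :* (con (+ 9) :* m) := con (+ 81) :* m :^ 2) refl μ ⟩
        81 · 1# * μ ^ 2                    ≈⟨ ·-as-* 81 (μ ^ 2) ⟨
        81 · (μ ^ 2)                       ∎
      opposite : θ y μ ≈ 0# → θ y (- μ) ≉ 0#
      opposite θμ≈0 θ-μ≈0 = *-≉0 (*-≉0 1≉0 (⁻¹-≉0 2≉0)) (*-≉0 2≉0 (*-≉0 μ≉0 √-3≉0)) (begin
        1# / (2 · 1#) * (2 · 1# * (μ * √-3))
          ≈⟨ solve 4 (λ i B m s → i :* (con (+ 2) :* (m :* s)) :=
              i :* (:- B :+ m :* s) :- i :* (:- B :+ (:- m) :* s)) refl (1# / (2 · 1#)) (B y) μ √-3 ⟩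
        θ y μ - θ y (- μ)
          ≈⟨ x≈y⇒x-y≈0 (trans θμ≈0 (sym θ-μ≈0)) ⟩
        0# ∎)
      choose : Dec (θ y μ ≈ 0#) → _
      choose (no  θμ≉0) = μ , μ≉0 , φμ≈μ , disc≈ , θμ≉0
      choose (yes θμ≈0) = - μ , -‿≉0 μ≉0 , trans (φ^.-‿homo k μ) (-‿cong φμ≈μ) ,
        trans disc≈ (×-congʳ 81 (solve 1 (λ m → m :^ 2 := (:- m) :^ 2) refl μ)) , opposite θμ≈0
        where open MonoidMultProperties +-monoid using (×-congʳ)

  -- Irreducibility as freeness of orbits, and the induction on levels

  -- Dynamical irreducibility starts at n = 1; at n = 0 there is nothing to show, since no k
  -- satisfies 0 < k < 3⁰. All roots are covered, because later a preimage of `β n` other than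
  -- `β (suc n)` may be used.
  irreducible⇒free : F[X].DynamicallyIrreducible h β₀ → ∀ n {x} → eval⟨ f n ⟩ x ≈ 0# → FreeBelow x (3 ^ℕ n)
  irreducible⇒free irr zero    fx≈0 k 0<k k<1 = contradiction 0<k (ℕ.<⇒≱ k<1)
  irreducible⇒free irr (suc n) fx≈0 = irreducible⇒FreeBelow (f-leading (suc n)) (lc≉0 (suc n)) fx≈0 (irr (suc n) (s≤s z≤n))

  free⇒irreducible : ∀ (β : ℕ → Carrier) → (∀ n → eval⟨ f n ⟩ (β n) ≈ 0#) → (∀ n → FreeBelow (β n) (3 ^ℕ n)) →
                     F[X].DynamicallyIrreducible h β₀
  free⇒irreducible β β-root free n _ = FreeBelow⇒irreducible {α = β n} (f-leading n) (lc≉0 n) (β-root n) (free n)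

  module Criterion {√-3 : Carrier} (√-3²≈-3 : √-3 ^ 2 ≈ - (3 · 1#))
    (γ₁ γ₂ : Carrier) (critical : RootsWithMultiplicity (map ι (F[X].derivative h)) (γ₁ ∷ γ₂ ∷ []))
    (β : ℕ → Carrier) (β-root : ∀ n → eval⟨ f n ⟩ (β n) ≈ 0#) where
    open CriticalPoints γ₁ γ₂ critical
    open Resolvents √-3²≈-3

    SquareCondition : ℕ → Set _
    SquareCondition n = δ n ≉ 0# × (∃ λ (c : F.Carrier) → ι c ^ 2 ≈ δ n)

    NoncubeCondition : ℕ → Set _
    NoncubeCondition n = ∀ μ → Adjoin F K ι (β n ∷ []) μ → μ ≉ 0# → discriminant A (B (β n)) ≈ 81 · (μ ^ 2) →
      (b₁ F.≈ F.0# → θ (β n) μ ≉ 0#) → ¬ (∃ λ y → Adjoin F K ι (√-3 ∷ β n ∷ []) y × (y ^ 3 ≈ θ (β n) μ))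

    module _ (free : ∀ n {x} → eval⟨ f n ⟩ x ≈ 0# → FreeBelow x (3 ^ℕ n)) where

      free⇒square : ∀ n → SquareCondition n
      free⇒square n = Norm.fixed⇒square n (β-root n) (free n (β-root n)) ρ²≈disc ρ≉0 ψρ≈ρ
        where
        x : Carrier
        x = proj₁ (preimage (β n))
        hx≈β : eval⟨ h ⟩ x ≈ β n
        hx≈β = proj₂ (preimage (β n))
        square : ∃ λ ρ → ρ * ρ ≈ discriminant A (B (β n)) × ρ ≉ 0# × φ^ (3 ^ℕ n) ρ ≈ ρ
        square = Preimages.free⇒discriminant-square n (β-root n) (free n (β-root n)) hx≈β
          (free (suc n) (preimage-root n hx≈β (β-root n)))
        ρ²≈disc = proj₁ (proj₂ square)
        ρ≉0 = proj₁ (proj₂ (proj₂ square))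
        ψρ≈ρ = proj₂ (proj₂ (proj₂ square))

      free⇒noncube : ∀ n → NoncubeCondition n
      free⇒noncube n μ _ _ disc≈ hyp = free⇒θ-noncube n (β-root n) (free n (β-root n)) disc≈
        (λ hx≈β → free (suc n) (preimage-root n hx≈β (β-root n)))
        (b₁≈0⇒θ≉0⇒θ≉0 n (β-root n) (free n (β-root n)) disc≈ hyp)

    -- Freeness is first shown for a preimage x of `β n`. Since x and `β (suc n)` are roots of the
    -- same polynomial, `FreeBelow-conjugate` then transfers it.
    free-suc : ∀ n → SquareCondition n → NoncubeCondition n → FreeBelow (β n) (3 ^ℕ n) → FreeBelow (β (suc n)) (3 ^ℕ suc n)
    free-suc n square noncube free =
      FreeBelow-conjugate (f-leading (suc n)) (lc≉0 (suc n)) (preimage-root n hx≈β (β-root n)) (β-root (suc n))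
        (discriminant-square⇒free hx≈β σ²≈disc (proj₁ σ-fixed) (proj₂ σ-fixed) ψx≉x)
      where
      open Preimages n (β-root n) free
      x σ : Carrier
      x = proj₁ (preimage (β n))
      σ = proj₁ (square-root (discriminant A (B (β n))))
      hx≈β : eval⟨ h ⟩ x ≈ β n
      hx≈β = proj₂ (preimage (β n))
      σ²≈disc : σ * σ ≈ discriminant A (B (β n))
      σ²≈disc = proj₂ (square-root (discriminant A (B (β n))))
      σ-fixed : σ ≉ 0# × ψ σ ≈ σ
      σ-fixed = Norm.square⇒fixed n (β-root n) free σ²≈disc square
      ψx≉x : ψ x ≉ x
      ψx≉x =
        -- The noncube condition is applied to a sign of μ with θ nonzero, whatever b₁ is. Being
        -- fixed by ψ, this μ lies in F(βₙ).
        let μ , μ≉0 , ψμ≈μ , disc≈ , θ≉0 = nonvanishing-sign N {β n} σ²≈disc (proj₁ σ-fixed) (proj₂ σ-fixed)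
            μ∈ = fixed⇒Adjoin (3^n>0 n) free y-fixed ψμ≈μ
        in θ-noncube⇒moved n (β-root n) free disc≈ ψμ≈μ μ≉0 (noncube μ μ∈ μ≉0 disc≈ (λ _ → θ≉0)) hx≈β

    free-all : (∀ n → SquareCondition n) → (∀ n → NoncubeCondition n) → ∀ n → FreeBelow (β n) (3 ^ℕ n)
    free-all square noncube zero    k 0<k k<1 = contradiction 0<k (ℕ.<⇒≱ k<1)
    free-all square noncube (suc n) = free-suc n (square n) (noncube n) (free-all square noncube n)

    criterion : F[X].DynamicallyIrreducible h β₀ ⇔ ((∀ n → SquareCondition n) × (∀ n → NoncubeCondition n))
    criterion = mk⇔
      (λ irr → free⇒square (irreducible⇒free irr) , free⇒noncube (irreducible⇒free irr))
      (λ conditions → free⇒irreducible β β-root (free-all (proj₁ conditions) (proj₂ conditions)))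

proposition2 :
  ∀ {a ℓ₁ b ℓ₂} (p s : ℕ) → Prime p → 3 < p → 0 < s →
  (F : Field a ℓ₁) → HasCardinality F (p ^ℕ s) →
  (F̄ : Field b ℓ₂) (ι : Field.Carrier F → Field.Carrier F̄) → IsAlgebraicClosure F F̄ ι →
  let module F = Field F
      module F[X] = Polynomial F.rawRing
      open Field F̄
      module F̄[X] = Polynomial rawRing
      F⟮_⟯ = Adjoin F F̄ ι
  in
  (√-3 : Carrier) → √-3 ^ 2 ≈ - (3 · 1#) →
  (b₀ b₁ b₃ : F.Carrier) → b₃ F.≉ F.0# →
  (β₀ : F.Carrier) →
  let h = b₀ ∷ b₁ ∷ F.0# ∷ b₃ ∷ [] in
  (γ₁ γ₂ : Carrier) → F̄[X].RootsWithMultiplicity (map ι (F[X].derivative h)) (γ₁ ∷ γ₂ ∷ []) →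
  (β : ℕ → Carrier) → (∀ n → F̄[X].eval (map ι (h F[X].^∘ n F[X].-ₚ F[X].C β₀)) (β n) ≈ 0#) →
  let h^ : ℕ → Carrier → Carrier
      h^ n = F̄[X].eval (map ι (h F[X].^∘ n))
      A : Carrier
      A = ι b₁ / ι b₃
      B : ℕ → Carrier
      B n = (ι b₀ - β n) / ι b₃
      δ : ℕ → Carrier
      δ n = - (3 · 1#) * (h^ (suc n) γ₁ - ι β₀) * (h^ (suc n) γ₂ - ι β₀)
      θ : ℕ → Carrier → Carrier
      θ n μ = (1# / (2 · 1#)) * (- B n + μ * √-3)
  in
  F[X].DynamicallyIrreducible h β₀
    ⇔
  ( (∀ n → (δ n ≉ 0#) × (∃ λ (c : F.Carrier) → ι c ^ 2 ≈ δ n))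
  × (∀ n (μ : Carrier) → F⟮ β n ∷ [] ⟯ μ → μ ≉ 0# →
       - (4 · (A ^ 3)) - 27 · (B n ^ 2) ≈ 81 · (μ ^ 2) →
       (b₁ F.≈ F.0# → θ n μ ≉ 0#) →
       ¬ (∃ λ y → F⟮ √-3 ∷ β n ∷ [] ⟯ y × (y ^ 3 ≈ θ n μ))) )
-- The abbreviations of the statement unfold to those of `Criterion`, so both conditions agree
-- definitionally.
proposition2 p s pp 3<p 0<s F card F̄ ι closure √-3 √-3²≈-3 b₀ b₁ b₃ b₃≉0 β₀ γ₁ γ₂ critical β β-root =
  CubicDynamics.Criterion.criterion s pp 3<p 0<s F card F̄ ι closure b₀ b₁ b₃ b₃≉0 β₀ √-3²≈-3 γ₁ γ₂ critical β β-root
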